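{- For every $\epsilon>0$ there exist a constant $c>0$ and, for infinitely many $n$, a simple undirected unweighted graph $G$ on $n$ nodes together with an initial coloring of its nodes with two colors, such that the stabilization time of the minority process on $G$ is at least $c\,n^{2-\epsilon}$ (i.e., $\Omega(n^{2-\epsilon})$) in each of the following models: (B) sequential benevolent, (C) independent benevolent, (D) free benevolent, (E) concurrent synchronous, (F) sequential random, and (G) concurrent random; in the randomized models this holds for every possible execution.
   Context: Let $G$ be a simple, unweighted, undirected graph whose nodes are colored with two colors (black and white). A node $v$ is switchable in the current coloring if, with $v$ currently colored $c_1$, the other color $c_2$ occurs strictly fewer times than $c_1$ among the neighbors of $v$; switching $v$ means changing its color to the color least frequent in its neighborhood (with two colors: to the other color). The minority process is a sequence of steps, each step consisting of a set of nodes that switch simultaneously; a step is valid only if every chosen node is switchable in the coloring before the step. A coloring is stable if no node is switchable, and the stabilization time is the number of steps until a stable coloring is reached. Models: (B) sequential benevolent: each step switches exactly one switchable node, chosen by a benevolent player who minimizes the number of steps until stabilization; (C) independent benevolent: in each step the benevolent player chooses any independent set of switchable nodes and switches them simultaneously; (D) free benevolent: in each step the benevolent player chooses any set of switchable nodes and switches them simultaneously; (E) concurrent synchronous: in each step all switchable nodes switch simultaneously; (F) sequential random: in each step exactly one node switches, chosen uniformly at random among the switchable nodes; (G) concurrent random: in each step every switchable node switches independently with some fixed probability $p$. -}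

module Defs where

open import Data.Nat using (ℕ; zero; suc; _+_; _*_; _^_; _≤_; _<_)
open import Data.Bool using (Bool; true; false; not; _∧_; _xor_; if_then_else_)
open import Data.Fin using (Fin)
open import Data.List using (List; length; filterᵇ; allFin)
open import Data.Product using (Σ; _×_; ∃)
open import Relation.Binary.PropositionalEquality using (_≡_)
open import Relation.Nullary using (¬_)

record SimpleGraph (n : ℕ) : Set where
  field
    Adj   : Fin n → Fin n → Bool
    sym   : ∀ u v → Adj u v ≡ Adj v u
    irrefl : ∀ v → Adj v v ≡ false
open SimpleGraph public

-- Two colours: black = true, white = false.
Coloring : ℕ → Set
Coloring n = Fin n → Bool

NodeSet : ℕ → Set
NodeSet n = Fin n → Bool

module _ {n : ℕ} (G : SimpleGraph n) where

  nbrCount : Coloring n → Fin n → Bool → ℕ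
  nbrCount x v c = length (filterᵇ (λ u → Adj G v u ∧ not (x u xor c)) (allFin n))

  Switchable : Coloring n → Fin n → Set
  Switchable x v = nbrCount x v (not (x v)) < nbrCount x v (x v)

  Stable : Coloring n → Set
  Stable x = ∀ v → ¬ Switchable x v

  switch : NodeSet n → Coloring n → Coloring n
  switch S x v = if S v then not (x v) else x v

  ValidStep : Coloring n → NodeSet n → Set
  ValidStep x S = ∀ v → S v ≡ true → Switchable x v

  NonEmpty : NodeSet n → Set
  NonEmpty S = ∃ λ v → S v ≡ true

  SingleSwitch : Coloring n → NodeSet n → Set
  SingleSwitch x S = Σ (Fin n) λ v → Switchable x v × (∀ u → S u ≡ true → u ≡ v) × (S v ≡ true)

  -- A model = which step sets are allowed in a given colouring.
  Model : Set₁
  Model = Coloring n → NodeSet n → Set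

  modelB : Model
  modelB = SingleSwitch
  modelC : Model
  modelC x S = ValidStep x S × NonEmpty S ×
               (∀ u v → S u ≡ true → S v ≡ true → Adj G u v ≡ false)
  modelD : Model
  modelD x S = ValidStep x S × NonEmpty S
  modelE : Model
  modelE x S = ∀ v → (S v ≡ true → Switchable x v) × (Switchable x v → S v ≡ true)
  -- (F) sequential random: possible steps = one switchable node
  modelF : Model
  modelF = SingleSwitch
  -- (G) concurrent random (fixed 0 < p < 1): possible steps = any subset of the
  -- switchable nodes (each switches independently with probability p)
  modelG : Model
  modelG x S = ValidStep x S

  data ReachesStable (M : Model) : Coloring n → ℕ → Set where
    done : ∀ {x} → Stable x → ReachesStable M x zero
    step : ∀ {x k} (S : NodeSet n) → M x S →
           ReachesStable M (switch S x) k → ReachesStable M x (suc k)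

  -- The stabilisation time from x in model M is at least the bound B, i.e.
  -- every (benevolently chosen / possible) execution that stabilises uses at
  -- least B steps: expressed as "B k holds for each such length k".
  StabTimeAtLeast : Model → Coloring n → (ℕ → Set) → Set
  StabTimeAtLeast M x B = ∀ k → ReachesStable M x k → B k

-- With ε = p/q and c = a/b (positive rationals), and n ≥ 1:
--   c · n^(2-ε) ≤ k   ⇔   a^q · n^(2q) ≤ b^q · k^q · n^p
AtLeastCN2minusEps : (p q a b n : ℕ) → ℕ → Set
AtLeastCN2minusEps p q a b n k = a ^ q * n ^ (2 * q) ≤ b ^ q * k ^ q * n ^ p

LowerBoundAllModels : ∀ {n} → SimpleGraph n → Coloring n → (ℕ → Set) → Set
LowerBoundAllModels G x B =
  StabTimeAtLeast G (modelB G) x B × StabTimeAtLeast G (modelC G) x B ×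
  StabTimeAtLeast G (modelD G) x B × StabTimeAtLeast G (modelE G) x B ×
  StabTimeAtLeast G (modelF G) x B × StabTimeAtLeast G (modelG G) x B

{-# OPTIONS --safe #-}
module Submission where

open import Defs using (SimpleGraph; Coloring; LowerBoundAllModels; AtLeastCN2minusEps)
open import Data.Bool as Bool using (Bool; true; false; not; _∧_; _∨_; _xor_; if_then_else_)
open import Data.Bool.Properties using (∧-identityʳ; ∧-zeroʳ; ∨-comm; ∨-identityʳ; not-involutive)
open import Data.Empty using (⊥; ⊥-elim)
open import Data.Fin as Fin using (Fin; zero; suc; toℕ; fromℕ; inject₁)
import Data.Fin.Induction as Fin
import Data.Fin.Properties as Fin
open import Data.Fin.Relation.Unary.Top using (view; ‵fromℕ; ‵inject₁)
open import Data.Integer as ℤ using (ℤ; +_; 0ℤ; 1ℤ; -1ℤ; _+_; _-_; -_; _≤_; _<_; +≤+; -≤+; -<+; +<+)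
import Data.Integer.Properties as ℤ
open import Data.Integer.Tactic.RingSolver using (solve-∀)
open import Data.List using (length; filterᵇ; tabulate)
open import Data.Nat as ℕ using (ℕ; zero; suc; z≤n; s≤s; _*_; _^_; _∸_)
import Data.Nat.Properties as ℕ
import Data.Nat.Tactic.RingSolver as ℕSolver
open import Data.Product using (Σ; Σ-syntax; ∃; _×_; _,_; proj₁; proj₂)
open import Data.Product.Properties using (≡-dec)
open import Data.Sum using (_⊎_; inj₁; inj₂)
open import Data.Unit using (⊤; tt)
open import Function using (_∘_; id)
open import Relation.Binary.Definitions using (tri<; tri≈; tri>)
open import Relation.Binary.PropositionalEquality
open import Relation.Nullary using (¬_; Dec; yes; no; does)
open import Relation.Nullary.Decidable using (dec-true; dec-false; decidable-stable; ¬?)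

-- All models only allow steps that switch switchable nodes, so it suffices to build graphs on
-- which every sequence of such steps is long.  In a suitable frame the process is the zero
-- temperature dynamics of a spin system with couplings ±1, where a node follows the sign of
-- the field of its neighbours.
--
-- The graph is a tower of levels. A level is a ring of g segments of N units each, with groups of
-- nodes in every unit that flip one after the other: all A flip, then all S and Z, then E, then
-- X, and this releases the A of the next unit. The weights are such that the field of A, E and X
-- is only 1 or 2 at the moment at which they may flip, so that one missing predecessor blocks
-- them; S and Z may start early, but E and X wait for all of them. The nodes S of a segment
-- reverse the field of the A of the level below; when the last unit of the segment has flipped,
-- it triggers a wave through the level below, and the next segment waits for the end of this
-- wave. Segments act with alternating signs and g is odd. So a wave through one level contains g
-- waves through the level below, and since the final state of a wave is the negative of its
-- initial state, the wave can be repeated with opposite signs.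
--
-- The energy of a wave is supplied by the S of the level above.  Each of them serves
-- only O(g) groups A, which makes the weights grow by a factor O(g) per level while the number of
-- units shrinks by the same factor.  With K + 1 levels this gives n = O(g^(K+2)) nodes and at least
-- g^(2K+1) steps, that is, n^(2-ε) up to a constant if K is large.

-- Integer inequalities are reduced to ring identities: to show x ≤ y, write
-- y - x as a sum of terms known to be nonnegative.

-- The player of model D may leave switchable nodes idle or flip many at once, so no order of flips
-- can be imposed. Two effects replace it. A tie is never switchable and one missing neighbour
-- changes a field by 2, so a field of 1 or 2 after all predecessors have flipped acts as a
-- conjunction. And the cells that flip within a stage attract each other, so the field of a flipped
-- cell never decreases and the order inside the stage does not matter; all other nodes must be
-- stable in every state of the stage. Such margins are fragile because couplings are symmetric:
-- whatever a node drives pulls back on it with the same weight. Hence the balancing edges. The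
-- unflipped A and S of the next unit cancel the pulls of S on X and of A on E; S cancels the pull
-- of the next A on W; the nodes G cancel the pull of the heads on the last X. Closing the ring by a
-- repulsive link gives the first and the last unit the same environment as the others. It also
-- makes the first unit look released from the start, so its nodes A, the heads, need a trigger of
-- their own from the next level.

infixr 6 _⊕_

_⊕_ : ∀ {a b} → 0ℤ ≤ a → 0ℤ ≤ b → 0ℤ ≤ a + b
_⊕_ = ℤ.+-mono-≤

nonneg : ∀ n → 0ℤ ≤ + n
nonneg n = +≤+ z≤n

gap : ∀ {x y} → x ≤ y → 0ℤ ≤ y - x
gap = ℤ.i≤j⇒0≤j-i

≤-by : ∀ {x y d} → 0ℤ ≤ d → y - x ≡ d → x ≤ y
≤-by p e = ℤ.0≤i-j⇒j≤i (subst (0ℤ ≤_) (sym e) p)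

<-by : ∀ {x y d} → 0ℤ ≤ d → y - (1ℤ + x) ≡ d → x < y
<-by p e = ℤ.suc[i]≤j⇒i<j (≤-by p e)

gap< : ∀ {x y} → x < y → 0ℤ ≤ y - (1ℤ + x)
gap< p = gap (ℤ.i<j⇒suc[i]≤j p)

absurd-by : ∀ {d} {A : Set} → 0ℤ ≤ d → d ≡ -1ℤ → A
absurd-by () refl

sp : Bool → ℤ
sp true  = 1ℤ
sp false = -1ℤ

sp≤1 : ∀ b → sp b ≤ 1ℤ
sp≤1 true  = ℤ.≤-refl
sp≤1 false = -≤+

-1≤sp : ∀ b → -1ℤ ≤ sp b
-1≤sp true  = -≤+
-1≤sp false = ℤ.≤-refl

sp-not : ∀ b → sp (not b) ≡ - sp b
sp-not true  = refl
sp-not false = refl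

true≢false : ∀ {b} {A : Set} → b ≡ true → b ≡ false → A
true≢false refl ()

-- Sums over finite types

∑ : ∀ {n} → (Fin n → ℤ) → ℤ
∑ {zero}  f = 0ℤ
∑ {suc n} f = f zero + ∑ (f ∘ suc)

∑-cong : ∀ {n} {f g : Fin n → ℤ} → (∀ i → f i ≡ g i) → ∑ f ≡ ∑ g
∑-cong {zero}  h = refl
∑-cong {suc n} h = cong₂ _+_ (h zero) (∑-cong (h ∘ suc))

∑-mono : ∀ {n} {f g : Fin n → ℤ} → (∀ i → f i ≤ g i) → ∑ f ≤ ∑ g
∑-mono {zero}  h = ℤ.≤-refl
∑-mono {suc n} h = ℤ.+-mono-≤ (h zero) (∑-mono (h ∘ suc))

∑-neg : ∀ {n} (f : Fin n → ℤ) → ∑ (-_ ∘ f) ≡ - ∑ f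
∑-neg {zero}  f = refl
∑-neg {suc n} f = trans (cong (λ t → - f zero + t) (∑-neg (f ∘ suc))) (sym (ℤ.neg-distrib-+ (f zero) _))

∑-zero : ∀ {n} {f : Fin n → ℤ} → (∀ i → f i ≡ 0ℤ) → ∑ f ≡ 0ℤ
∑-zero {zero}  h = refl
∑-zero {suc n} h = cong₂ _+_ (h zero) (∑-zero (h ∘ suc))

∑-+ : ∀ {n} (f g : Fin n → ℤ) → ∑ (λ i → f i + g i) ≡ ∑ f + ∑ g
∑-+ {zero}  f g = refl
∑-+ {suc n} f g = trans (cong (λ t → (f zero + g zero) + t) (∑-+ (f ∘ suc) (g ∘ suc)))
                        (lemma (f zero) (g zero) (∑ (f ∘ suc)) (∑ (g ∘ suc)))
  where lemma : ∀ a b c d → (a + b) + (c + d) ≡ (a + c) + (b + d)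
        lemma = solve-∀

∑-const : ∀ n → ∑ {n} (λ _ → 1ℤ) ≡ + n
∑-const zero    = refl
∑-const (suc n) = cong (λ t → 1ℤ + t) (∑-const n)

∑-pick : ∀ {n} (c : Fin n) (f : Fin n → ℤ) → (∀ i → i ≢ c → f i ≡ 0ℤ) → ∑ f ≡ f c
∑-pick zero    f h = trans (cong (λ t → f zero + t) (∑-zero (λ i → h (suc i) λ ()))) (ℤ.+-identityʳ _)
∑-pick (suc c) f h = trans (cong₂ _+_ (h zero λ ()) (∑-pick c (f ∘ suc) λ i i≢c → h (suc i) (i≢c ∘ Fin.suc-injective)))
                           (ℤ.+-identityˡ _)

∑-at-most-one : ∀ {n c} (f : Fin n → ℤ) → (∀ i j → f i ≢ 0ℤ → f j ≢ 0ℤ → i ≡ j) → (∀ i → f i ≤ c) → 0ℤ ≤ c → ∑ f ≤ c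
∑-at-most-one f unique bound 0≤c with Fin.any? (λ i → ¬? (f i ℤ.≟ 0ℤ))
... | yes (i , fi≢0) = ℤ.≤-trans (ℤ.≤-reflexive (∑-pick i f λ j j≢i →
        decidable-stable (f j ℤ.≟ 0ℤ) λ fj≢0 → j≢i (unique j i fj≢0 fi≢0))) (bound i)
... | no none        = ℤ.≤-trans (ℤ.≤-reflexive (∑-zero λ j → decidable-stable (f j ℤ.≟ 0ℤ) λ fj≢0 → none (j , fj≢0))) 0≤c

∑-split : ∀ m {n} (f : Fin m ⊎ Fin n → ℤ) → ∑ (f ∘ inj₁) + ∑ (f ∘ inj₂) ≡ ∑ (f ∘ Fin.splitAt m)
∑-split zero    f = ℤ.+-identityˡ _
∑-split (suc m) f = trans (ℤ.+-assoc (f (inj₁ zero)) _ _) (cong (λ t → f (inj₁ zero) + t) (trans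
  (∑-split m (f ∘ map₁ suc))
  (∑-cong lemma)))
  where
  open import Data.Sum using (map₁)
  lemma : ∀ i → f (map₁ suc (Fin.splitAt m i)) ≡ f (Fin.splitAt (suc m) (suc i))
  lemma i = refl

∑-product : ∀ m {n} (f : Fin m × Fin n → ℤ) → ∑ (λ i → ∑ λ j → f (i , j)) ≡ ∑ (f ∘ Fin.remQuot {m} n)
∑-product zero        f = refl
∑-product (suc m) {n} f = trans
  (cong (λ t → ∑ (λ j → f (zero , j)) + t) (∑-product m {n} (f ∘ λ (i , j) → suc i , j)))
  (trans (∑-split n {m * n} h) (∑-cong lemma))
  where
  open import Data.Product using (map₁)
  h : Fin n ⊎ Fin (m * n) → ℤ
  h (inj₁ j) = f (zero , j)
  h (inj₂ k) = f (map₁ suc (Fin.remQuot {m} n k))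
  lemma : ∀ i → h (Fin.splitAt n i) ≡ f (Fin.remQuot {suc m} n i)
  lemma i with Fin.splitAt n i
  ... | inj₁ j = refl
  ... | inj₂ k = refl

-- `sum` is kept apart from its value `∑ (f ∘ to)` so that sums over disjoint unions and products
-- unfold to nested sums, the form in which the fields are computed.
record Finite (A : Set) : Set where
  field
    size    : ℕ
    to      : Fin size → A
    from    : A → Fin size
    to-from : ∀ a → to (from a) ≡ a
    from-to : ∀ i → from (to i) ≡ i
    sum     : (A → ℤ) → ℤ
    sum-∑   : ∀ f → sum f ≡ ∑ (f ∘ to)

  sum-cong : ∀ {f g} → (∀ a → f a ≡ g a) → sum f ≡ sum g
  sum-cong {f} {g} h = trans (sum-∑ f) (trans (∑-cong (h ∘ to)) (sym (sum-∑ g)))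

  sum-mono : ∀ {f g} → (∀ a → f a ≤ g a) → sum f ≤ sum g
  sum-mono {f} {g} h = subst₂ _≤_ (sym (sum-∑ f)) (sym (sum-∑ g)) (∑-mono (h ∘ to))

  sum-neg : ∀ f → sum (-_ ∘ f) ≡ - sum f
  sum-neg f = trans (sum-∑ (-_ ∘ f)) (trans (∑-neg (f ∘ to)) (cong -_ (sym (sum-∑ f))))

  sum-zero : ∀ {f} → (∀ a → f a ≡ 0ℤ) → sum f ≡ 0ℤ
  sum-zero {f} h = trans (sum-∑ f) (∑-zero (h ∘ to))

  sum-one : sum (λ _ → 1ℤ) ≡ + size
  sum-one = trans (sum-∑ _) (∑-const size)

  sum-pick : ∀ c (f : A → ℤ) → (∀ a → a ≢ c → f a ≡ 0ℤ) → sum f ≡ f c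
  sum-pick c f h = trans (sum-∑ f) (trans
    (∑-pick (from c) (f ∘ to) λ i i≢ → h (to i) λ e → i≢ (trans (sym (from-to i)) (cong from e)))
    (cong f (to-from c)))

  sum-≤ : ∀ {f} → (∀ a → f a ≤ 1ℤ) → sum f ≤ + size
  sum-≤ h = ℤ.≤-trans (sum-mono h) (ℤ.≤-reflexive sum-one)

  -≤sum : ∀ {f} → (∀ a → -1ℤ ≤ f a) → - + size ≤ sum f
  -≤sum h = ℤ.≤-trans (ℤ.≤-reflexive (sym (trans (sum-neg _) (cong -_ sum-one)))) (sum-mono h)

  spins : (A → Bool) → ℤ
  spins x = sum (sp ∘ x)

  spins-all : ∀ {x} b → (∀ a → x a ≡ b) → spins x ≡ (if b then + size else - + size)
  spins-all true  h = trans (sum-cong (cong sp ∘ h)) sum-one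
  spins-all false h = trans (sum-cong (cong sp ∘ h)) (trans (sum-neg _) (cong -_ sum-one))

  spins-≤ : ∀ x → spins x ≤ + size
  spins-≤ x = sum-≤ λ a → sp≤1 (x a)

  -≤spins : ∀ x → - + size ≤ spins x
  -≤spins x = -≤sum λ a → -1≤sp (x a)

  all⊎missing : (x : A → Bool) → (∀ a → x a ≡ true) ⊎ (∃ λ a → x a ≡ false)
  all⊎missing x with Fin.any? (λ i → x (to i) Bool.≟ false)
  ... | yes (i , e) = inj₂ (to i , e)
  ... | no ¬e       = inj₁ λ a → lemma (x a) λ e → ¬e (from a , trans (cong x (to-from a)) e)
    where
    lemma : ∀ b → b ≢ false → b ≡ true
    lemma true  h = refl
    lemma false h = ⊥-elim (h refl)

  private
    ∑-missing : ∀ {n} (x : Fin n → Bool) i → x i ≡ false → ∑ (sp ∘ x) + + 2 ≤ + n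
    ∑-missing {suc n} x zero e rewrite e =
      ≤-by (gap (ℤ.≤-trans (∑-mono (sp≤1 ∘ x ∘ suc)) (ℤ.≤-reflexive (∑-const n)))) (lemma (+ n) (∑ (sp ∘ x ∘ suc)))
      where lemma : ∀ n s → (1ℤ + n) - ((-1ℤ + s) + + 2) ≡ n - s
            lemma = solve-∀
    ∑-missing {suc n} x (suc i) e =
      ≤-by (gap (∑-missing (x ∘ suc) i e) ⊕ gap (sp≤1 (x zero))) (lemma (+ n) (∑ (sp ∘ x ∘ suc)) (sp (x zero)))
      where lemma : ∀ n s t → (1ℤ + n) - ((t + s) + + 2) ≡ (n - (s + + 2)) + (1ℤ - t)
            lemma = solve-∀

  -- A spin -1 in place of +1 lowers the sum by 2, more than one unit of field; this makes a single
  -- missing node decisive.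
  spins-missing : ∀ x {a} → x a ≡ false → spins x + + 2 ≤ + size
  spins-missing x {a} e rewrite sum-∑ (sp ∘ x) = ∑-missing (x ∘ to) (from a) (trans (cong x (to-from a)) e)

open Finite public

fin : ∀ n → Finite (Fin n)
fin n = record { size = n ; to = id ; from = id ; to-from = λ _ → refl ; from-to = λ _ → refl
               ; sum = ∑ ; sum-∑ = λ _ → refl }

unit : Finite ⊤
unit = record { size = 1 ; to = λ _ → tt ; from = λ _ → zero ; to-from = λ _ → refl
              ; from-to = λ { zero → refl } ; sum = λ f → f tt ; sum-∑ = λ f → sym (ℤ.+-identityʳ (f tt)) }

infixr 4 _⊞_
infixr 5 _⊠_

_⊞_ : ∀ {A B} → Finite A → Finite B → Finite (A ⊎ B)
_⊞_ {A} {B} F G = record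
  { size = size F ℕ.+ size G
  ; to = map (to F) (to G) ∘ Fin.splitAt (size F)
  ; from = Fin.join (size F) (size G) ∘ map (from F) (from G)
  ; to-from = λ { (inj₁ a) → trans (cong (map (to F) (to G)) (Fin.splitAt-↑ˡ _ (from F a) _)) (cong inj₁ (to-from F a))
                ; (inj₂ b) → trans (cong (map (to F) (to G)) (Fin.splitAt-↑ʳ (size F) _ (from G b))) (cong inj₂ (to-from G b)) }
  ; from-to = λ i → trans (cong (Fin.join (size F) (size G)) (lemma (Fin.splitAt (size F) i))) (Fin.join-splitAt (size F) (size G) i)
  ; sum = λ f → sum F (f ∘ inj₁) + sum G (f ∘ inj₂)
  ; sum-∑ = λ f → trans (cong₂ _+_ (sum-∑ F _) (sum-∑ G _)) (∑-split (size F) (f ∘ map (to F) (to G))) }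
  where
  open import Data.Sum using (map)
  lemma : ∀ s → map (from F) (from G) (map (to F) (to G) s) ≡ s
  lemma (inj₁ i) = cong inj₁ (from-to F i)
  lemma (inj₂ i) = cong inj₂ (from-to G i)

_⊠_ : ∀ {A B} → Finite A → Finite B → Finite (A × B)
_⊠_ {A} {B} F G = record
  { size = size F * size G
  ; to = map (to F) (to G) ∘ Fin.remQuot {size F} (size G)
  ; from = λ (a , b) → Fin.combine (from F a) (from G b)
  ; to-from = λ (a , b) → trans (cong (map (to F) (to G)) (Fin.remQuot-combine (from F a) (from G b)))
                                (cong₂ _,_ (to-from F a) (to-from G b))
  ; from-to = λ i → trans (cong₂ Fin.combine (from-to F _) (from-to G _)) (Fin.combine-remQuot {size F} (size G) i)
  ; sum = λ f → sum F λ a → sum G λ b → f (a , b)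
  ; sum-∑ = λ f → trans (sum-∑ F _) (trans (∑-cong λ i → sum-∑ G (λ b → f (to F i , b))) (∑-product (size F) (f ∘ map (to F) (to G)))) }
  where open import Data.Product using (map)

-- Spin systems.  The frame colour of a node turns the antiferromagnetic coupling of the
-- minority process into a signed one: neighbours of different frame colour attract.

act : Bool → Bool → Bool → ℤ
act false _     _ = 0ℤ
act true  true  b = sp b
act true  false b = sp (not b)

act-not : ∀ a d b → act a d (not b) ≡ - act a d b
act-not false d b = refl
act-not true true  b = sp-not b
act-not true false b = sp-not (not b)

act≤1 : ∀ a d b → act a d b ≤ 1ℤ
act≤1 false d b = +≤+ z≤n
act≤1 true true  b = sp≤1 b
act≤1 true false b = sp≤1 (not b)

-1≤act : ∀ a d b → -1ℤ ≤ act a d b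
-1≤act false d b = -≤+
-1≤act true true  b = -1≤sp b
-1≤act true false b = -1≤sp (not b)

-- Strict inequalities: in field 0 neither spin is bad, in agreement with `Switchable`.
Bad : Bool → ℤ → Set
Bad true  f = f < 0ℤ
Bad false f = 0ℤ < f

Bad-neg : ∀ {b f} → Bad b f → Bad (not b) (- f)
Bad-neg {true}  = ℤ.neg-mono-<
Bad-neg {false} = ℤ.neg-mono-<

Bad-neg⁻ : ∀ {b f} → Bad (not b) (- f) → Bad b f
Bad-neg⁻ {true}  = ℤ.neg-cancel-<
Bad-neg⁻ {false} = ℤ.neg-cancel-<

good⁺ : ∀ {b f} → b ≡ true → 0ℤ ≤ f → ¬ Bad b f
good⁺ refl p q = ℤ.<⇒≱ q p

good⁻ : ∀ {b f} → b ≡ false → f ≤ 0ℤ → ¬ Bad b f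
good⁻ refl p q = ℤ.<⇒≱ q p

record Sys : Set₁ where
  field
    Node    : Set
    finite  : Finite Node
    adj     : Node → Node → Bool
    colour  : Node → Bool

  State = Node → Bool
  Ext   = Node → ℤ

  pull : State → Node → Node → ℤ
  pull z i j = act (adj i j) (colour i xor colour j) (z j)

  field′ : State → Node → ℤ
  field′ z i = sum finite (pull z i)

  Unstable : Ext → State → Node → Set
  Unstable e z i = Bad (z i) (field′ z i + e i)

  -- Any set of unstable nodes may flip, the empty one included, so that the steps of all six models
  -- are instances.
  Step : Ext → State → State → Set
  Step e z z′ = ∀ i → z′ i ≢ z i → Unstable e z i

  -- A run is a chain of traps: a state of a trap is not stable, and a step leads from it
  -- to the same trap or to the entry of the next one.
  data Run (e : Ext) (Θ : State → Set) : (Φ Ω : State → Set) → ℕ → Set₁ where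
    stop : ∀ {Φ Ω : State → Set} → (∀ z → Φ z → Ω z) → Run e Θ Φ Ω 0
    trap : ∀ {Φ Φ′ Ω : State → Set} {k} (Ψ : State → Set) →
           (∀ z → Φ z → Ψ z) →
           (∀ z → Ψ z → Θ z) →
           (∀ z → Ψ z → ∃ (Unstable e z)) →
           (∀ z z′ → Ψ z → Step e z z′ → Ψ z′ ⊎ Φ′ z′) →
           Run e Θ Φ′ Ω k → Run e Θ Φ Ω (suc k)

  infixr 5 _++_

  _++_ : ∀ {e Θ Φ Ω Ω′ k l} → Run e Θ Φ Ω k → Run e Θ Ω Ω′ l → Run e Θ Φ Ω′ (k ℕ.+ l)
  stop h         ++ stop h′         = stop λ z → h′ z ∘ h z
  stop h         ++ trap Ψ a b c d r = trap Ψ (λ z → a z ∘ h z) b c d r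
  trap Ψ a b c d r ++ r′            = trap Ψ a b c d (r ++ r′)

  Run-map : ∀ {e Θ Θ′ Φ Φ′ Ω Ω′ k} → (∀ z → Φ′ z → Φ z) → (∀ z → Θ z → Θ′ z) → (∀ z → Ω z → Ω′ z) →
            Run e Θ Φ Ω k → Run e Θ′ Φ′ Ω′ k
  Run-map f t g (stop h)           = stop λ z → g z ∘ h z ∘ f z
  Run-map f t g (trap Ψ a b c d r) = trap Ψ (λ z → a z ∘ f z) (λ z → t z ∘ b z) c d (Run-map (λ _ p → p) t g r)

  neg : State → State
  neg z i = not (z i)

  field-cong : ∀ {z z′} → (∀ i → z i ≡ z′ i) → ∀ i → field′ z i ≡ field′ z′ i
  field-cong h i = sum-cong finite λ j → cong (act (adj i j) _) (h j)

  field-neg : ∀ z i → field′ (neg z) i ≡ - field′ z i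
  field-neg z i = trans (sum-cong finite λ j → act-not (adj i j) _ (z j)) (sum-neg finite _)

  Attracts : Node → Node → Set
  Attracts i j = adj i j ≡ true → colour i xor colour j ≡ true

  -- A change lowers the field of i only if an attracting spin falls or a repelling one rises.
  -- Changes restricted to attracting nodes that were at -1 do neither.
  field-mono : ∀ {z z′} i → (∀ j → z j ≡ z′ j ⊎ (Attracts i j × z j ≡ false)) → field′ z i ≤ field′ z′ i
  field-mono {z} {z′} i h = sum-mono finite λ j → lemma (adj i j) _ (z j) (z′ j) (h j)
    where
    lemma : ∀ a d b b′ → (b ≡ b′ ⊎ ((a ≡ true → d ≡ true) × b ≡ false)) → act a d b ≤ act a d b′
    lemma a d b b′ (inj₁ refl) = ℤ.≤-refl
    lemma false d b b′ (inj₂ (p , e)) = ℤ.≤-refl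
    lemma true d b b′ (inj₂ (p , refl)) rewrite p refl = -1≤sp b′

  kept : ∀ {e z z′} → Step e z z′ → ∀ i → ¬ Unstable e z i → z′ i ≡ z i
  kept {z = z} {z′} s i ¬u with z′ i Bool.≟ z i
  ... | yes p = p
  ... | no p  = ⊥-elim (¬u (s i p))

  unstable-neg : ∀ {e e′ z} i → e′ i ≡ - e i → Unstable e z i → Unstable e′ (neg z) i
  unstable-neg {e} {e′} {z} i p u =
    subst (Bad (not (z i))) (trans (ℤ.neg-distrib-+ (field′ z i) (e i)) (sym (cong₂ _+_ (field-neg z i) p))) (Bad-neg {z i} u)

  unstable-neg⁻ : ∀ {e e′ z} i → e′ i ≡ - e i → Unstable e′ (neg z) i → Unstable e z i
  unstable-neg⁻ {e} {e′} {z} i p u = Bad-neg⁻ {z i}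
    (subst (Bad (not (z i))) (sym (trans (ℤ.neg-distrib-+ (field′ z i) (e i)) (sym (cong₂ _+_ (field-neg z i) p)))) u)

  -- The field is an odd function of the state, so reversing all spins together with the external
  -- field maps unstable nodes to unstable nodes.
  Run-neg : ∀ {e e′ Θ Φ Ω k} → (∀ i → e′ i ≡ - e i) → Run e Θ Φ Ω k →
            Run e′ (Θ ∘ neg) (Φ ∘ neg) (Ω ∘ neg) k
  Run-neg p (stop h)           = stop (h ∘ neg)
  Run-neg {e} {e′} p (trap Ψ a b c d r) = trap (Ψ ∘ neg) (a ∘ neg) (b ∘ neg)
    (λ z h → let i , u = c (neg z) h in i , unstable-neg⁻ {e′} {e} i (p′ i) u)
    (λ z z′ h s → d (neg z) (neg z′) h λ i ne → unstable-neg {e′} {e} i (p′ i) (s i (ne ∘ cong not)))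
    (Run-neg p r)
    where
    p′ : ∀ i → e i ≡ - e′ i
    p′ i = trans (sym (ℤ.neg-involutive (e i))) (cong -_ (sym (p i)))

xor-same : ∀ a → a xor a ≡ false
xor-same true  = refl
xor-same false = refl

xor-sym : ∀ a b → a xor b ≡ b xor a
xor-sym true  true  = refl
xor-sym true  false = refl
xor-sym false true  = refl
xor-sym false false = refl

-- Coupling two spin systems

module Join (X V : Sys) (link : Sys.Node X → Sys.Node V → Bool) where
  private
    module X = Sys X
    module V = Sys V

  joinAdj : X.Node ⊎ V.Node → X.Node ⊎ V.Node → Bool
  joinAdj (inj₁ x) (inj₁ y) = X.adj x y
  joinAdj (inj₁ x) (inj₂ v) = link x v
  joinAdj (inj₂ v) (inj₁ x) = link x v
  joinAdj (inj₂ v) (inj₂ w) = V.adj v w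

  joinColour : X.Node ⊎ V.Node → Bool
  joinColour (inj₁ x) = X.colour x
  joinColour (inj₂ v) = V.colour v

  join : Sys
  join = record { Node = X.Node ⊎ V.Node ; finite = X.finite ⊞ V.finite ; adj = joinAdj ; colour = joinColour }

  open Sys join

  up : X.Node → V.State → ℤ
  up x z = sum V.finite λ v → act (link x v) (X.colour x xor V.colour v) (z v)

  down : X.State → V.Node → ℤ
  down z v = sum X.finite λ x → act (link x v) (V.colour v xor X.colour x) (z x)

  _×ₛ_ : X.State → (V.State → Set) → State → Set
  (p ×ₛ Φ) z = (∀ x → z (inj₁ x) ≡ p x) × Φ (z ∘ inj₂)

  down-cong : ∀ {z p} → (∀ x → z x ≡ p x) → ∀ v → down z v ≡ down p v
  down-cong h v = sum-cong X.finite λ x → cong (act (link x v) _) (h x)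

  -- While the nodes of X are stable in the state p, they act on V as an external field.
  lift : ∀ {e′ : Ext} {e : V.Ext} {Θ : V.State → Set} (p : X.State) →
         (∀ v → down p v + e′ (inj₂ v) ≡ e v) →
         (∀ z → (p ×ₛ Θ) z → ∀ x → ¬ Unstable e′ z (inj₁ x)) →
         ∀ {Φ Ω k} → V.Run e Θ Φ Ω k → Run e′ (p ×ₛ Θ) (p ×ₛ Φ) (p ×ₛ Ω) k
  lift p q st (V.stop h) = stop λ z (a , b) → a , h _ b
  lift {e′} {e} p q st (V.trap Ψ a b c d r) = trap (p ×ₛ Ψ)
    (λ z (h , t) → h , a _ t)
    (λ z (h , t) → h , b _ t)
    (λ z (h , t) → let i , u = c _ t in inj₂ i , subst (Bad (z (inj₂ i))) (sym (total {z} h i)) u)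
    step′
    (lift p q st r)
    where
    total : ∀ {z : State} → (∀ x → z (inj₁ x) ≡ p x) → ∀ v →
            field′ z (inj₂ v) + e′ (inj₂ v) ≡ V.field′ (z ∘ inj₂) v + e v
    total {z} h v = trans (lemma (down (z ∘ inj₁) v) _ _)
      (cong (λ t → V.field′ (z ∘ inj₂) v + t) (trans (cong (λ t → t + e′ (inj₂ v)) (down-cong h v)) (q v)))
      where lemma : ∀ a b c → (a + b) + c ≡ b + (a + c)
            lemma = solve-∀
    step′ : ∀ z z′ → (p ×ₛ Ψ) z → Step e′ z z′ → (p ×ₛ Ψ) z′ ⊎ _
    step′ z z′ (h , t) s with d _ (z′ ∘ inj₂) t (λ i ne → subst (Bad (z (inj₂ i))) (total {z} h i) (s (inj₂ i) ne))
    ... | inj₁ ψ = inj₁ ((λ x → trans (kept s (inj₁ x) (st z (h , b _ t) x)) (h x)) , ψ)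
    ... | inj₂ φ = inj₂ ((λ x → trans (kept s (inj₁ x) (st z (h , b _ t) x)) (h x)) , φ)

-- Machines and their interface to the next level

data Role (N ρ : ℕ) : Set where
  plain : Role N ρ
  -- A node of role `dem γ j h` takes its field from slot j of unit γ in every segment; a head is
  -- coupled to the X of the last units as well.
  dem   : Fin N → Fin ρ → (head : Bool) → Role N ρ
  end   : Role N ρ

ind : Bool → ℤ
ind b = if b then 1ℤ else 0ℤ

module _ {N ρ : ℕ} where

  isEnd : Role N ρ → Bool
  isEnd end = true
  isEnd _   = false

  isHead : Role N ρ → Bool
  isHead (dem _ _ h) = h
  isHead _           = false

  inSlot : Fin N → Fin ρ → Role N ρ → Bool
  inSlot γ j (dem γ′ j′ _) = does (γ Fin.≟ γ′) ∧ does (j Fin.≟ j′)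
  inSlot γ j _             = false

  -- runExt is the external field during a run, and cap the strongest one that the resting
  -- state tolerates.  Besides the demand u, a head waits for a trigger of weight 1 and the
  -- ending bears a load of weight 1, both coming from the next level.
  runExt : ℕ → Role N ρ → ℤ
  runExt u plain       = 0ℤ
  runExt u (dem _ _ h) = + u + ind h
  runExt u end         = -1ℤ

  cap : ℕ → Role N ρ → ℤ
  cap u plain       = 0ℤ
  cap u (dem _ _ h) = + u - ind h
  cap u end         = 1ℤ

-- b is the parity of the current segment.
sg : Bool → ℤ → ℤ
sg true  x = - x
sg false x = x

parity : ℕ → Bool
parity zero    = false
parity (suc n) = not (parity n)

-- A machine flips all its nodes, in T stages, when its external field is reversed.  The
-- roles tell how a machine of the next level, with N units in each segment, ρ slots in
-- each unit and frame colour o for the nodes A of the first unit, supplies this field.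
record Machine (N ρ : ℕ) (o : Bool) : Set₁ where
  field
    sys : Sys
  open Sys sys public
  field
    u D η T : ℕ
    role    : Node → Role N ρ
    adj-sym : ∀ i j → adj i j ≡ adj j i
    adj-irr : ∀ i → adj i i ≡ false
    -- S in unit (s , γ) has frame colour `not (o xor (parity s xor parity γ))`, so with this choice
    -- it attracts the node for even s and repels it for odd s.
    colour-dem  : ∀ {v γ j h} → role v ≡ dem γ j h → colour v ≡ o xor parity (toℕ γ)
    colour-head : ∀ {v γ j} → role v ≡ dem γ j true → colour v ≡ not o
    colour-end  : ∀ {v} → role v ≡ end → colour v ≡ not o
    ending  : Node
    role-ending   : role ending ≡ end
    ending-unique : ∀ {v} → role v ≡ end → v ≡ ending
    -- Bounds the pull that the driven nodes exert back on a single node S.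
    load  : ∀ γ j → sum finite (λ v → ind (inSlot γ j (role v))) ≤ + D
    heads : sum finite (λ v → ind (isHead (role v))) ≡ + η
    η≤D   : η ℕ.≤ D
    1≤u   : 1 ℕ.≤ u
    -- A machine at rest must not react before it is triggered: the internal field of the uniform
    -- state withstands an opposing field of strength `cap`.
    hold  : ∀ v → cap u (role v) ≤ field′ (λ _ → true) v
    run   : Run (runExt u ∘ role) (λ z → z ending ≡ false) (λ z → ∀ v → z v ≡ false) (λ z → ∀ v → z v ≡ true) T

  running : ∀ b → Run (λ v → sg b (runExt u (role v))) (λ z → z ending ≡ b)
                      (λ z → ∀ v → z v ≡ b) (λ z → ∀ v → z v ≡ not b) T
  running false = run
  running true  = Run-map (λ z h v → cong not (h v))
                          (λ z h → trans (sym (not-involutive _)) (cong not h))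
                          (λ z h v → trans (sym (not-involutive _)) (cong not (h v)))
                          (Run-neg (λ _ → refl) run)

-- The ring of units and its frame colours

not-xor-not : ∀ a b → not a xor not b ≡ a xor b
not-xor-not true  b = refl
not-xor-not false b = not-involutive b

xor-not : ∀ a → a xor not a ≡ true
xor-not true  = refl
xor-not false = refl

not-xor : ∀ a → not a xor a ≡ true
not-xor true  = refl
not-xor false = refl

-- The units of a level form a ring.  Frame colours alternate along it and the number of
-- units is odd, so the ring closes with one repulsive link.
module Units (g′ N′ : ℕ) (o : Bool) (even-g′ : parity g′ ≡ false) (even-N′ : parity N′ ≡ false) (N′≢0 : N′ ≢ 0) where

  Seg Unit : Set
  Seg  = Fin (suc g′)
  Unit = Seg × Fin (suc N′)

  segs : Finite Seg
  segs = fin (suc g′)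

  units : Finite Unit
  units = segs ⊠ fin (suc N′)

  seg : Unit → Seg
  seg = proj₁

  last : Seg → Unit
  last s = s , fromℕ N′

  isFirst : Unit → Bool
  isFirst (zero , zero) = true
  isFirst _             = false

  prevSeg : Seg → Seg
  prevSeg zero    = fromℕ g′
  prevSeg (suc s) = inject₁ s

  prev : Unit → Unit
  prev (s , zero)  = prevSeg s , fromℕ N′
  prev (s , suc γ) = s , inject₁ γ

  prevSeg-surjective : ∀ s → ∃ λ t → prevSeg t ≡ s
  prevSeg-surjective s with view s
  ... | ‵fromℕ = zero , refl
  ... | ‵inject₁ i = suc i , refl

  next-spec : ∀ q → ∃ λ r → prev r ≡ q
  next-spec (s , γ) with view γ
  ... | ‵fromℕ     = (proj₁ (prevSeg-surjective s) , zero) , cong (_, fromℕ N′) (proj₂ (prevSeg-surjective s))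
  ... | ‵inject₁ i = (s , suc i) , refl

  next : Unit → Unit
  next q = proj₁ (next-spec q)

  prev-next : ∀ q → prev (next q) ≡ q
  prev-next q = proj₂ (next-spec q)

  prevSeg-injective : ∀ {s t} → prevSeg s ≡ prevSeg t → s ≡ t
  prevSeg-injective {zero}  {zero}  e = refl
  prevSeg-injective {zero}  {suc t} e = ⊥-elim (Fin.fromℕ≢inject₁ e)
  prevSeg-injective {suc s} {zero}  e = ⊥-elim (Fin.fromℕ≢inject₁ (sym e))
  prevSeg-injective {suc s} {suc t} e = cong suc (Fin.inject₁-injective e)

  prev-injective : ∀ {q r} → prev q ≡ prev r → q ≡ r
  prev-injective {_ , zero}  {_ , zero}  e = cong (_, zero) (prevSeg-injective (cong proj₁ e))
  prev-injective {_ , zero}  {_ , suc δ} e = ⊥-elim (Fin.fromℕ≢inject₁ (cong proj₂ e))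
  prev-injective {_ , suc γ} {_ , zero}  e = ⊥-elim (Fin.fromℕ≢inject₁ (sym (cong proj₂ e)))
  prev-injective {_ , suc γ} {_ , suc δ} e = cong₂ (λ s γ → s , suc γ) (cong proj₁ e) (Fin.inject₁-injective (cong proj₂ e))

  prev≢ : ∀ q → prev q ≢ q
  prev≢ (s , zero)  e = N′≢0 (trans (sym (Fin.toℕ-fromℕ N′)) (cong (toℕ ∘ proj₂) e))
  prev≢ (s , suc γ) e = ℕ.m≢1+m+n _ {0} (trans (trans (sym (Fin.toℕ-inject₁ γ)) (cong (toℕ ∘ proj₂) e)) (cong suc (sym (ℕ.+-identityʳ _))))

  infix 4 _==_

  _≟_ : (q r : Unit) → Dec (q ≡ r)
  _≟_ = ≡-dec Fin._≟_ Fin._≟_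

  abstract

    _==_ : Unit → Unit → Bool
    q == r = does (q ≟ r)

    ==-on : ∀ {q r} → q ≡ r → (q == r) ≡ true
    ==-on = dec-true (_ ≟ _)

    ==-off : ∀ {q r} → q ≢ r → (q == r) ≡ false
    ==-off = dec-false (_ ≟ _)

    isTop : Seg → Bool
    isTop s = does (s Fin.≟ fromℕ g′)

    isTop-on : ∀ {s} → s ≡ fromℕ g′ → isTop s ≡ true
    isTop-on = dec-true (_ Fin.≟ _)

    isTop-off : ∀ {s} → s ≢ fromℕ g′ → isTop s ≡ false
    isTop-off = dec-false (_ Fin.≟ _)

  isTop-true : ∀ {s} → isTop s ≡ true → s ≡ fromℕ g′
  isTop-true {s} e with s Fin.≟ fromℕ g′
  ... | yes p = p
  ... | no p  = true≢false e (isTop-off p)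

  ==-true : ∀ {q r} → (q == r) ≡ true → q ≡ r
  ==-true {q} {r} e with q ≟ r
  ... | yes p = p
  ... | no p  = true≢false e (==-off p)

  par : Unit → Bool
  par (s , γ) = o xor (parity (toℕ s) xor parity (toℕ γ))

  -- Inside a segment the parity of γ changes. At a segment boundary both positions N′ and 0 are
  -- even, so only the parity of s changes. Where the ring closes, g′ and N′ are even as well and
  -- the two colours coincide.
  par-prev : ∀ q → par q xor par (prev q) ≡ not (isFirst q)
  par-prev (zero , zero) rewrite Fin.toℕ-fromℕ g′ | Fin.toℕ-fromℕ N′ | even-g′ | even-N′ = xor-same (o xor false)
  par-prev (suc s , zero) rewrite Fin.toℕ-fromℕ N′ | even-N′ | Fin.toℕ-inject₁ s = lemma o (parity (toℕ s))
    where lemma : ∀ a b → (a xor (not b xor false)) xor (a xor (b xor false)) ≡ true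
          lemma true  true  = refl
          lemma true  false = refl
          lemma false true  = refl
          lemma false false = refl
  par-prev (s , suc γ) rewrite Fin.toℕ-inject₁ γ = trans (lemma o (parity (toℕ s)) (parity (toℕ γ))) (sym (cong not (first s)))
    where lemma : ∀ a b c → (a xor (b xor not c)) xor (a xor (b xor c)) ≡ true
          lemma true  true  true  = refl
          lemma true  true  false = refl
          lemma true  false true  = refl
          lemma true  false false = refl
          lemma false true  true  = refl
          lemma false true  false = refl
          lemma false false true  = refl
          lemma false false false = refl
          first : ∀ s → isFirst (s , suc γ) ≡ false
          first zero    = refl
          first (suc s) = refl

  par-next : ∀ q → par q xor par (next q) ≡ not (isFirst (next q))
  par-next q = trans (cong (λ r → par r xor par (next q)) (sym (prev-next q)))
                     (trans (xor-sym (par (prev (next q))) _) (par-prev (next q)))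

  idx : Unit → ℕ
  idx (s , γ) = toℕ s * suc N′ ℕ.+ toℕ γ

  idx-prev : ∀ q → isFirst q ≡ false → idx q ≡ suc (idx (prev q))
  idx-prev (suc s , zero) e rewrite Fin.toℕ-fromℕ N′ | Fin.toℕ-inject₁ s =
    trans (ℕ.+-identityʳ _) (cong suc (ℕ.+-comm N′ _))
  idx-prev (s , suc γ) e rewrite Fin.toℕ-inject₁ γ = ℕ.+-suc _ _

  idx-seg : ∀ {s t} γ δ → toℕ s ℕ.< toℕ t → idx (s , γ) ℕ.< idx (t , δ)
  idx-seg {s} {t} γ δ s<t = begin-strict
    toℕ s * suc N′ ℕ.+ toℕ γ    <⟨ ℕ.+-monoʳ-< (toℕ s * suc N′) (Fin.toℕ<n γ) ⟩
    toℕ s * suc N′ ℕ.+ suc N′   ≡⟨ ℕ.+-comm _ (suc N′) ⟩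
    suc (toℕ s) * suc N′        ≤⟨ ℕ.*-monoˡ-≤ (suc N′) s<t ⟩
    toℕ t * suc N′              ≤⟨ ℕ.m≤m+n _ _ ⟩
    toℕ t * suc N′ ℕ.+ toℕ δ    ∎
    where open ℕ.≤-Reasoning

  idx-injective : ∀ {q r} → idx q ≡ idx r → q ≡ r
  idx-injective {s , γ} {t , δ} e with ℕ.<-cmp (toℕ s) (toℕ t)
  ... | tri< s<t _ _ = ⊥-elim (ℕ.<⇒≢ (idx-seg γ δ s<t) e)
  ... | tri> _ _ t<s = ⊥-elim (ℕ.<⇒≢ (idx-seg δ γ t<s) (sym e))
  ... | tri≈ _ s≡t _ with refl ← Fin.toℕ-injective s≡t =
    cong (s ,_) (Fin.toℕ-injective (ℕ.+-cancelˡ-≡ (toℕ s * suc N′) _ _ e))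

  idx-last : ∀ s γ → idx (s , γ) ℕ.≤ idx (last s)
  idx-last s γ = ℕ.+-monoʳ-≤ (toℕ s * suc N′) (ℕ.≤-trans (Fin.toℕ≤pred[n] γ) (ℕ.≤-reflexive (sym (Fin.toℕ-fromℕ N′))))

  idx-top : ∀ q → idx q ℕ.≤ idx (last (fromℕ g′))
  idx-top (s , γ) = ℕ.≤-trans (idx-last s γ) (ℕ.+-monoˡ-≤ _ (ℕ.*-monoˡ-≤ (suc N′)
    (ℕ.≤-trans (Fin.toℕ≤pred[n] s) (ℕ.≤-reflexive (sym (Fin.toℕ-fromℕ g′))))))

  isFirst-idx : ∀ q → isFirst q ≡ true → idx q ≡ 0
  isFirst-idx (zero , zero) e = refl

  prev-first : ∀ q → isFirst q ≡ true → prev q ≡ last (fromℕ g′)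
  prev-first (zero , zero) e = refl

-- One level without its lower machine.  In every unit the weights are σ for A, σ = ρ * u
-- for S (ρ slots of u nodes driving the lower machine), 3 for Z and 1 for E and X; the
-- last unit of a segment also has η nodes G and the node W, which waits for the lower machine.
-- Each node sees exactly the weight that lets it flip once its predecessors have flipped.
module Chain (g′ N′ : ℕ) (o : Bool) (even-g′ : parity g′ ≡ false) (even-N′ : parity N′ ≡ false) (N′≢0 : N′ ≢ 0)
             (ρ u η : ℕ) where

  open Units g′ N′ o even-g′ even-N′ N′≢0 public

  σ : ℕ
  σ = ρ * u

  slots : Finite (Fin ρ × Fin u)
  slots = fin ρ ⊠ fin u

  Cell : Set
  Cell = (Unit × Fin σ) ⊎ (Unit × (Fin ρ × Fin u)) ⊎ (Unit × Fin 3) ⊎ Unit ⊎ Unit ⊎ (Seg × Fin η) ⊎ Seg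

  pattern nA q k = inj₁ (q , k)
  pattern nS q c = inj₂ (inj₁ (q , c))
  pattern nZ q k = inj₂ (inj₂ (inj₁ (q , k)))
  pattern nE q   = inj₂ (inj₂ (inj₂ (inj₁ q)))
  pattern nX q   = inj₂ (inj₂ (inj₂ (inj₂ (inj₁ q))))
  pattern nG s k = inj₂ (inj₂ (inj₂ (inj₂ (inj₂ (inj₁ (s , k))))))
  pattern nW s   = inj₂ (inj₂ (inj₂ (inj₂ (inj₂ (inj₂ s)))))

  -- Adjacency is the symmetric closure of this relation. The edges from X to A and from E to S
  -- reach into the next unit: the former release A, and both give X and E a counterweight σ. The
  -- links of W with A hold back the next segment, those with S restore the balance of W; the top W
  -- has no segment to hold back and gets neither.
  arrow : Cell → Cell → Bool
  arrow (nA q _) (nS r _) = q == r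
  arrow (nA q _) (nE r)   = q == r
  arrow (nS q _) (nZ r _) = q == r
  arrow (nS q _) (nX r)   = q == r
  arrow (nZ q _) (nE r)   = q == r
  arrow (nE q)   (nX r)   = q == r
  arrow (nX q)   (nA r _) = q == prev r
  arrow (nE q)   (nS r _) = q == prev r
  arrow (nG s _) (nZ q _) = last s == q
  arrow (nG s _) (nX q)   = last s == q
  arrow (nW s)   (nE q)   = last s == q
  arrow (nW s)   (nS q _) = not (isTop s) ∧ (last s == q)
  arrow (nW s)   (nA q _) = not (isTop s) ∧ (last s == prev q)
  arrow _        _        = false

  shade : Cell → Bool
  shade (nA q _) = par q
  shade (nS q _) = not (par q)
  shade (nZ q _) = par q
  shade (nE q)   = not (par q)
  shade (nX q)   = par q
  shade (nG s _) = not (par (last s))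
  shade (nW s)   = par (last s)

  chain : Sys
  chain = record
    { Node = Cell
    ; finite = (units ⊠ fin σ) ⊞ (units ⊠ slots) ⊞ (units ⊠ fin 3) ⊞ units ⊞ units ⊞ (segs ⊠ fin η) ⊞ segs
    ; adj = λ x y → arrow x y ∨ arrow y x
    ; colour = shade }

  open Sys chain using (State; field′; adj)

  chain-irr : ∀ x → adj x x ≡ false
  chain-irr (nA q _) = refl
  chain-irr (nS q _) = refl
  chain-irr (nZ q _) = refl
  chain-irr (nE q)   = refl
  chain-irr (nX q)   = refl
  chain-irr (nG s _) = refl
  chain-irr (nW s)   = refl

  open Sys chain using (pull)

  private
    t∨ : ∀ {t b} → t ≡ b → t ∨ false ≡ b
    t∨ {t} e = trans (∨-identityʳ t) e

    ∧-off : ∀ c {t} → t ≡ false → c ∧ t ≡ false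
    ∧-off true  e = e
    ∧-off false e = refl

    ∧-on : ∀ c {t} → t ≡ true → c ∧ t ≡ c
    ∧-on true  e = e
    ∧-on false e = refl

    act-cong : ∀ {a a′ d d′} b → a ≡ a′ → d ≡ d′ → act a d b ≡ act a′ d′ b
    act-cong b refl refl = refl

    seg-off : ∀ {q s} → s ≢ seg q → last s ≢ q
    seg-off ne e = ne (cong proj₁ e)

    next-off : ∀ {q r} → r ≢ next q → q ≢ prev r
    next-off {q} ne e = ne (prev-injective (trans (sym e) (sym (prev-next q))))

    module _ (z : State) (x : Cell) where

      absent : ∀ {A} (F : Finite A) (i : A → Cell) → (∀ a → adj x (i a) ≡ false) → sum F (λ a → pull z x (i a)) ≡ 0ℤ
      absent F i h = sum-zero F λ a → act-cong (z (i a)) (h a) refl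

      single : ∀ {A} (F : Finite A) (i : A → Cell) a {c d} → (∀ b → b ≢ a → adj x (i b) ≡ false) →
               adj x (i a) ≡ c → shade x xor shade (i a) ≡ d → sum F (λ a → pull z x (i a)) ≡ act c d (z (i a))
      single F i a h p q = trans (sum-pick F a (λ a → pull z x (i a)) λ b ne → act-cong (z (i b)) (h b ne) refl)
                                 (act-cong (z (i a)) p q)

      block : ∀ {A C} (F : Finite A) (G : Finite C) (i : A × C → Cell) q {c d} → (∀ r k → r ≢ q → adj x (i (r , k)) ≡ false) →
              (∀ k → adj x (i (q , k)) ≡ c) → (∀ k → shade x xor shade (i (q , k)) ≡ d) →
              sum (F ⊠ G) (λ a → pull z x (i a)) ≡ sum G (λ k → act c d (z (i (q , k))))
      block F G i q h p e = trans
        (sum-pick F q (λ r → sum G λ k → pull z x (i (r , k)))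
          λ r ne → sum-zero G λ k → act-cong (z (i (r , k))) (h r k ne) refl)
        (sum-cong G λ k → act-cong (z (i (q , k))) (p k) (e k))

      pile : ∀ {a b c d e f g} →
             sum (units ⊠ fin σ) (λ p → pull z x (inj₁ p)) ≡ a →
             sum (units ⊠ slots) (λ p → pull z x (inj₂ (inj₁ p))) ≡ b →
             sum (units ⊠ fin 3) (λ p → pull z x (inj₂ (inj₂ (inj₁ p)))) ≡ c →
             sum units (λ q → pull z x (nE q)) ≡ d →
             sum units (λ q → pull z x (nX q)) ≡ e →
             sum (segs ⊠ fin η) (λ p → pull z x (inj₂ (inj₂ (inj₂ (inj₂ (inj₂ (inj₁ p))))))) ≡ f →
             sum segs (λ s → pull z x (nW s)) ≡ g →
             field′ z x ≡ a + (b + (c + (d + (e + (f + g)))))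
      pile p q r s t v w = cong₂ _+_ p (cong₂ _+_ q (cong₂ _+_ r (cong₂ _+_ s (cong₂ _+_ t (cong₂ _+_ v w)))))

  iA : Unit × Fin σ → Cell
  iA = inj₁
  iS : Unit × (Fin ρ × Fin u) → Cell
  iS p = inj₂ (inj₁ p)
  iZ : Unit × Fin 3 → Cell
  iZ p = inj₂ (inj₂ (inj₁ p))
  iE iX : Unit → Cell
  iE q = nE q
  iX q = nX q
  iG : Seg × Fin η → Cell
  iG p = inj₂ (inj₂ (inj₂ (inj₂ (inj₂ (inj₁ p)))))
  iW : Seg → Cell
  iW s = nW s

  -- Contributions to the fields around unit q. The prefix `σ` stands for its own groups, `x` for
  -- the next unit, `p` for the previous one and `w` for couplings with W; `gZ` is the pull of G,
  -- felt by Z and X alike.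
  σA σS σZ gZ xA xS : State → Unit → ℤ
  σA z q = spins (fin σ) (λ k → z (nA q k))
  σS z q = spins slots (λ c → z (nS q c))
  σZ z q = spins (fin 3) (λ k → z (nZ q k))
  gZ z q = sum (fin η) (λ k → act (last (seg q) == q) (par q xor not (par (last (seg q)))) (z (nG (seg q) k)))
  xA z q = sum (fin σ) (λ k → act true (not (isFirst (next q))) (z (nA (next q) k)))
  xS z q = sum slots (λ c → act true (not (isFirst (next q))) (z (nS (next q) c)))

  pX pE pW wS wE : State → Unit → ℤ
  pX z q = act true (not (isFirst q)) (z (nX (prev q)))
  pE z q = act true (not (isFirst q)) (z (nE (prev q)))
  pW z q = act (not (isTop (seg (prev q))) ∧ (last (seg (prev q)) == prev q)) (par q xor par (last (seg (prev q)))) (z (nW (seg (prev q))))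
  wS z q = act (not (isTop (seg q)) ∧ (last (seg q) == q)) (not (par q) xor par (last (seg q))) (z (nW (seg q)))
  wE z q = act (last (seg q) == q) (not (par q) xor par (last (seg q))) (z (nW (seg q)))

  wA wS′ : State → Seg → ℤ
  wA  z s = sum (fin σ) (λ k → act (not (isTop s)) (not (isFirst (next (last s)))) (z (nA (next (last s)) k)))
  wS′ z s = sum slots (λ c → act (not (isTop s)) true (z (nS (last s) c)))

  module _ (z : State) where

    field-A : ∀ q k → field′ z (nA q k) ≡ σS z q + sp (z (nE q)) + pX z q + pW z q
    field-A q k = trans
      (pile z x
        (absent z x (units ⊠ fin σ) iA λ _ → refl)
        (block z x units slots iS q (λ r c ne → t∨ (==-off (ne ∘ sym))) (λ c → t∨ (==-on refl)) λ c → xor-not (par q))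
        (absent z x (units ⊠ fin 3) iZ λ _ → refl)
        (single z x units iE q (λ r ne → t∨ (==-off (ne ∘ sym))) (t∨ (==-on refl)) (xor-not (par q)))
        (single z x units iX (prev q) (λ r ne → ==-off ne) (==-on refl) (par-prev q))
        (absent z x (segs ⊠ fin η) iG λ _ → refl)
        (single z x segs iW (seg (prev q)) (λ s ne → ∧-off (not (isTop s)) (==-off (seg-off ne))) refl refl))
      (lemma (σS z q) (sp (z (nE q))) (pX z q) (pW z q))
      where
      x = nA q k
      lemma : ∀ a b c d → 0ℤ + (a + (0ℤ + (b + (c + (0ℤ + d))))) ≡ a + b + c + d
      lemma = solve-∀

    field-S : ∀ q c → field′ z (nS q c) ≡ σA z q + σZ z q + pE z q + sp (z (nX q)) + wS z q
    field-S q c = trans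
      (pile z x
        (block z x units (fin σ) iA q (λ r k ne → ==-off ne) (λ k → ==-on refl) λ k → not-xor (par q))
        (absent z x (units ⊠ slots) iS λ _ → refl)
        (block z x units (fin 3) iZ q (λ r k ne → t∨ (==-off (ne ∘ sym))) (λ k → t∨ (==-on refl)) λ k → not-xor (par q))
        (single z x units iE (prev q) (λ r ne → ==-off ne) (==-on refl)
          (trans (not-xor-not (par q) (par (prev q))) (par-prev q)))
        (single z x units iX q (λ r ne → t∨ (==-off (ne ∘ sym))) (t∨ (==-on refl)) (not-xor (par q)))
        (absent z x (segs ⊠ fin η) iG λ _ → refl)
        (single z x segs iW (seg q) (λ s ne → ∧-off (not (isTop s)) (==-off (seg-off ne))) refl refl))
      (lemma (σA z q) (σZ z q) (pE z q) (sp (z (nX q))) (wS z q))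
      where
      x = nS q c
      lemma : ∀ a b c d e → a + (0ℤ + (b + (c + (d + (0ℤ + e))))) ≡ a + b + c + d + e
      lemma = solve-∀

    field-Z : ∀ q k → field′ z (nZ q k) ≡ σS z q + sp (z (nE q)) + gZ z q
    field-Z q k = trans
      (pile z x
        (absent z x (units ⊠ fin σ) iA λ _ → refl)
        (block z x units slots iS q (λ r c ne → ==-off ne) (λ c → ==-on refl) λ c → xor-not (par q))
        (absent z x (units ⊠ fin 3) iZ λ _ → refl)
        (single z x units iE q (λ r ne → t∨ (==-off (ne ∘ sym))) (t∨ (==-on refl)) (xor-not (par q)))
        (absent z x units iX λ _ → refl)
        (block z x segs (fin η) iG (seg q) (λ s k ne → ==-off (seg-off ne)) (λ k → refl) λ k → refl)
        (absent z x segs iW λ _ → refl))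
      (lemma (σS z q) (sp (z (nE q))) (gZ z q))
      where
      x = nZ q k
      lemma : ∀ a b c → 0ℤ + (a + (0ℤ + (b + (0ℤ + (c + 0ℤ))))) ≡ a + b + c
      lemma = solve-∀

    field-E : ∀ q → field′ z (nE q) ≡ σA z q + σZ z q + xS z q + sp (z (nX q)) + wE z q
    field-E q = trans
      (pile z x
        (block z x units (fin σ) iA q (λ r k ne → ==-off ne) (λ k → ==-on refl) λ k → not-xor (par q))
        (block z x units slots iS (next q) (λ r c ne → t∨ (==-off (next-off ne))) (λ c → t∨ (==-on (sym (prev-next q))))
          λ c → trans (not-xor-not (par q) (par (next q))) (par-next q))
        (block z x units (fin 3) iZ q (λ r k ne → ==-off ne) (λ k → ==-on refl) λ k → not-xor (par q))
        (absent z x units iE λ _ → refl)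
        (single z x units iX q (λ r ne → t∨ (==-off (ne ∘ sym))) (t∨ (==-on refl)) (not-xor (par q)))
        (absent z x (segs ⊠ fin η) iG λ _ → refl)
        (single z x segs iW (seg q) (λ s ne → ==-off (seg-off ne)) refl refl))
      (lemma (σA z q) (σZ z q) (xS z q) (sp (z (nX q))) (wE z q))
      where
      x = nE q
      lemma : ∀ a b c d e → a + (c + (b + (0ℤ + (d + (0ℤ + e))))) ≡ a + b + c + d + e
      lemma = solve-∀

    field-X : ∀ q → field′ z (nX q) ≡ σS z q + sp (z (nE q)) + xA z q + gZ z q
    field-X q = trans
      (pile z x
        (block z x units (fin σ) iA (next q) (λ r k ne → t∨ (==-off (next-off ne))) (λ k → t∨ (==-on (sym (prev-next q))))
          λ k → par-next q)
        (block z x units slots iS q (λ r c ne → ==-off ne) (λ c → ==-on refl) λ c → xor-not (par q))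
        (absent z x (units ⊠ fin 3) iZ λ _ → refl)
        (single z x units iE q (λ r ne → ==-off ne) (==-on refl) (xor-not (par q)))
        (absent z x units iX λ _ → refl)
        (block z x segs (fin η) iG (seg q) (λ s k ne → ==-off (seg-off ne)) (λ k → refl) λ k → refl)
        (absent z x segs iW λ _ → refl))
      (lemma (σS z q) (sp (z (nE q))) (xA z q) (gZ z q))
      where
      x = nX q
      lemma : ∀ a b c d → c + (a + (0ℤ + (b + (0ℤ + (d + 0ℤ))))) ≡ a + b + c + d
      lemma = solve-∀

    field-G : ∀ s k → field′ z (nG s k) ≡ σZ z (last s) + sp (z (nX (last s)))
    field-G s k = trans
      (pile z x
        (absent z x (units ⊠ fin σ) iA λ _ → refl)
        (absent z x (units ⊠ slots) iS λ _ → refl)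
        (block z x units (fin 3) iZ (last s) (λ r k ne → t∨ (==-off (ne ∘ sym))) (λ k → t∨ (==-on refl)) λ k → not-xor (par (last s)))
        (absent z x units iE λ _ → refl)
        (single z x units iX (last s) (λ r ne → t∨ (==-off (ne ∘ sym))) (t∨ (==-on refl)) (not-xor (par (last s))))
        (absent z x (segs ⊠ fin η) iG λ _ → refl)
        (absent z x segs iW λ _ → refl))
      (lemma (σZ z (last s)) (sp (z (nX (last s)))))
      where
      x = nG s k
      lemma : ∀ a b → 0ℤ + (0ℤ + (a + (0ℤ + (b + (0ℤ + 0ℤ))))) ≡ a + b
      lemma = solve-∀

    field-W : ∀ s → field′ z (nW s) ≡ wA z s + wS′ z s + sp (z (nE (last s)))
    field-W s = trans
      (pile z x
        (block z x units (fin σ) iA (next (last s)) (λ r k ne → t∨ (∧-off (not (isTop s)) (==-off (next-off ne))))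
          (λ k → t∨ (∧-on (not (isTop s)) (==-on (sym (prev-next (last s)))))) λ k → par-next (last s))
        (block z x units slots iS (last s) (λ r c ne → t∨ (∧-off (not (isTop s)) (==-off (ne ∘ sym))))
          (λ c → t∨ (∧-on (not (isTop s)) (==-on refl))) λ c → xor-not (par (last s)))
        (absent z x (units ⊠ fin 3) iZ λ _ → refl)
        (single z x units iE (last s) (λ r ne → t∨ (==-off (ne ∘ sym))) (t∨ (==-on refl)) (xor-not (par (last s))))
        (absent z x units iX λ _ → refl)
        (absent z x (segs ⊠ fin η) iG λ _ → refl)
        (absent z x segs iW λ _ → refl))
      (lemma (wA z s) (wS′ z s) (sp (z (nE (last s)))))
      where
      x = nW s
      lemma : ∀ a b c → a + (b + (0ℤ + (c + (0ℤ + (0ℤ + 0ℤ))))) ≡ a + b + c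
      lemma = solve-∀

-- Alternating signs of the segments

act-sg : ∀ b x → act true (not b) x ≡ sg b (sp x)
act-sg true  x = sp-not x
act-sg false x = refl

sg-zero : ∀ b → sg b 0ℤ ≡ 0ℤ
sg-zero true  = refl
sg-zero false = refl

sg-+ : ∀ b x y → sg b (x + y) ≡ sg b x + sg b y
sg-+ true  x y = ℤ.neg-distrib-+ x y
sg-+ false x y = refl

sg-∑ : ∀ b {n} (f : Fin n → ℤ) → sg b (∑ f) ≡ ∑ (sg b ∘ f)
sg-∑ true  f = sym (∑-neg f)
sg-∑ false f = refl

-- The constant terms on either side of s cancel in pairs. For odd n a term left over before s is
-- cancelled by one left over after it; for even n one c survives.
∑-alternating : ∀ {n} (f : Fin n → ℤ) s {c} →
                (∀ t → toℕ t ℕ.< toℕ s → f t ≡ c) → (∀ t → toℕ s ℕ.< toℕ t → f t ≡ - c) →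
                ∑ (λ t → sg (parity (toℕ t)) (f t)) ≡ sg (parity (toℕ s)) (f s) + (if parity n then 0ℤ else c)
∑-alternating {suc n} f zero {c} below above =
  cong (λ t → f zero + t) (trans (∑-cong {n} λ t → trans (cong (sg (not (parity (toℕ t)))) (above (suc t) (s≤s z≤n))) (flip (parity (toℕ t)))) (constant n))
  where
  flip : ∀ b → sg (not b) (- c) ≡ sg b c
  flip true  = refl
  flip false = ℤ.neg-involutive c
  unflip : ∀ b → sg (not b) c ≡ - sg b c
  unflip true  = sym (ℤ.neg-involutive c)
  unflip false = refl
  constant : ∀ n → ∑ {n} (λ t → sg (parity (toℕ t)) c) ≡ (if not (parity n) then 0ℤ else c)
  constant zero    = refl
  constant (suc n) = trans
    (cong (λ t → c + t) (trans (∑-cong {n} (unflip ∘ parity ∘ toℕ)) (trans (∑-neg {n} (λ t → sg (parity (toℕ t)) c)) (cong -_ (constant n)))))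
    (lemma (parity n))
    where
    lemma : ∀ b → c + - (if not b then 0ℤ else c) ≡ (if not (not b) then 0ℤ else c)
    lemma true  = ℤ.+-inverseʳ c
    lemma false = ℤ.+-identityʳ c
∑-alternating {suc n} f (suc s) {c} below above = trans
  (cong₂ _+_ (below zero (s≤s z≤n)) (trans (∑-cong {n} λ t → flip (parity (toℕ t)) (f (suc t)))
    (trans (∑-neg (λ t → sg (parity (toℕ t)) (f (suc t))))
      (cong -_ (∑-alternating (f ∘ suc) s (λ t p → below (suc t) (s≤s p)) (λ t p → above (suc t) (s≤s p)))))))
  (lemma (parity (toℕ s)) (parity n) (f (suc s)))
  where
  flip : ∀ b x → sg (not b) x ≡ - sg b x
  flip true  x = sym (ℤ.neg-involutive x)
  flip false x = refl
  lemma : ∀ b d x → c + - (sg b x + (if d then 0ℤ else c)) ≡ sg (not b) x + (if not d then 0ℤ else c)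
  lemma true  true  x = solve₁ c x
    where solve₁ : ∀ c x → c + - (- x + 0ℤ) ≡ x + c
          solve₁ = solve-∀
  lemma true  false x = solve₁ c x
    where solve₁ : ∀ c x → c + - (- x + c) ≡ x + 0ℤ
          solve₁ = solve-∀
  lemma false true  x = solve₁ c x
    where solve₁ : ∀ c x → c + - (x + 0ℤ) ≡ - x + c
          solve₁ = solve-∀
  lemma false false x = solve₁ c x
    where solve₁ : ∀ c x → c + - (x + c) ≡ - x + 0ℤ
          solve₁ = solve-∀

<?-on : ∀ {m n} → m ℕ.< n → does (m ℕ.<? n) ≡ true
<?-on = dec-true (_ ℕ.<? _)

<?-off : ∀ {m n} → n ℕ.≤ m → does (m ℕ.<? n) ≡ false
<?-off h = dec-false (_ ℕ.<? _) (ℕ.≤⇒≯ h)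

act≤ind : ∀ a d b → act a d b ≤ ind a
act≤ind true  d b = act≤1 true d b
act≤ind false d b = ℤ.≤-refl

-ind≤act : ∀ a d b → - ind a ≤ act a d b
-ind≤act true  d b = -1≤act true d b
-ind≤act false d b = ℤ.≤-refl

-- A level driving the machine below

module Level (g′ N′ : ℕ) (o : Bool) (even-g′ : parity g′ ≡ false) (even-N′ : parity N′ ≡ false) (N′≢0 : N′ ≢ 0)
             (ρ : ℕ) (M : Machine (suc N′) ρ o) where

  private module M = Machine M

  open Chain g′ N′ o even-g′ even-N′ N′≢0 ρ M.u M.η public

  ps : Seg → Bool
  ps s = parity (toℕ s)

  linkᵣ : Cell → Role (suc N′) ρ → Bool
  linkᵣ (nS (s , γ) (j , _)) r = inSlot γ j r
  linkᵣ (nX q)               r = isHead r ∧ (last (seg q) == q)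
  linkᵣ (nW s)               r = isEnd r
  linkᵣ _                    r = false

  link : Cell → M.Node → Bool
  link x v = linkᵣ x (M.role v)

  open Join chain M.sys link public
  open Sys join public

  -- The parity of γ occurs on both sides and cancels, so the sign of the coupling between S and a
  -- demanding node depends on the segment only.
  par-slot : ∀ s γ → not (par (s , γ)) xor (o xor parity (toℕ γ)) ≡ not (ps s)
  par-slot s γ = lemma o (ps s) (parity (toℕ γ))
    where
    lemma : ∀ a b c → not (a xor (b xor c)) xor (a xor c) ≡ not b
    lemma true  true  true  = refl
    lemma true  true  false = refl
    lemma true  false true  = refl
    lemma true  false false = refl
    lemma false true  true  = refl
    lemma false true  false = refl
    lemma false false true  = refl
    lemma false false false = refl

  par-last : ∀ s → par (last s) xor not o ≡ not (ps s)
  par-last s rewrite Fin.toℕ-fromℕ N′ | even-N′ = lemma o (ps s)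
    where
    lemma : ∀ a b → (a xor (b xor false)) xor not a ≡ not b
    lemma true  true  = refl
    lemma true  false = refl
    lemma false true  = refl
    lemma false false = refl

  -- The field exerted on the lower machine

  -- The field of segment s alone on a node of role r, before the sign of the segment is applied.
  driven : Sys.State chain → Seg → Role (suc N′) ρ → ℤ
  driven p s plain       = 0ℤ
  driven p s (dem γ j h) = spins (fin M.u) (λ k → p (nS (s , γ) (j , k))) + (if h then sp (p (nX (last s))) else 0ℤ)
  driven p s end         = sp (p (nW s))

  private
    module _ (p : Sys.State chain) (c : Bool) where

      pushᵣ : Role (suc N′) ρ → Cell → ℤ
      pushᵣ r x = act (linkᵣ x r) (c xor shade x) (p x)

      zeros : ∀ {A} (F : Finite A) r (i : A → Cell) → (∀ a → linkᵣ (i a) r ≡ false) → sum F (pushᵣ r ∘ i) ≡ 0ℤ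
      zeros F r i h = sum-zero F λ a → cong (λ t → act t (c xor shade (i a)) (p (i a))) (h a)

      by-sg : ∀ {a b d} x → a ≡ true → d ≡ not b → act a d x ≡ sg b (sp x)
      by-sg {b = b} x refl refl = act-sg b x

      from-S : ∀ γ j h → c ≡ o xor parity (toℕ γ) →
               sum (units ⊠ slots) (pushᵣ (dem γ j h) ∘ iS) ≡ ∑ (λ s → sg (ps s) (spins (fin M.u) λ k → p (nS (s , γ) (j , k))))
      from-S γ j h e = ∑-cong λ s → trans
        (∑-pick γ (λ δ → ∑ λ i → ∑ λ k → f s δ i k) λ δ ne → ∑-zero λ i → ∑-zero λ k →
          cong (λ t → act (t ∧ does (i Fin.≟ j)) (g s δ) (p (nS (s , δ) (i , k)))) (dec-false (δ Fin.≟ γ) ne))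
        (trans
          (∑-pick j (λ i → ∑ λ k → f s γ i k) λ i ne → ∑-zero λ k →
            trans (cong (λ t → act (t ∧ does (i Fin.≟ j)) (g s γ) (p (nS (s , γ) (i , k)))) (dec-true (γ Fin.≟ γ) refl))
                  (cong (λ t → act t (g s γ) (p (nS (s , γ) (i , k)))) (dec-false (i Fin.≟ j) ne)))
          (trans
            (∑-cong λ k → by-sg {b = ps s} (p (nS (s , γ) (j , k))) (cong₂ _∧_ (dec-true (γ Fin.≟ γ) refl) (dec-true (j Fin.≟ j) refl))
              (trans (cong (λ c → c xor not (par (s , γ))) e) (trans (xor-sym _ (not (par (s , γ)))) (par-slot s γ))))
            (sym (sg-∑ (ps s) λ k → sp (p (nS (s , γ) (j , k)))))))
        where
        g : Seg → Fin (suc N′) → Bool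
        g s δ = c xor not (par (s , δ))
        f : Seg → Fin (suc N′) → Fin ρ → Fin M.u → ℤ
        f s δ i k = pushᵣ (dem γ j h) (nS (s , δ) (i , k))

      from-X : ∀ γ j h → (h ≡ true → c ≡ not o) →
               sum units (pushᵣ (dem γ j h) ∘ iX) ≡ ∑ (λ s → sg (ps s) (if h then sp (p (nX (last s))) else 0ℤ))
      from-X γ j false e = ∑-cong {suc g′} λ s → trans (∑-zero {suc N′} λ δ → refl) (sym (sg-zero (ps s)))
      from-X γ j true e = ∑-cong λ s → trans
        (∑-pick (fromℕ N′) (λ δ → pushᵣ (dem γ j true) (nX (s , δ))) λ δ ne →
          cong (λ t → act t (c xor par (s , δ)) (p (nX (s , δ)))) (==-off (ne ∘ sym ∘ cong proj₂)))
        (by-sg {b = ps s} (p (nX (last s))) (==-on refl)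
          (trans (cong (λ c → c xor par (last s)) (e refl)) (trans (xor-sym (not o) _) (par-last s))))

      downᵣ : ∀ r → (∀ {γ j h} → r ≡ dem γ j h → c ≡ o xor parity (toℕ γ)) → (∀ {γ j} → r ≡ dem γ j true → c ≡ not o) →
              (r ≡ end → c ≡ not o) → sum (Sys.finite chain) (pushᵣ r) ≡ ∑ (λ s → sg (ps s) (driven p s r))
      downᵣ plain e₁ e₂ e₃ = trans (sum-zero (Sys.finite chain) lemma) (sym (∑-zero λ s → sg-zero (ps s)))
        where
        lemma : ∀ x → pushᵣ plain x ≡ 0ℤ
        lemma (nA q _) = refl
        lemma (nS q _) = refl
        lemma (nZ q _) = refl
        lemma (nE q)   = refl
        lemma (nX q)   = refl
        lemma (nG s _) = refl
        lemma (nW s)   = refl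
      downᵣ end e₁ e₂ e₃ = trans
        (cong₂ _+_ (zeros (units ⊠ fin σ) end iA λ _ → refl) (cong₂ _+_ (zeros (units ⊠ slots) end iS λ _ → refl)
          (cong₂ _+_ (zeros (units ⊠ fin 3) end iZ λ _ → refl) (cong₂ _+_ (zeros units end iE λ _ → refl)
            (cong₂ _+_ (zeros units end iX λ _ → refl) (cong₂ _+_ (zeros (segs ⊠ fin M.η) end iG λ _ → refl)
              (∑-cong λ s → by-sg {b = ps s} (p (nW s)) refl
                (trans (cong (λ c → c xor par (last s)) (e₃ refl)) (trans (xor-sym (not o) _) (par-last s))))))))))
        (lemma _)
        where lemma : ∀ a → 0ℤ + (0ℤ + (0ℤ + (0ℤ + (0ℤ + (0ℤ + a))))) ≡ a
              lemma = solve-∀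
      downᵣ (dem γ j h) e₁ e₂ e₃ = trans
        (cong₂ _+_ (zeros (units ⊠ fin σ) r iA λ _ → refl) (cong₂ _+_ (from-S γ j h (e₁ refl))
          (cong₂ _+_ (zeros (units ⊠ fin 3) r iZ λ _ → refl) (cong₂ _+_ (zeros units r iE λ _ → refl)
            (cong₂ _+_ (from-X γ j h λ { refl → e₂ refl }) (cong₂ _+_ (zeros (segs ⊠ fin M.η) r iG λ _ → refl)
              (zeros segs r iW λ _ → refl)))))))
        (trans (lemma (∑ a) (∑ b)) (trans (sym (∑-+ a b)) (∑-cong λ s → sym (sg-+ (ps s) (a′ s) (b′ s)))))
        where r = dem γ j h
              a b a′ b′ : Seg → ℤ
              a′ s = spins (fin M.u) λ k → p (nS (s , γ) (j , k))
              b′ s = if h then sp (p (nX (last s))) else 0ℤ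
              a s = sg (ps s) (a′ s)
              b s = sg (ps s) (b′ s)
              lemma : ∀ a b → 0ℤ + (a + (0ℤ + (0ℤ + (b + (0ℤ + 0ℤ))))) ≡ a + b
              lemma = solve-∀

  -- Once the segments before s are + and those after s are -, their effects cancel.
  Graded : Sys.State chain → Seg → Set
  Graded p s = (∀ t → toℕ t ℕ.< toℕ s → (∀ γ c → p (nS (t , γ) c) ≡ true) × p (nX (last t)) ≡ true × p (nW t) ≡ true)
             × (∀ t → toℕ s ℕ.< toℕ t → (∀ γ c → p (nS (t , γ) c) ≡ false) × p (nX (last t)) ≡ false × p (nW t) ≡ false)

  down-graded : ∀ p s → Graded p s → ∀ v → down p v ≡ sg (ps s) (driven p s (M.role v))
  down-graded p s (below , above) v = trans
    (downᵣ p (M.colour v) (M.role v) M.colour-dem M.colour-head M.colour-end)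
    (trans (∑-alternating (λ t → driven p t (M.role v)) s (λ t → before t (M.role v)) (λ t → after t (M.role v)))
           -- The number of segments is odd by `even-g′`, so `∑-alternating` leaves no constant
           -- remainder.
           (trans (cong (λ b → sg (ps s) (driven p s (M.role v)) + (if not b then 0ℤ else level (M.role v))) even-g′)
                  (ℤ.+-identityʳ _)))
    where
    level : Role (suc N′) ρ → ℤ
    level plain       = 0ℤ
    level (dem γ j h) = + M.u + (if h then 1ℤ else 0ℤ)
    level end         = 1ℤ
    before : ∀ t r → toℕ t ℕ.< toℕ s → driven p t r ≡ level r
    before t plain       t<s = refl
    before t (dem γ j h) t<s = cong₂ _+_ (spins-all (fin M.u) true λ k → proj₁ (below t t<s) γ (j , k))
                                         (cong (λ x → if h then x else 0ℤ) (cong sp (proj₁ (proj₂ (below t t<s)))))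
    before t end         t<s = cong sp (proj₂ (proj₂ (below t t<s)))
    after : ∀ t r → toℕ s ℕ.< toℕ t → driven p t r ≡ - level r
    after t plain       s<t = refl
    after t (dem γ j h) s<t = trans
      (cong₂ _+_ (spins-all (fin M.u) false λ k → proj₁ (above t s<t) γ (j , k))
                 (trans (cong (λ x → if h then x else 0ℤ) (cong sp (proj₁ (proj₂ (above t s<t))))) (lemma h)))
      (sym (ℤ.neg-distrib-+ (+ M.u) (if h then 1ℤ else 0ℤ)))
      where lemma : ∀ h → (if h then -1ℤ else 0ℤ) ≡ - (if h then 1ℤ else 0ℤ)
            lemma true  = refl
            lemma false = refl
    after t end         s<t = cong sp (proj₂ (proj₂ (above t s<t)))

-- The stages of a wave

module Dynamics (g′ N′ : ℕ) (o : Bool) (even-g′ : parity g′ ≡ false) (even-N′ : parity N′ ≡ false) (N′≢0 : N′ ≢ 0)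
                (ρ : ℕ) (M : Machine (suc N′) ρ o) (light : Machine.D M ℕ.+ 5 ℕ.≤ ρ * Machine.u M)
                {N₂ ρ₂ : ℕ} (slot : Fin (suc g′) × Fin (suc N′) → Fin N₂ × Fin ρ₂) where

  private module M = Machine M

  open Level g′ N′ o even-g′ even-N′ N′≢0 ρ M public

  roleW : Bool → Role N₂ ρ₂
  roleW true  = end
  roleW false = plain

  roleₓ : Cell → Role N₂ ρ₂
  roleₓ (nA q _) = dem (proj₁ (slot q)) (proj₂ (slot q)) (isFirst q)
  roleₓ (nW s)   = roleW (isTop s)
  roleₓ _        = plain

  role′ : Node → Role N₂ ρ₂
  role′ (inj₁ x) = roleₓ x
  role′ (inj₂ v) = plain

  ext : Ext
  ext = runExt (suc σ) ∘ role′

  Stable : State → Node → Set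
  Stable z i = ¬ Unstable ext z i

  total : State → Node → ℤ
  total z i = field′ z i + ext i

  cells : State → Sys.State chain
  cells z = z ∘ inj₁

  lower : State → M.State
  lower z = z ∘ inj₂

  private
    plus : ∀ {a a′ b b′ c c′ : ℤ} → a ≡ a′ → b ≡ b′ → c ≡ c′ → (a + b) + c ≡ (a′ + b′) + c′
    plus refl refl refl = refl

    nolink : ∀ z x → (∀ v → link x v ≡ false) → up x (lower z) ≡ 0ℤ
    nolink z x h = sum-zero M.finite λ v → cong (λ t → act t (shade x xor M.colour v) (lower z v)) (h v)

    drop₂ : ∀ a → (a + 0ℤ) + 0ℤ ≡ a
    drop₂ = solve-∀

  total-A : ∀ z q k → total z (inj₁ (nA q k)) ≡
            (σS (cells z) q + sp (z (inj₁ (nE q))) + pX (cells z) q + pW (cells z) q) + (+ suc σ + ind (isFirst q))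
  total-A z q k = trans (plus (field-A (cells z) q k) (nolink z (nA q k) λ _ → refl) refl)
    (cong (λ t → t + (+ suc σ + ind (isFirst q)))
          (ℤ.+-identityʳ (σS (cells z) q + sp (z (inj₁ (nE q))) + pX (cells z) q + pW (cells z) q)))

  total-S : ∀ z q c → total z (inj₁ (nS q c)) ≡
            (σA (cells z) q + σZ (cells z) q + pE (cells z) q + sp (z (inj₁ (nX q))) + wS (cells z) q) + up (nS q c) (lower z)
  total-S z q c = trans (plus (field-S (cells z) q c) refl refl) (ℤ.+-identityʳ _)

  total-Z : ∀ z q k → total z (inj₁ (nZ q k)) ≡ σS (cells z) q + sp (z (inj₁ (nE q))) + gZ (cells z) q
  total-Z z q k = trans (plus (field-Z (cells z) q k) (nolink z (nZ q k) λ _ → refl) refl) (drop₂ _)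

  total-E : ∀ z q → total z (inj₁ (nE q)) ≡
            σA (cells z) q + σZ (cells z) q + xS (cells z) q + sp (z (inj₁ (nX q))) + wE (cells z) q
  total-E z q = trans (plus (field-E (cells z) q) (nolink z (nE q) λ _ → refl) refl) (drop₂ _)

  total-X : ∀ z q → total z (inj₁ (nX q)) ≡
            (σS (cells z) q + sp (z (inj₁ (nE q))) + xA (cells z) q + gZ (cells z) q) + up (nX q) (lower z)
  total-X z q = trans (plus (field-X (cells z) q) refl refl) (ℤ.+-identityʳ _)

  total-G : ∀ z s k → total z (inj₁ (nG s k)) ≡ σZ (cells z) (last s) + sp (z (inj₁ (nX (last s))))
  total-G z s k = trans (plus (field-G (cells z) s k) (nolink z (nG s k) λ _ → refl) refl) (drop₂ _)

  total-W : ∀ z s → total z (inj₁ (nW s)) ≡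
            (wA (cells z) s + wS′ (cells z) s + sp (z (inj₁ (nE (last s))))) + up (nW s) (lower z) + runExt (suc σ) (roleW (isTop s))
  total-W z s = plus (field-W (cells z) s) refl refl

  inUnit : Unit → Cell → Bool
  inUnit q (nA r _) = q == r
  inUnit q (nS r _) = q == r
  inUnit q (nZ r _) = q == r
  inUnit q (nE r)   = q == r
  inUnit q (nX r)   = q == r
  inUnit q (nG s _) = q == last s
  inUnit q (nW s)   = false

  Own : Bool → Unit → Sys.State chain → Set
  Own b q p = ∀ x → inUnit q x ≡ true → p x ≡ b

  signed : Bool → ℕ → ℤ
  signed b n = if b then + n else - + n

  module _ {b q} (p : Sys.State chain) (own : Own b q p) where

    own-A : σA p q ≡ signed b σ
    own-A = spins-all (fin σ) b λ k → own (nA q k) (==-on refl)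

    own-S : σS p q ≡ signed b σ
    own-S = spins-all slots b λ c → own (nS q c) (==-on refl)

    own-Z : σZ p q ≡ signed b 3
    own-Z = spins-all (fin 3) b λ k → own (nZ q k) (==-on refl)

    own-E : p (nE q) ≡ b
    own-E = own (nE q) (==-on refl)

    own-X : p (nX q) ≡ b
    own-X = own (nX q) (==-on refl)

  lastη : Unit → ℤ
  lastη q = if last (seg q) == q then + M.η else 0ℤ

  lastη≤ : ∀ q → lastη q ≤ + M.η
  lastη≤ q with last (seg q) == q
  ... | true  = ℤ.≤-refl
  ... | false = nonneg M.η

  private
    ind-sum : ∀ t → sum M.finite (λ v → ind (isHead (M.role v) ∧ t)) ≡ (if t then + M.η else 0ℤ)
    ind-sum true  = trans (sum-cong M.finite λ v → cong ind (∧-identityʳ (isHead (M.role v)))) M.heads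
    ind-sum false = sum-zero M.finite λ v → cong ind (∧-zeroʳ (isHead (M.role v)))

    sum-gZ : ∀ t → sum (fin M.η) (λ _ → ind t) ≡ (if t then + M.η else 0ℤ)
    sum-gZ true  = sum-one (fin M.η)
    sum-gZ false = sum-zero (fin M.η) λ _ → refl

  gZ≤ : ∀ p q → gZ p q ≤ lastη q
  gZ≤ p q = ℤ.≤-trans (sum-mono (fin M.η) λ k → act≤ind _ _ (p (nG (seg q) k))) (ℤ.≤-reflexive (sum-gZ _))

  -≤gZ : ∀ p q → - lastη q ≤ gZ p q
  -≤gZ p q = ℤ.≤-trans (ℤ.≤-reflexive (sym (trans (sum-neg (fin M.η) _) (cong -_ (sum-gZ _)))))
                       (sum-mono (fin M.η) λ k → -ind≤act _ _ (p (nG (seg q) k)))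

  gZ-all : ∀ p q → (last (seg q) ≡ q → ∀ k → p (nG (seg q) k) ≡ true) → gZ p q ≡ lastη q
  gZ-all p q h = trans (sum-cong (fin M.η) λ k → lemma k _ refl) (sum-gZ (last (seg q) == q))
    where
    lemma : ∀ k t → (last (seg q) == q) ≡ t → act (last (seg q) == q) (par q xor not (par (last (seg q)))) (p (nG (seg q) k)) ≡ ind (last (seg q) == q)
    lemma k true  e =
      trans (cong₂ (λ a d → act a d (p (nG (seg q) k))) e (trans (cong (λ r → par q xor not (par r)) (==-true e)) (xor-not (par q))))
            (trans (cong sp (h (==-true e) k)) (cong ind (sym e)))
    lemma k false e rewrite e = refl

  -≤upX : ∀ q v → - lastη q ≤ up (nX q) v
  -≤upX q v = ℤ.≤-trans (ℤ.≤-reflexive (sym (trans (sum-neg M.finite _) (cong -_ (ind-sum _)))))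
                        (sum-mono M.finite λ w → -ind≤act _ _ (v w))

  -- Before the wave below, every head pulls X towards -1, whatever the sign of the segment. The η
  -- nodes G compensate exactly this pull.
  upX-before : ∀ q v → (∀ w → v w ≡ ps (seg q)) → up (nX q) v ≡ - lastη q
  upX-before q v h = trans (sum-cong M.finite λ w → lemma w _ _ refl refl)
                           (trans (sum-neg M.finite _) (cong -_ (ind-sum (last (seg q) == q))))
    where
    lemma₂ : ∀ b → act true (not b) b ≡ -1ℤ
    lemma₂ true  = refl
    lemma₂ false = refl
    lemma : ∀ w t r → (last (seg q) == q) ≡ t → M.role w ≡ r →
            act (isHead (M.role w) ∧ (last (seg q) == q)) (par q xor M.colour w) (v w) ≡ - ind (isHead (M.role w) ∧ (last (seg q) == q))
    lemma w t     plain           e e′ rewrite e′ = refl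
    lemma w t     end             e e′ rewrite e′ = refl
    lemma w t     (dem γ j false) e e′ rewrite e′ = refl
    lemma w false (dem γ j true)  e e′ rewrite e | e′ = refl
    lemma w true  (dem γ j true)  e e′ =
      trans (cong₂ (λ a d → act a d (v w)) test (trans (cong₂ (λ r c → par r xor c) (sym (==-true e)) (M.colour-head e′)) (par-last (seg q))))
            (trans (cong (act true (not (ps (seg q)))) (h w)) (trans (lemma₂ (ps (seg q))) (cong (-_ ∘ ind) (sym test))))
      where
      test : isHead (M.role w) ∧ (last (seg q) == q) ≡ true
      test = trans (cong (λ r → isHead r ∧ (last (seg q) == q)) e′) e

  -≤upS : ∀ q c v → - + M.D ≤ up (nS q c) v
  -≤upS q c v = ℤ.≤-trans (ℤ.neg-mono-≤ (M.load (proj₂ q) (proj₁ c)))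
    (ℤ.≤-trans (ℤ.≤-reflexive (sym (sum-neg M.finite _))) (sum-mono M.finite λ w → -ind≤act _ _ (v w)))

  upW : ∀ s v → up (nW s) v ≡ sg (ps s) (sp (v M.ending))
  upW s v = trans (sum-pick M.finite M.ending _ λ w ne → lemma w _ refl ne)
    (trans (cong₂ (λ a d → act a d (v M.ending)) (cong isEnd M.role-ending)
                  (trans (cong (par (last s) xor_) (M.colour-end M.role-ending)) (par-last s)))
           (act-sg (ps s) (v M.ending)))
    where
    lemma : ∀ w r → M.role w ≡ r → w ≢ M.ending → act (isEnd (M.role w)) (par (last s) xor M.colour w) (v w) ≡ 0ℤ
    lemma w plain       e ne rewrite e = refl
    lemma w (dem _ _ _) e ne rewrite e = refl
    lemma w end         e ne = ⊥-elim (ne (M.ending-unique e))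

  upW≤ : ∀ s v → up (nW s) v ≤ 1ℤ
  upW≤ s v = subst (_≤ 1ℤ) (sym (trans (upW s v) (sym (act-sg (ps s) (v M.ending))))) (act≤1 true (not (ps s)) (v M.ending))

  -≤upW : ∀ s v → -1ℤ ≤ up (nW s) v
  -≤upW s v = subst (-1ℤ ≤_) (sym (trans (upW s v) (sym (act-sg (ps s) (v M.ending))))) (-1≤act true (not (ps s)) (v M.ending))

  ≥-of : ∀ {a b} → a ≡ b → 0ℤ ≤ a - b
  ≥-of {a} refl = gap (ℤ.≤-refl {a})

  private
    ≤-of : ∀ {a b} → a ≡ b → 0ℤ ≤ b - a
    ≤-of {a} refl = gap (ℤ.≤-refl {a})

    σ-light : 0ℤ ≤ + σ - (+ M.D + + 5)
    σ-light = gap (+≤+ light)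

    D-η : 0ℤ ≤ + M.D - + M.η
    D-η = gap (+≤+ M.η≤D)

    module _ (p : Sys.State chain) (q : Unit) where

      -1≤pX : 0ℤ ≤ pX p q - -1ℤ
      -1≤pX = gap (-1≤act true (not (isFirst q)) (p (nX (prev q))))

      -1≤pE : 0ℤ ≤ pE p q - -1ℤ
      -1≤pE = gap (-1≤act true (not (isFirst q)) (p (nE (prev q))))

      -1≤pW : 0ℤ ≤ pW p q - -1ℤ
      -1≤pW = gap (-1≤act (not (isTop (seg (prev q))) ∧ (last (seg (prev q)) == prev q))
                          (par q xor par (last (seg (prev q)))) (p (nW (seg (prev q)))))

      -1≤wS : 0ℤ ≤ wS p q - -1ℤ
      -1≤wS = gap (-1≤act (not (isTop (seg q)) ∧ (last (seg q) == q)) (not (par q) xor par (last (seg q))) (p (nW (seg q))))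

      -1≤wE : 0ℤ ≤ wE p q - -1ℤ
      -1≤wE = gap (-1≤act (last (seg q) == q) (not (par q) xor par (last (seg q))) (p (nW (seg q))))

      -σ≤xA : 0ℤ ≤ xA p q - - + σ
      -σ≤xA = gap (-≤sum (fin σ) λ k → -1≤act true (not (isFirst (next q))) (p (nA (next q) k)))

      -σ≤xS : 0ℤ ≤ xS p q - - + σ
      -σ≤xS = gap (-≤sum slots λ c → -1≤act true (not (isFirst (next q))) (p (nS (next q) c)))

    0≤total : ∀ {z i e d} → total z i ≡ e → 0ℤ ≤ d → e ≡ d → 0ℤ ≤ total z i
    0≤total p q r = subst (0ℤ ≤_) (sym (trans p r)) q

    0<total : ∀ {z i e d} → total z i ≡ e → 0ℤ ≤ d → e ≡ 1ℤ + d → 0ℤ < total z i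
    0<total {d = d} p q r = subst (0ℤ <_) (sym (trans p r)) (<-by q (lemma d))
      where lemma : ∀ d → (1ℤ + d) - (1ℤ + 0ℤ) ≡ d
            lemma = solve-∀

    total≤0 : ∀ {z i e d} → total z i ≡ e → 0ℤ ≤ d → e ≡ - d → total z i ≤ 0ℤ
    total≤0 p q r = subst (_≤ 0ℤ) (sym (trans p r)) (ℤ.neg-mono-≤ q)

  isA : Cell → Bool
  isA (nA _ _) = true
  isA _        = false

  -- The own groups of a flipped unit outweigh all other terms at their worst values, whatever the
  -- adjacent units, W and the machine below do.
  robust⁺ : ∀ z q → Own true q (cells z) → ∀ x → inUnit q x ≡ true → isA x ≡ false → 0ℤ ≤ total z (inj₁ x)
  robust⁺ z q own (nS r c) e _ with refl ← ==-true e = 0≤total {z} {inj₁ (nS q c)} (total-S z q c)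
    (≥-of (own-A p own) ⊕ ≥-of (own-Z p own) ⊕ ≥-of (cong sp (own-X p own)) ⊕ -1≤pE p q
      ⊕ -1≤wS p q ⊕ gap (-≤upS q c (lower z)) ⊕ σ-light ⊕ nonneg 7)
    (lemma (σA p q) (σZ p q) (pE p q) (sp (p (nX q))) (wS p q) (up (nS q c) (lower z)) (+ σ) (+ M.D))
    where
    p = cells z
    lemma : ∀ a t e x w l s d → (a + t + e + x + w) + l ≡
            (a - s) + ((t - + 3) + ((x - 1ℤ) + ((e - -1ℤ) + ((w - -1ℤ) + ((l - - d) + ((s - (d + + 5)) + + 7))))))
    lemma = solve-∀
  robust⁺ z q own (nZ r k) e _ with refl ← ==-true e = 0≤total {z} {inj₁ (nZ q k)} (total-Z z q k)
    (≥-of (own-S p own) ⊕ ≥-of (cong sp (own-E p own)) ⊕ gap (-≤gZ p q) ⊕ gap (lastη≤ q) ⊕ D-η ⊕ σ-light ⊕ nonneg 6)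
    (lemma (σS p q) (sp (p (nE q))) (gZ p q) (+ σ) (+ M.D) (+ M.η) (lastη q))
    where
    p = cells z
    lemma : ∀ a e g s d h l → a + e + g ≡
            (a - s) + ((e - 1ℤ) + ((g - - l) + ((h - l) + ((d - h) + ((s - (d + + 5)) + + 6)))))
    lemma = solve-∀
  robust⁺ z q own (nE r) e _ with refl ← ==-true e = 0≤total {z} {inj₁ (nE q)} (total-E z q)
    (≥-of (own-A p own) ⊕ ≥-of (own-Z p own) ⊕ ≥-of (cong sp (own-X p own)) ⊕ -σ≤xS p q
      ⊕ -1≤wE p q ⊕ nonneg 3)
    (lemma (σA p q) (σZ p q) (xS p q) (sp (p (nX q))) (wE p q) (+ σ))
    where
    p = cells z
    lemma : ∀ a t n x w s → a + t + n + x + w ≡ (a - s) + ((t - + 3) + ((x - 1ℤ) + ((n - - s) + ((w - -1ℤ) + + 3))))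
    lemma = solve-∀
  robust⁺ z q own (nX r) e _ with refl ← ==-true e = 0≤total {z} {inj₁ (nX q)} (total-X z q)
    (≥-of (own-S p own) ⊕ ≥-of (cong sp (own-E p own)) ⊕ -σ≤xA p q
      ⊕ ≥-of (gZ-all p q λ e k → own (nG (seg q) k) (==-on (sym e))) ⊕ gap (-≤upX q (lower z)) ⊕ nonneg 1)
    (lemma (σS p q) (sp (p (nE q))) (xA p q) (gZ p q) (up (nX q) (lower z)) (+ σ) (lastη q))
    where
    p = cells z
    lemma : ∀ a e n g l s h → (a + e + n + g) + l ≡ (a - s) + ((e - 1ℤ) + ((n - - s) + ((g - h) + ((l - - h) + 1ℤ))))
    lemma = solve-∀
  robust⁺ z q own (nG s k) e _ with refl ← ==-true e = 0≤total {z} {inj₁ (nG s k)} (total-G z s k)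
    (≥-of (own-Z p own) ⊕ ≥-of (cong sp (own-X p own)) ⊕ nonneg 4)
    (lemma (σZ p (last s)) (sp (p (nX (last s)))))
    where
    p = cells z
    lemma : ∀ a x → a + x ≡ (a - + 3) + ((x - 1ℤ) + + 4)
    lemma = solve-∀

  ext-inner : ∀ q x → inUnit q x ≡ true → isA x ≡ false → ext (inj₁ x) ≡ 0ℤ
  ext-inner q (nS _ _) e f = refl
  ext-inner q (nZ _ _) e f = refl
  ext-inner q (nE _)   e f = refl
  ext-inner q (nX _)   e f = refl
  ext-inner q (nG _ _) e f = refl

  -- The unflipped case is the flipped one after negating the whole state; these cells, unlike A,
  -- have no external field that would break the symmetry.
  robust : ∀ z b q → Own b q (cells z) → ∀ x → inUnit q x ≡ true → isA x ≡ false → Stable z (inj₁ x)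
  robust z true  q own x e f = good⁺ (own x e) (robust⁺ z q own x e f)
  robust z false q own x e f u =
    good⁺ (cong not (own x e)) (robust⁺ (neg z) q (λ y h → cong not (own y h)) x e f)
      (unstable-neg {ext} {ext} {z} (inj₁ x) (trans (ext-inner q x e f) (cong -_ (sym (ext-inner q x e f)))) u)

  ind≥0 : ∀ b → 0ℤ ≤ ind b
  ind≥0 true  = +≤+ z≤n
  ind≥0 false = ℤ.≤-refl

  stable-A-done : ∀ z q k → Own true q (cells z) → Stable z (inj₁ (nA q k))
  stable-A-done z q k own = good⁺ (own (nA q k) (==-on refl)) (0≤total {z} {inj₁ (nA q k)} (total-A z q k)
    (≥-of (own-S p own) ⊕ ≥-of (cong sp (own-E p own)) ⊕ -1≤pX p q
      ⊕ -1≤pW p q ⊕ ind≥0 (isFirst q) ⊕ nonneg σ ⊕ nonneg σ)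
    (lemma (σS p q) (sp (p (nE q))) (pX p q) (pW p q) (ind (isFirst q)) (+ σ)))
    where
    p = cells z
    lemma : ∀ a e x w f s → (a + e + x + w) + ((1ℤ + s) + f) ≡
            (a - s) + ((e - 1ℤ) + ((x - -1ℤ) + ((w - -1ℤ) + (f + (s + s)))))
    lemma = solve-∀

  -- The demand σ + 1 exactly cancels the unflipped S and E of the unit and leaves `pX + pW`. A
  -- triggered head has one more unit of field, hence the restriction by `isFirst`.
  stable-A-todo : ∀ z q k → Own false q (cells z) → isFirst q ≡ false → pX (cells z) q + pW (cells z) q ≤ 0ℤ → Stable z (inj₁ (nA q k))
  stable-A-todo z q k own f h = good⁻ (own (nA q k) (==-on refl)) (total≤0 {z} {inj₁ (nA q k)} (total-A z q k)
    (≤-of (own-S p own) ⊕ ≤-of (cong sp (own-E p own)) ⊕ gap h ⊕ ≤-of (cong ind f))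
    (lemma (σS p q) (sp (p (nE q))) (pX p q) (pW p q) (ind (isFirst q)) (+ σ)))
    where
    p = cells z
    lemma : ∀ a e x w f s → (a + e + x + w) + ((1ℤ + s) + f) ≡ - ((- s - a) + ((-1ℤ - e) + ((0ℤ - (x + w)) + (0ℤ - f))))
    lemma = solve-∀

  wA-on : ∀ {p s} → isTop s ≡ true → wA p s ≡ 0ℤ
  wA-on {p} {s} e = sum-zero (fin σ) λ k → cong (λ t → act (not t) (not (isFirst (next (last s)))) (p (nA (next (last s)) k))) e

  wS-on : ∀ {p s} → isTop s ≡ true → wS′ p s ≡ 0ℤ
  wS-on {p} {s} e = sum-zero slots λ c → cong (λ t → act (not t) true (p (nS (last s) c))) e

  private
    wS-off : ∀ {p s} → isTop s ≡ false → wS′ p s ≡ σS p (last s)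
    wS-off {p} {s} e = sum-cong slots λ c → cong (λ t → act (not t) true (p (nS (last s) c))) e

    ext-W : ∀ {s b} → isTop s ≡ b → runExt (suc σ) (roleW (isTop s)) ≡ (if b then -1ℤ else 0ℤ)
    ext-W {b = true}  e rewrite e = refl
    ext-W {b = false} e rewrite e = refl

  0≤total-W : ∀ z s → isTop s ≡ false → Own true (last s) (cells z) → 0ℤ ≤ total z (inj₁ (nW s))
  0≤total-W z s t own = 0≤total {z} {inj₁ (nW s)} (total-W z s)
    (gap (-≤sum (fin σ) λ k → -1≤act (not (isTop s)) _ (p (nA (next (last s)) k))) ⊕ ≥-of (trans (wS-off {p} t) (own-S p own))
      ⊕ ≥-of (cong sp (own-E p own)) ⊕ gap (-≤upW s (lower z)) ⊕ ≥-of (ext-W t))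
    (lemma (wA p s) (wS′ p s) (sp (p (nE (last s)))) (up (nW s) (lower z)) (runExt (suc σ) (roleW (isTop s))) (+ σ))
    where
    p = cells z
    lemma : ∀ a b e l x s → (a + b + e) + l + x ≡ (a - - s) + ((b - s) + ((e - 1ℤ) + ((l - -1ℤ) + (x - 0ℤ))))
    lemma = solve-∀

  stable-W-done : ∀ z s → isTop s ≡ false → Own true (last s) (cells z) → cells z (nW s) ≡ true → Stable z (inj₁ (nW s))
  stable-W-done z s t own w = good⁺ w (0≤total-W z s t own)

  stable-W-todo : ∀ z s → Own false (last s) (cells z) → cells z (nW s) ≡ false → Stable z (inj₁ (nW s))
  stable-W-todo z s own w = good⁻ w (by-top _ refl)
    where
    p = cells z
    lemma₁ : ∀ a b e l x → (a + b + e) + l + x ≡ - ((0ℤ - a) + ((0ℤ - b) + ((-1ℤ - e) + ((1ℤ - l) + ((-1ℤ - x) + 1ℤ)))))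
    lemma₁ = solve-∀
    lemma₂ : ∀ a b e l x s → (a + b + e) + l + x ≡ - ((s - a) + ((- s - b) + ((-1ℤ - e) + ((1ℤ - l) + (0ℤ - x)))))
    lemma₂ = solve-∀
    by-top : ∀ t → isTop s ≡ t → total z (inj₁ (nW s)) ≤ 0ℤ
    by-top true t = total≤0 {z} {inj₁ (nW s)} (total-W z s)
      (≤-of (wA-on {p} t) ⊕ ≤-of (wS-on {p} t) ⊕ ≤-of (cong sp (own-E p own)) ⊕ gap (upW≤ s (lower z)) ⊕ ≤-of (ext-W t) ⊕ nonneg 1)
      (lemma₁ (wA p s) (wS′ p s) (sp (p (nE (last s)))) (up (nW s) (lower z)) (runExt (suc σ) (roleW (isTop s))))
    by-top false t = total≤0 {z} {inj₁ (nW s)} (total-W z s)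
      (gap (sum-≤ (fin σ) λ k → act≤1 (not (isTop s)) _ (p (nA (next (last s)) k))) ⊕ ≤-of (trans (wS-off {p} t) (own-S p own))
        ⊕ ≤-of (cong sp (own-E p own)) ⊕ gap (upW≤ s (lower z)) ⊕ ≤-of (ext-W t))
      (lemma₂ (wA p s) (wS′ p s) (sp (p (nE (last s)))) (up (nW s) (lower z)) (runExt (suc σ) (roleW (isTop s))) (+ σ))

  -- The next unit has not flipped, taking into account the repulsive link that closes the ring.
  Behind : Sys.State chain → Unit → Set
  Behind p q = (∀ k → p (nA (next q) k) ≡ isFirst (next q)) × (∀ c → p (nS (next q) c) ≡ isFirst (next q))

  private
    act-behind : ∀ f {x} → x ≡ f → act true (not f) x ≡ -1ℤ
    act-behind true  refl = refl
    act-behind false refl = refl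

    minus : ∀ {A} (F : Finite A) {f : A → ℤ} → (∀ a → f a ≡ -1ℤ) → sum F f ≡ - + size F
    minus F h = trans (sum-cong F h) (trans (sum-neg F _) (cong -_ (sum-one F)))

  behind-A : ∀ {p q} → Behind p q → xA p q ≡ - + σ
  behind-A {p} {q} (h , _) = minus (fin σ) λ k → act-behind (isFirst (next q)) (h k)

  behind-S : ∀ {p q} → Behind p q → xS p q ≡ - + σ
  behind-S {p} {q} (_ , h) = minus slots λ c → act-behind (isFirst (next q)) (h c)

  behind-W : ∀ {p s} → isTop s ≡ false → Behind p (last s) → wA p s ≡ - + σ
  behind-W {p} {s} t h = trans (sum-cong (fin σ) λ k → cong (λ t → act (not t) (not (isFirst (next (last s)))) (p (nA (next (last s)) k))) t)
                               (behind-A {p} {last s} h)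

  upW-before : ∀ s v → v M.ending ≡ ps s → up (nW s) v ≡ -1ℤ
  upW-before s v h = trans (upW s v) (trans (cong (sg (ps s) ∘ sp) h) (lemma (ps s)))
    where lemma : ∀ b → sg b (sp b) ≡ -1ℤ
          lemma true  = refl
          lemma false = refl

  upW-after : ∀ s v → v M.ending ≡ not (ps s) → up (nW s) v ≡ 1ℤ
  upW-after s v h = trans (upW s v) (trans (cong (sg (ps s) ∘ sp) h) (lemma (ps s)))
    where lemma : ∀ b → sg b (sp (not b)) ≡ 1ℤ
          lemma true  = refl
          lemma false = refl

  -- The next A and the own S contribute at most 0 together, E at most 1, and the ending of the
  -- machine below -1. The top W lacks the first pair and has the load -1 in addition.
  stable-W-waiting : ∀ z s → (isTop s ≡ false → Behind (cells z) (last s)) → lower z M.ending ≡ ps s → cells z (nW s) ≡ false → Stable z (inj₁ (nW s))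
  stable-W-waiting z s beh wait w = good⁻ w (by-top _ refl)
    where
    p = cells z
    lemma₁ : ∀ a b e l x → (a + b + e) + l + x ≡ - ((0ℤ - a) + ((0ℤ - b) + ((1ℤ - e) + ((-1ℤ - l) + ((-1ℤ - x) + 1ℤ)))))
    lemma₁ = solve-∀
    lemma₂ : ∀ a b e l x s → (a + b + e) + l + x ≡ - ((- s - a) + ((s - b) + ((1ℤ - e) + ((-1ℤ - l) + (0ℤ - x)))))
    lemma₂ = solve-∀
    by-top : ∀ t → isTop s ≡ t → total z (inj₁ (nW s)) ≤ 0ℤ
    by-top true t = total≤0 {z} {inj₁ (nW s)} (total-W z s)
      (≤-of (wA-on {p} t) ⊕ ≤-of (wS-on {p} t) ⊕ gap (sp≤1 (p (nE (last s)))) ⊕ ≤-of (upW-before s (lower z) wait) ⊕ ≤-of (ext-W t) ⊕ nonneg 1)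
      (lemma₁ (wA p s) (wS′ p s) (sp (p (nE (last s)))) (up (nW s) (lower z)) (runExt (suc σ) (roleW (isTop s))))
    by-top false t = total≤0 {z} {inj₁ (nW s)} (total-W z s)
      (≤-of (behind-W {p} t (beh t)) ⊕ gap (sum-≤ slots λ c → act≤1 (not (isTop s)) true (p (nS (last s) c)))
        ⊕ gap (sp≤1 (p (nE (last s)))) ⊕ ≤-of (upW-before s (lower z) wait) ⊕ ≤-of (ext-W t))
      (lemma₂ (wA p s) (wS′ p s) (sp (p (nE (last s)))) (up (nW s) (lower z)) (runExt (suc σ) (roleW (isTop s))) (+ σ))

  -- Once the ending has flipped, its pull is +1. The field of W is then 2, or 1 at the top, where
  -- the load takes 1 away.
  unstable-W : ∀ z s → Own true (last s) (cells z) → (isTop s ≡ false → Behind (cells z) (last s)) → lower z M.ending ≡ not (ps s) →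
               cells z (nW s) ≡ false → Unstable ext z (inj₁ (nW s))
  unstable-W z s own beh done w = subst (λ b → Bad b (total z (inj₁ (nW s)))) (sym w) (by-top _ refl)
    where
    p = cells z
    lemma₁ : ∀ a b e l x → (a + b + e) + l + x ≡ 1ℤ + ((a - 0ℤ) + ((b - 0ℤ) + ((e - 1ℤ) + ((l - 1ℤ) + (x - -1ℤ)))))
    lemma₁ = solve-∀
    lemma₂ : ∀ a b e l x s → (a + b + e) + l + x ≡ 1ℤ + ((a - - s) + ((b - s) + ((e - 1ℤ) + ((l - 1ℤ) + ((x - 0ℤ) + 1ℤ)))))
    lemma₂ = solve-∀
    by-top : ∀ t → isTop s ≡ t → 0ℤ < total z (inj₁ (nW s))
    by-top true t = 0<total {z} {inj₁ (nW s)} (total-W z s)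
      (≥-of (wA-on {p} t) ⊕ ≥-of (wS-on {p} t) ⊕ ≥-of (cong sp (own-E p own)) ⊕ ≥-of (upW-after s (lower z) done) ⊕ ≥-of (ext-W t))
      (lemma₁ (wA p s) (wS′ p s) (sp (p (nE (last s)))) (up (nW s) (lower z)) (runExt (suc σ) (roleW (isTop s))))
    by-top false t = 0<total {z} {inj₁ (nW s)} (total-W z s)
      (≥-of (behind-W {p} t (beh t)) ⊕ ≥-of (trans (wS-off {p} t) (own-S p own))
        ⊕ ≥-of (cong sp (own-E p own)) ⊕ ≥-of (upW-after s (lower z) done) ⊕ ≥-of (ext-W t) ⊕ nonneg 1)
      (lemma₂ (wA p s) (wS′ p s) (sp (p (nE (last s)))) (up (nW s) (lower z)) (runExt (suc σ) (roleW (isTop s))) (+ σ))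

  -- n counts the flipped units and w the flipped nodes W. They are independent because W lags
  -- behind the last unit of its segment by a whole wave of the machine below.
  pat : ℕ → ℕ → Sys.State chain
  pat n w (nA q _) = does (idx q ℕ.<? n)
  pat n w (nS q _) = does (idx q ℕ.<? n)
  pat n w (nZ q _) = does (idx q ℕ.<? n)
  pat n w (nE q)   = does (idx q ℕ.<? n)
  pat n w (nX q)   = does (idx q ℕ.<? n)
  pat n w (nG s _) = does (idx (last s) ℕ.<? n)
  pat n w (nW s)   = does (toℕ s ℕ.<? w)

  pat-own : ∀ {n w} r x → inUnit r x ≡ true → pat n w x ≡ does (idx r ℕ.<? n)
  pat-own r (nA _ _) e with refl ← ==-true e = refl
  pat-own r (nS _ _) e with refl ← ==-true e = refl
  pat-own r (nZ _ _) e with refl ← ==-true e = refl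
  pat-own r (nE _)   e with refl ← ==-true e = refl
  pat-own r (nX _)   e with refl ← ==-true e = refl
  pat-own r (nG _ _) e with refl ← ==-true e = refl

  below-top : ∀ {s t : Seg} → toℕ t ℕ.< toℕ s → isTop t ≡ false
  below-top {s} {t} t<s = isTop-off λ e → ℕ.<⇒≱ t<s
    (ℕ.≤-trans (Fin.toℕ≤pred[n] s) (ℕ.≤-reflexive (trans (sym (Fin.toℕ-fromℕ g′)) (cong toℕ (sym e)))))

  follows : ∀ q t → prev q ≡ last t → isFirst q ≡ false → toℕ t ℕ.< toℕ (seg q)
  follows (suc s , zero)  t e f rewrite sym (cong proj₁ e) | Fin.toℕ-inject₁ s = ℕ.≤-refl
  follows (s     , suc γ) t e f = ⊥-elim (Fin.fromℕ≢inject₁ (sym (cong proj₂ e)))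

  graded : ∀ p s n → (∀ t γ → t ≢ s → Own (does (idx (t , γ) ℕ.<? n)) (t , γ) p) →
           (∀ t → t ≢ s → p (nW t) ≡ does (toℕ t ℕ.<? toℕ s)) →
           idx (s , zero) ℕ.≤ n → n ℕ.≤ suc (idx (last s)) → Graded p s
  graded p s n own w lo hi =
    (λ t t<s → let on = λ γ → <?-on (ℕ.<-≤-trans (idx-seg γ zero t<s) lo)
                   ne = λ e → ℕ.<⇒≢ t<s (cong toℕ e) in
      (λ γ c → trans (own t γ ne (nS (t , γ) c) (==-on refl)) (on γ)) ,
      trans (own t _ ne (nX (last t)) (==-on refl)) (on (fromℕ N′)) ,
      trans (w t ne) (<?-on t<s)) ,
    (λ t s<t → let off = λ γ → <?-off (ℕ.≤-trans hi (idx-seg (fromℕ N′) γ s<t))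
                   ne = λ e → ℕ.<⇒≢ s<t (cong toℕ (sym e)) in
      (λ γ c → trans (own t γ ne (nS (t , γ) c) (==-on refl)) (off γ)) ,
      trans (own t _ ne (nX (last t)) (==-on refl)) (off (fromℕ N′)) ,
      trans (w t ne) (<?-off (ℕ.<⇒≤ s<t)))

  next-last : ∀ s → isTop s ≡ false → isFirst (next (last s)) ≡ false × idx (next (last s)) ≡ suc (idx (last s))
  next-last s t = notFirst , trans (idx-prev (next (last s)) notFirst) (cong (ℕ.suc ∘ idx) (prev-next (last s)))
    where
    notFirst : isFirst (next (last s)) ≡ false
    notFirst with isFirst (next (last s)) in e
    ... | false = refl
    ... | true  = true≢false (isTop-on (cong proj₁ (trans (sym (prev-next (last s))) (prev-first (next (last s)) e)))) t

  private
    rowsum : M.Node → ℤ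
    rowsum = M.field′ (λ _ → true)

    uniform : ∀ {y : M.State} b → (∀ v → y v ≡ b) → ∀ v → M.field′ y v ≡ sg (not b) (rowsum v)
    uniform true  h v = M.field-cong h v
    uniform false h v = trans (M.field-cong h v) (M.field-neg (λ _ → true) v)

    total-lower : ∀ z s b → Graded (cells z) s → (∀ v → lower z v ≡ b) → ∀ v →
                  total z (inj₂ v) ≡ sg (ps s) (driven (cells z) s (M.role v)) + sg (not b) (rowsum v)
    total-lower z s b gr h v = trans (ℤ.+-identityʳ _) (cong₂ _+_ (down-graded (cells z) s gr v) (uniform b h v))

  -- While X of the last unit is unflipped, a head receives at most u - 1 and any other demanding
  -- node at most u. This is `cap`, which `hold` tolerates.
  stable-before : ∀ z s → Graded (cells z) s → cells z (nX (last s)) ≡ false → (∀ v → lower z v ≡ ps s) → ∀ v → Stable z (inj₂ v)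
  stable-before z s gr x h v = by-parity (ps s) refl
    where
    driven≤cap : ∀ r → driven (cells z) s r ≤ cap M.u r
    driven≤cap plain           = ℤ.≤-refl
    driven≤cap (dem γ j true)  rewrite x = ℤ.+-monoˡ-≤ -1ℤ (spins-≤ (fin M.u) λ k → cells z (nS (s , γ) (j , k)))
    driven≤cap (dem γ j false) = ℤ.+-monoˡ-≤ 0ℤ (spins-≤ (fin M.u) λ k → cells z (nS (s , γ) (j , k)))
    driven≤cap end             = sp≤1 (cells z (nW s))
    slack : 0ℤ ≤ rowsum v - driven (cells z) s (M.role v)
    slack = gap (ℤ.≤-trans (driven≤cap (M.role v)) (M.hold v))
    by-parity : ∀ b → ps s ≡ b → Stable z (inj₂ v)
    by-parity true e = good⁺ (trans (h v) e) (0≤total {z} {inj₂ v} (trans (total-lower z s (ps s) gr h v) (cong₂ _+_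
      (cong (λ b → sg b (driven (cells z) s (M.role v))) e) (cong (λ b → sg (not b) (rowsum v)) e))) slack (lemma _ (rowsum v)))
      where lemma : ∀ d r → - d + r ≡ r - d
            lemma = solve-∀
    by-parity false e = good⁻ (trans (h v) e) (total≤0 {z} {inj₂ v} (trans (total-lower z s (ps s) gr h v) (cong₂ _+_
      (cong (λ b → sg b (driven (cells z) s (M.role v))) e) (cong (λ b → sg (not b) (rowsum v)) e))) slack (lemma _ (rowsum v)))
      where lemma : ∀ d r → d + - r ≡ - (r - d)
            lemma = solve-∀

  -- After the wave the driving field supports the new state at the demanding nodes. It opposes it
  -- only at the ending, with weight 1, and `hold` provides that weight.
  stable-after : ∀ z s → Graded (cells z) s → (∀ r → driven (cells z) s r ≡ runExt M.u r) → (∀ v → lower z v ≡ not (ps s)) →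
                 ∀ v → Stable z (inj₂ v)
  stable-after z s gr d h v = by-parity (ps s) refl
    where
    cap+run : ∀ r → 0ℤ ≤ cap M.u r + runExt M.u r
    cap+run plain       = ℤ.≤-refl
    cap+run (dem γ j b) = subst (0ℤ ≤_) (lemma (+ M.u) (ind b)) (nonneg M.u ⊕ nonneg M.u)
      where lemma : ∀ u b → u + u ≡ (u - b) + (u + b)
            lemma = solve-∀
    cap+run end         = ℤ.≤-refl
    slack : 0ℤ ≤ rowsum v + driven (cells z) s (M.role v)
    slack = ℤ.≤-trans (cap+run (M.role v)) (subst (λ t → cap M.u (M.role v) + runExt M.u (M.role v) ≤ rowsum v + t) (sym (d (M.role v)))
      (ℤ.+-monoˡ-≤ (runExt M.u (M.role v)) (M.hold v)))
    by-parity : ∀ b → ps s ≡ b → Stable z (inj₂ v)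
    by-parity true e = good⁻ (trans (h v) (cong not e)) (total≤0 {z} {inj₂ v} (trans (total-lower z s (not (ps s)) gr h v) (cong₂ _+_
      (cong (λ b → sg b (driven (cells z) s (M.role v))) e) (cong (λ b → sg (not (not b)) (rowsum v)) e))) slack (lemma _ (rowsum v)))
      where lemma : ∀ d r → - d + - r ≡ - (r + d)
            lemma = solve-∀
    by-parity false e = good⁺ (trans (h v) (cong not e)) (0≤total {z} {inj₂ v} (trans (total-lower z s (not (ps s)) gr h v) (cong₂ _+_
      (cong (λ b → sg b (driven (cells z) s (M.role v))) e) (cong (λ b → sg (not (not b)) (rowsum v)) e))) slack (ℤ.+-comm _ (rowsum v)))

  quiet-W : ∀ z s t → t ≢ s → Own (does (idx (last t) ℕ.<? idx (last s))) (last t) (cells z) → cells z (nW t) ≡ does (toℕ t ℕ.<? toℕ s) →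
            Stable z (inj₁ (nW t))
  quiet-W z s t ne own w with ℕ.<-cmp (toℕ t) (toℕ s)
  ... | tri< t<s _ _ = stable-W-done z t (below-top t<s) (λ x h → trans (own x h) (<?-on (idx-seg (fromℕ N′) (fromℕ N′) t<s))) (trans w (<?-on t<s))
  ... | tri≈ _ t≡s _ = ⊥-elim (ne (Fin.toℕ-injective t≡s))
  ... | tri> _ _ s<t = stable-W-todo z t (λ x h → trans (own x h) (<?-off (ℕ.<⇒≤ (idx-seg (fromℕ N′) (fromℕ N′) s<t)))) (trans w (<?-off (ℕ.<⇒≤ s<t)))

  rises : Unit → Cell → Bool
  rises q (nA r _) = q == r
  rises q (nS r _) = q == r
  rises q (nZ r _) = q == r
  rises q (nE r)   = q == r
  rises q (nX r)   = false
  rises q (nG s _) = q == last s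
  rises q (nW s)   = false

  ¬rises : ∀ {q r} x → inUnit r x ≡ true → r ≢ q → rises q x ≡ false
  ¬rises (nA _ _) e ne with refl ← ==-true e = ==-off (ne ∘ sym)
  ¬rises (nS _ _) e ne with refl ← ==-true e = ==-off (ne ∘ sym)
  ¬rises (nZ _ _) e ne with refl ← ==-true e = ==-off (ne ∘ sym)
  ¬rises (nE _)   e ne with refl ← ==-true e = ==-off (ne ∘ sym)
  ¬rises (nX _)   e ne = refl
  ¬rises (nG _ _) e ne with refl ← ==-true e = ==-off (ne ∘ sym)

  -- Unit q is flipping.  All couplings inside `rises q` are attractive, so its cells flip at
  -- most once; X q flips only when all of them have done so.
  record Trap (q : Unit) (z : State) : Set where
    field
      fixed  : ∀ x → rises q x ≡ false → z (inj₁ x) ≡ pat (idx q) (toℕ (seg q)) x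
      -- Strict positivity is more than stability: from the positive field of a flipped E,
      -- `complete` recovers that all A and Z have flipped.
      rising : ∀ x → rises q x ≡ true → z (inj₁ x) ≡ true → 0ℤ < total z (inj₁ x)
      wait   : ∀ v → lower z v ≡ ps (seg q)

  private
    over₁ : ∀ {a b c x y w} → x + y + w ≤ a + b + c → a < x → b ≤ y → c ≤ w → ⊥
    over₁ h p q r = ℤ.<⇒≱ (ℤ.+-mono-<-≤ (ℤ.+-mono-<-≤ p q) r) h

    over₂ : ∀ {a b c x y w} → x + y + w ≤ a + b + c → a ≤ x → b < y → c ≤ w → ⊥
    over₂ h p q r = ℤ.<⇒≱ (ℤ.+-mono-<-≤ (ℤ.+-mono-≤-< p q) r) h

    over₃ : ∀ {a b c x y w} → x + y + w ≤ a + b + c → a ≤ x → b ≤ y → c < w → ⊥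
    over₃ h p q r = ℤ.<⇒≱ (ℤ.+-mono-≤-< (ℤ.+-mono-≤ p q) r) h

    tight-X : ∀ {a e n g l s h} → 0ℤ < (a + e + n + g) + l → n ≡ - s → l ≡ - h → s + 1ℤ + h ≤ a + e + g
    tight-X {a} {e} {g = g} {s = s} {h} p refl refl = ≤-by (gap< p) (lemma a e g s h)
      where lemma : ∀ a e g s h → (a + e + g) - (s + 1ℤ + h) ≡ ((a + e + - s + g) + - h) - (1ℤ + 0ℤ)
            lemma = solve-∀

    tight-E : ∀ {a t n x w s} → 0ℤ < a + t + n + x + w → n ≡ - s → x ≡ -1ℤ → w ≤ 0ℤ → s + + 3 ≤ (a + t) + 1ℤ
    tight-E {a} {t} {w = w} {s} p refl refl q = ≤-by (gap< p ⊕ gap q) (lemma a t w s)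
      where lemma : ∀ a t w s → ((a + t) + 1ℤ) - (s + + 3) ≡ ((a + t + - s + -1ℤ + w) - (1ℤ + 0ℤ)) + (0ℤ - w)
            lemma = solve-∀

    over₄ : ∀ {a t s} → s + + 3 ≤ (a + t) + 1ℤ → a + + 2 ≤ s → t ≤ + 3 → ⊥
    over₄ {a} {t} {s} h p q = absurd-by (gap h ⊕ gap p ⊕ gap q) (lemma a t s)
      where lemma : ∀ a t s → (((a + t) + 1ℤ) - (s + + 3)) + ((s - (a + + 2)) + (+ 3 - t)) ≡ -1ℤ
            lemma = solve-∀

    over₅ : ∀ {a t s} → s + + 3 ≤ (a + t) + 1ℤ → a ≤ s → t + + 2 ≤ + 3 → ⊥
    over₅ {a} {t} {s} h p q = absurd-by (gap h ⊕ gap p ⊕ gap q) (lemma a t s)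
      where lemma : ∀ a t s → (((a + t) + 1ℤ) - (s + + 3)) + ((s - a) + (+ 3 - (t + + 2))) ≡ -1ℤ
            lemma = solve-∀

    missing< : ∀ {a b} → a + + 2 ≤ b → a < b
    missing< {a} {b} p = <-by (gap p ⊕ nonneg 1) (lemma a b)
      where lemma : ∀ a b → b - (1ℤ + a) ≡ (b - (a + + 2)) + 1ℤ
            lemma = solve-∀

  module _ {q z} (trap : Trap q z) where
    open Trap trap

    private
      p = cells z
      s = seg q

    own : ∀ {r} → r ≢ q → Own (does (idx r ℕ.<? idx q)) r p
    own {r} ne x e = trans (fixed x (¬rises x e ne)) (pat-own r x e)

    X-off : p (nX q) ≡ false
    X-off = trans (fixed (nX q) refl) (<?-off (ℕ.≤-refl {idx q}))

    W-off : p (nW s) ≡ false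
    W-off = trans (fixed (nW s) refl) (<?-off (ℕ.≤-refl {toℕ s}))

    prev-flipped : does (idx (prev q) ℕ.<? idx q) ≡ not (isFirst q)
    prev-flipped with isFirst q in e
    ... | true  = <?-off (subst (ℕ._≤ idx (prev q)) (sym (isFirst-idx q e)) z≤n)
    ... | false = <?-on (ℕ.≤-reflexive (sym (idx-prev q e)))

    private
      ahead : ∀ f → act true (not f) (not f) ≡ 1ℤ
      ahead true  = refl
      ahead false = refl

    -- The first unit sees an unflipped predecessor through the repulsive link, every other unit a
    -- flipped one through an attractive link.
    pX≡1 : pX p q ≡ 1ℤ
    pX≡1 = trans (cong (act true (not (isFirst q))) (trans (own (prev≢ q) (nX (prev q)) (==-on refl)) prev-flipped)) (ahead (isFirst q))

    pE≡1 : pE p q ≡ 1ℤ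
    pE≡1 = trans (cong (act true (not (isFirst q))) (trans (own (prev≢ q) (nE (prev q)) (==-on refl)) prev-flipped)) (ahead (isFirst q))

    -- A node W that is able to block q belongs to an earlier segment and has already flipped.
    0≤pW : 0ℤ ≤ pW p q
    0≤pW = lemma _ _ refl refl
      where
      t = seg (prev q)
      lemma : ∀ a b → isTop t ≡ a → (last t == prev q) ≡ b → 0ℤ ≤ pW p q
      lemma true  b     e e′ rewrite e = ℤ.≤-refl
      lemma false false e e′ rewrite e | e′ = ℤ.≤-refl
      lemma false true  e e′ = subst (0ℤ ≤_) (sym value) (nonneg 1)
        where
        f : isFirst q ≡ false
        f with isFirst q in h
        ... | false = refl
        ... | true  = true≢false (isTop-on (cong proj₁ (prev-first q h))) e
        value : pW p q ≡ 1ℤ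
        value = trans
          (cong₂ (λ a d → act a d (p (nW t))) (cong₂ (λ a b → not a ∧ b) e e′)
            (trans (cong (λ r → par q xor par r) (==-true e′)) (trans (par-prev q) (cong not f))))
          (cong sp (trans (fixed (nW t) refl) (<?-on (follows q t (sym (==-true e′)) f))))

    next≢ : next q ≢ q
    next≢ e = prev≢ q (trans (cong prev (sym e)) (prev-next q))

    behind : Behind p q
    behind = (λ k → trans (own next≢ (nA (next q) k) (==-on refl)) value) , (λ c → trans (own next≢ (nS (next q) c) (==-on refl)) value)
      where
      value : does (idx (next q) ℕ.<? idx q) ≡ isFirst (next q)
      value with isFirst (next q) in e
      ... | true  = <?-on (subst (ℕ._< idx q) (sym (isFirst-idx (next q) e))
                          (ℕ.n≢0⇒n>0 λ h → next≢ (idx-injective (trans (isFirst-idx (next q) e) (sym h)))))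
      ... | false = <?-off (ℕ.<⇒≤ (ℕ.≤-reflexive (trans (cong (ℕ.suc ∘ idx) (sym (prev-next q))) (sym (idx-prev (next q) e)))))

    wE≤0 : wE p q ≤ 0ℤ
    wE≤0 = lemma _ refl
      where
      lemma : ∀ b → (last s == q) ≡ b → wE p q ≤ 0ℤ
      lemma true e = ℤ.≤-trans (ℤ.≤-reflexive (trans
        (cong₂ (λ a d → act a d (p (nW s))) e (trans (cong (λ r → not (par q) xor par r) (==-true e)) (not-xor (par q))))
        (cong sp W-off))) -≤+
      lemma false e rewrite e = ℤ.≤-refl

    private
      infixr 4 _▸_
      _▸_ : ∀ {x} → p x ≡ false → 0ℤ < total z (inj₁ x) → ∃ (Unstable ext z)
      _▸_ {x} e h = inj₁ x , subst (λ b → Bad b (total z (inj₁ x))) (sym e) h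

    -- In the order A, S, Z, E, G, X, the first group with an unflipped node is ready: the earlier
    -- groups it depends on are complete, and the later ones are counted at their worst.
    progress : ∃ (Unstable ext z)
    progress = at-A (all⊎missing (fin σ) λ k → p (nA q k))
      where
      lemmaA : ∀ a e x w f s → (a + e + x + w) + ((1ℤ + s) + f) ≡ 1ℤ + ((a - - s) + ((e - -1ℤ) + ((x - 1ℤ) + (w + f))))
      lemmaA = solve-∀
      lemmaS : ∀ a t e x w l s d → (a + t + e + x + w) + l ≡
               1ℤ + ((a - s) + ((t - - + 3) + ((e - 1ℤ) + ((x - -1ℤ) + ((w - -1ℤ) + ((l - - d) + (s - (d + + 5))))))))
      lemmaS = solve-∀
      lemmaZ : ∀ a e g s d h l → a + e + g ≡
               1ℤ + ((a - s) + ((e - -1ℤ) + ((g - - l) + ((h - l) + ((d - h) + ((s - (d + + 5)) + + 3))))))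
      lemmaZ = solve-∀
      lemmaE : ∀ a t n x w s → a + t + n + x + w ≡ 1ℤ + ((a - s) + ((t - + 3) + ((n - - s) + ((x - -1ℤ) + (w - -1ℤ)))))
      lemmaE = solve-∀
      lemmaG : ∀ a x → a + x ≡ 1ℤ + ((a - + 3) + ((x - -1ℤ) + 1ℤ))
      lemmaG = solve-∀
      lemmaX : ∀ a e n g l s h → (a + e + n + g) + l ≡ 1ℤ + ((a - s) + ((e - 1ℤ) + ((n - - s) + ((g - h) + (l - - h)))))
      lemmaX = solve-∀
      module _ (allS : ∀ c → p (nS q c) ≡ true) (allZ : ∀ k → p (nZ q k) ≡ true) (isE : p (nE q) ≡ true) where
        at-X : (last s ≡ q → ∀ k → p (nG s k) ≡ true) → ∃ (Unstable ext z)
        at-X allG = X-off ▸ 0<total {z} {inj₁ (nX q)} (total-X z q)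
          (≥-of (spins-all slots true allS) ⊕ ≥-of (cong sp isE) ⊕ ≥-of (behind-A {p} {q} behind) ⊕ ≥-of (gZ-all p q allG) ⊕ gap (-≤upX q (lower z)))
          (lemmaX (σS p q) (sp (p (nE q))) (xA p q) (gZ p q) (up (nX q) (lower z)) (+ σ) (lastη q))
        at-G : last s ≡ q → (∀ k → p (nG s k) ≡ true) ⊎ (∃ λ k → p (nG s k) ≡ false) → ∃ (Unstable ext z)
        at-G last≡q (inj₁ allG)    = at-X λ _ → allG
        at-G last≡q (inj₂ (k , e)) = e ▸ 0<total {z} {inj₁ (nG s k)} (total-G z s k)
          (≥-of (trans (cong (σZ p) last≡q) (spins-all (fin 3) true allZ)) ⊕ gap (-1≤sp (p (nX (last s)))) ⊕ nonneg 1)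
          (lemmaG (σZ p (last s)) (sp (p (nX (last s)))))
        at-last : Dec (last s ≡ q) → ∃ (Unstable ext z)
        at-last (no ne)  = at-X λ e → ⊥-elim (ne e)
        at-last (yes e)  = at-G e (all⊎missing (fin M.η) λ k → p (nG s k))
      module _ (allA : ∀ k → p (nA q k) ≡ true) where
        at-E : (∀ c → p (nS q c) ≡ true) → (∀ k → p (nZ q k) ≡ true) → ∀ b → p (nE q) ≡ b → ∃ (Unstable ext z)
        at-E allS allZ true  e = at-last allS allZ e (last s ≟ q)
        -- The next S cancel A; the three nodes Z then beat X and W by 1, which is why there are
        -- three.
        at-E allS allZ false e = e ▸ 0<total {z} {inj₁ (nE q)} (total-E z q)
          (≥-of (spins-all (fin σ) true allA) ⊕ ≥-of (spins-all (fin 3) true allZ) ⊕ ≥-of (behind-S {p} {q} behind) ⊕ gap (-1≤sp (p (nX q))) ⊕ -1≤wE p q)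
          (lemmaE (σA p q) (σZ p q) (xS p q) (sp (p (nX q))) (wE p q) (+ σ))
        at-Z : (∀ c → p (nS q c) ≡ true) → (∀ k → p (nZ q k) ≡ true) ⊎ (∃ λ k → p (nZ q k) ≡ false) → ∃ (Unstable ext z)
        at-Z allS (inj₁ allZ)    = at-E allS allZ _ refl
        at-Z allS (inj₂ (k , e)) = e ▸ 0<total {z} {inj₁ (nZ q k)} (total-Z z q k)
          (≥-of (spins-all slots true allS) ⊕ gap (-1≤sp (p (nE q))) ⊕ gap (-≤gZ p q) ⊕ gap (lastη≤ q) ⊕ D-η ⊕ σ-light ⊕ nonneg 3)
          (lemmaZ (σS p q) (sp (p (nE q))) (gZ p q) (+ σ) (+ M.D) (+ M.η) (lastη q))
        at-S : (∀ c → p (nS q c) ≡ true) ⊎ (∃ λ c → p (nS q c) ≡ false) → ∃ (Unstable ext z)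
        at-S (inj₁ allS)    = at-Z allS (all⊎missing (fin 3) λ k → p (nZ q k))
        -- The σ nodes A and the previous E face three nodes Z, X, W and a pull of at most D from
        -- below. The condition D + 5 ≤ σ leaves a margin of 1.
        at-S (inj₂ (c , e)) = e ▸ 0<total {z} {inj₁ (nS q c)} (total-S z q c)
          (≥-of (spins-all (fin σ) true allA) ⊕ gap (-≤spins (fin 3) λ k → p (nZ q k)) ⊕ ≥-of pE≡1 ⊕ gap (-1≤sp (p (nX q)))
            ⊕ -1≤wS p q ⊕ gap (-≤upS q c (lower z)) ⊕ σ-light)
          (lemmaS (σA p q) (σZ p q) (pE p q) (sp (p (nX q))) (wS p q) (up (nS q c) (lower z)) (+ σ) (+ M.D))
      at-A : (∀ k → p (nA q k) ≡ true) ⊎ (∃ λ k → p (nA q k) ≡ false) → ∃ (Unstable ext z)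
      at-A (inj₁ allA)    = at-S allA (all⊎missing slots λ c → p (nS q c))
      at-A (inj₂ (k , e)) = e ▸ 0<total {z} {inj₁ (nA q k)} (total-A z q k)
        (gap (-≤spins slots λ c → p (nS q c)) ⊕ gap (-1≤sp (p (nE q))) ⊕ ≥-of pX≡1 ⊕ 0≤pW ⊕ ind≥0 (isFirst q))
        (lemmaA (σS p q) (sp (p (nE q))) (pX p q) (pW p q) (ind (isFirst q)) (+ σ))

    -- X has field exactly 1 when S, E and, in a last unit, G have all flipped, so one missing node
    -- would make it negative. E is then flipped and has a positive field by `rising`, which in the
    -- same way forces all A and Z.
    complete : 0ℤ < total z (inj₁ (nX q)) → ∀ x → rises q x ≡ true → p x ≡ true
    complete h = result
      where
      tX : + σ + 1ℤ + lastη q ≤ σS p q + sp (p (nE q)) + gZ p q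
      tX = tight-X {σS p q} {sp (p (nE q))} {xA p q} {gZ p q} {up (nX q) (lower z)} {+ σ} {lastη q}
        (subst (0ℤ <_) (total-X z q) h) (behind-A {p} {q} behind) (upX-before q (lower z) wait)
      S≤ : σS p q ≤ + σ
      S≤ = spins-≤ slots λ c → p (nS q c)
      allS : (∀ c → p (nS q c) ≡ true) ⊎ (∃ λ c → p (nS q c) ≡ false) → ∀ c → p (nS q c) ≡ true
      allS (inj₁ all) = all
      allS (inj₂ (c , e)) = ⊥-elim (over₁ {σS p q} tX (missing< {σS p q} (spins-missing slots (λ c → p (nS q c)) {c} e)) (sp≤1 (p (nE q))) (gZ≤ p q))
      isE′ : ∀ b → p (nE q) ≡ b → p (nE q) ≡ true
      isE′ true  e = e
      isE′ false e = ⊥-elim (over₂ {σS p q} {sp (p (nE q))} {gZ p q} tX S≤ (subst (λ b → sp b < 1ℤ) (sym e) -<+) (gZ≤ p q))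
      isE : p (nE q) ≡ true
      isE = isE′ (p (nE q)) refl
      allG : last s ≡ q → (∀ k → p (nG s k) ≡ true) ⊎ (∃ λ k → p (nG s k) ≡ false) → ∀ k → p (nG s k) ≡ true
      allG last≡q (inj₁ all) = all
      allG last≡q (inj₂ (k , e)) = ⊥-elim (over₃ {σS p q} {sp (p (nE q))} {gZ p q} tX S≤ (sp≤1 (p (nE q))) (missing< fewG))
        where
        spinsG : gZ p q ≡ spins (fin M.η) (λ k → p (nG s k))
        spinsG = sum-cong (fin M.η) λ k → cong₂ (λ a d → act a d (p (nG s k))) (==-on last≡q)
          (trans (cong (λ r → par q xor not (par r)) last≡q) (xor-not (par q)))
        fewG : gZ p q + + 2 ≤ lastη q
        fewG = subst₂ (λ g h → g + + 2 ≤ h) (sym spinsG) (sym (cong (λ b → if b then + M.η else 0ℤ) (==-on last≡q)))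
                      (spins-missing (fin M.η) (λ k → p (nG s k)) {k} e)
      tE : + σ + + 3 ≤ (σA p q + σZ p q) + 1ℤ
      tE = tight-E {σA p q} {σZ p q} {xS p q} {sp (p (nX q))} {wE p q} {+ σ}
        (subst (0ℤ <_) (total-E z q) (rising (nE q) (==-on refl) isE)) (behind-S {p} {q} behind) (cong sp X-off) wE≤0
      allA : (∀ k → p (nA q k) ≡ true) ⊎ (∃ λ k → p (nA q k) ≡ false) → ∀ k → p (nA q k) ≡ true
      allA (inj₁ all) = all
      allA (inj₂ (k , e)) = ⊥-elim (over₄ {σA p q} {σZ p q} tE (spins-missing (fin σ) (λ k → p (nA q k)) {k} e) (spins-≤ (fin 3) λ k → p (nZ q k)))
      allZ : (∀ k → p (nZ q k) ≡ true) ⊎ (∃ λ k → p (nZ q k) ≡ false) → ∀ k → p (nZ q k) ≡ true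
      allZ (inj₁ all) = all
      allZ (inj₂ (k , e)) = ⊥-elim (over₅ {σA p q} {σZ p q} tE (spins-≤ (fin σ) λ k → p (nA q k)) (spins-missing (fin 3) (λ k → p (nZ q k)) {k} e))
      result : ∀ x → rises q x ≡ true → p x ≡ true
      result (nA r k) e = subst (λ r → p (nA r k) ≡ true) (==-true e) (allA (all⊎missing (fin σ) λ k → p (nA q k)) k)
      result (nS r c) e = subst (λ r → p (nS r c) ≡ true) (==-true e) (allS (all⊎missing slots λ c → p (nS q c)) c)
      result (nZ r k) e = subst (λ r → p (nZ r k) ≡ true) (==-true e) (allZ (all⊎missing (fin 3) λ k → p (nZ q k)) k)
      result (nE r)   e = subst (λ r → p (nE r) ≡ true) (==-true e) isE
      result (nG t k) e = subst (λ t → p (nG t k) ≡ true) (cong proj₁ (==-true e))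
        (allG (sym (trans (==-true e) (cong last (sym (cong proj₁ (==-true e)))))) (all⊎missing (fin M.η) λ k → p (nG s k)) k)

    private
      Own-at : ∀ {r b} → r ≢ q → does (idx r ℕ.<? idx q) ≡ b → Own b r p
      Own-at ne e x h = trans (own ne x h) e

    -- For a unit still to come, X of the predecessor is unflipped, even if the predecessor is q
    -- itself. Its pull -1 is not overcome by W.
    quiet-A : ∀ r k → r ≢ q → Stable z (inj₁ (nA r k))
    quiet-A r k ne with idx r ℕ.<? idx q
    ... | yes r<q = stable-A-done z r k (Own-at ne (<?-on r<q))
    ... | no  r≮q = stable-A-todo z r k (Own-at ne (<?-off (ℕ.≮⇒≥ r≮q))) notFirst
                      (ℤ.+-mono-≤ {pX p r} { -1ℤ } {pW p r} {1ℤ} (ℤ.≤-reflexive pX≡-1)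
                        (act≤1 (not (isTop (seg (prev r))) ∧ (last (seg (prev r)) == prev r)) (par r xor par (last (seg (prev r)))) (p (nW (seg (prev r))))))
      where
      q<r : idx q ℕ.< idx r
      q<r = ℕ.≤∧≢⇒< (ℕ.≮⇒≥ r≮q) λ e → ne (idx-injective (sym e))
      notFirst : isFirst r ≡ false
      notFirst with isFirst r in e
      ... | false = refl
      ... | true  = ⊥-elim (ℕ.n≮0 (subst (idx q ℕ.<_) (isFirst-idx r e) q<r))
      prev-off : p (nX (prev r)) ≡ false
      prev-off with prev r ≟ q
      ... | yes e  = trans (cong (λ t → p (nX t)) e) X-off
      ... | no ne′ = trans (own ne′ (nX (prev r)) (==-on refl)) (<?-off (ℕ.s≤s⁻¹ (subst (idx q ℕ.<_) (idx-prev r notFirst) q<r)))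
      pX≡-1 : pX p r ≡ -1ℤ
      pX≡-1 = cong₂ (λ f b → act true (not f) b) notFirst prev-off

    quiet : ∀ x → rises q x ≡ false → x ≢ nX q → Stable z (inj₁ x)
    quiet (nA r k) e ne = quiet-A r k λ { refl → true≢false (==-on refl) e }
    quiet (nS r c) e ne = robust z _ r (own λ { refl → true≢false (==-on refl) e }) (nS r c) (==-on refl) refl
    quiet (nZ r k) e ne = robust z _ r (own λ { refl → true≢false (==-on refl) e }) (nZ r k) (==-on refl) refl
    quiet (nE r)   e ne = robust z _ r (own λ { refl → true≢false (==-on refl) e }) (nE r) (==-on refl) refl
    quiet (nX r)   e ne = robust z _ r (own λ { refl → ne refl }) (nX r) (==-on refl) refl
    quiet (nG t k) e ne = robust z _ (last t) (own λ { refl → true≢false (==-on refl) e }) (nG t k) (==-on refl) refl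
    quiet (nW t)   e ne with t Fin.≟ s
    ... | no t≢s  = quiet-W z s t t≢s (Own-at (λ e → t≢s (cong proj₁ e)) (order t≢s)) (fixed (nW t) refl)
      where
      order : ∀ {t} → t ≢ s → does (idx (last t) ℕ.<? idx q) ≡ does (idx (last t) ℕ.<? idx (last s))
      order {t} t≢s with ℕ.<-cmp (toℕ t) (toℕ s)
      ... | tri< t<s _ _ = trans (<?-on (idx-seg (fromℕ N′) (proj₂ q) t<s)) (sym (<?-on (idx-seg (fromℕ N′) (fromℕ N′) t<s)))
      ... | tri≈ _ e _   = ⊥-elim (t≢s (Fin.toℕ-injective e))
      ... | tri> _ _ s<t = trans (<?-off (ℕ.<⇒≤ (idx-seg (proj₂ q) (fromℕ N′) s<t))) (sym (<?-off (ℕ.<⇒≤ (idx-seg (fromℕ N′) (fromℕ N′) s<t))))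
    ... | yes refl = stable-W-waiting z s behind-last (wait M.ending) W-off
      where
      behind-last : isTop s ≡ false → Behind p (last s)
      behind-last t = (λ k → value (nA r k) (==-on refl)) , (λ c → value (nS r c) (==-on refl))
        where
        r = next (last s)
        q<r : idx q ℕ.< idx r
        q<r = subst (idx q ℕ.<_) (sym (proj₂ (next-last s t))) (s≤s (idx-last s (proj₂ q)))
        value : ∀ x → inUnit r x ≡ true → p x ≡ isFirst r
        value x e = trans (own (λ e → ℕ.<⇒≢ q<r (cong idx (sym e))) x e) (trans (<?-off (ℕ.<⇒≤ q<r)) (sym (proj₁ (next-last s t))))

    graded-trap : Graded p s
    graded-trap = graded p s (idx q) (λ t γ ne → own (λ e → ne (cong proj₁ e))) (λ t ne → fixed (nW t) refl)
      (ℕ.+-monoʳ-≤ (toℕ s * suc N′) z≤n) (ℕ.m≤n⇒m≤1+n (idx-last s (proj₂ q)))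

    last-off : p (nX (last s)) ≡ false
    last-off = trans (fixed (nX (last s)) refl) (<?-off (idx-last s (proj₂ q)))

    quiet-lower : ∀ v → Stable z (inj₂ v)
    quiet-lower = stable-before z s graded-trap last-off wait

  -- Inside a unit every edge joins opposite frame colours. An edge from E to S leads to the next
  -- unit, which differs from q because no unit is its own predecessor.
  attracts : ∀ q x y → rises q x ≡ true → rises q y ≡ true → Attracts (inj₁ x) (inj₁ y)
  attracts q x y e f a = ordered x y (both x y a) e f
    where
    both : ∀ x y → arrow x y ∨ arrow y x ≡ true → arrow x y ≡ true ⊎ arrow y x ≡ true
    both x y a with arrow x y
    ... | true  = inj₁ refl
    ... | false = inj₂ a
    forward : ∀ x y → arrow x y ≡ true → rises q x ≡ true → rises q y ≡ true → shade x xor shade y ≡ true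
    forward (nA _ _) (nS _ _) a e f with refl ← ==-true e with refl ← ==-true f = xor-not (par q)
    forward (nA _ _) (nE _)   a e f with refl ← ==-true e with refl ← ==-true f = xor-not (par q)
    forward (nS _ _) (nZ _ _) a e f with refl ← ==-true e with refl ← ==-true f = not-xor (par q)
    forward (nS _ _) (nX _)   a e ()
    forward (nE _)   (nX _)   a e ()
    forward (nG _ _) (nX _)   a e ()
    forward (nZ _ _) (nE _)   a e f with refl ← ==-true e with refl ← ==-true f = xor-not (par q)
    forward (nE _)   (nS _ _) a e f with refl ← ==-true e with refl ← ==-true f = ⊥-elim (prev≢ q (sym (==-true a)))
    forward (nG _ _) (nZ _ _) a e f with refl ← ==-true e with refl ← ==-true f = not-xor (par q)
    ordered : ∀ x y → arrow x y ≡ true ⊎ arrow y x ≡ true → rises q x ≡ true → rises q y ≡ true → shade x xor shade y ≡ true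
    ordered x y (inj₁ a) e f = forward x y a e f
    ordered x y (inj₂ a) e f = trans (xor-sym (shade x) (shade y)) (forward y x a f e)

  rises⇒inUnit : ∀ q x → rises q x ≡ true → inUnit q x ≡ true
  rises⇒inUnit q (nA _ _) e = e
  rises⇒inUnit q (nS _ _) e = e
  rises⇒inUnit q (nZ _ _) e = e
  rises⇒inUnit q (nE _)   e = e
  rises⇒inUnit q (nG _ _) e = e

  classify : ∀ q x → rises q x ≡ true ⊎ x ≡ nX q ⊎ (rises q x ≡ false × x ≢ nX q)
  classify q x with rises q x in e
  classify q x        | true = inj₁ refl
  classify q (nA _ _) | false = inj₂ (inj₂ (refl , λ ()))
  classify q (nS _ _) | false = inj₂ (inj₂ (refl , λ ()))
  classify q (nZ _ _) | false = inj₂ (inj₂ (refl , λ ()))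
  classify q (nE _)   | false = inj₂ (inj₂ (refl , λ ()))
  classify q (nG _ _) | false = inj₂ (inj₂ (refl , λ ()))
  classify q (nW _)   | false = inj₂ (inj₂ (refl , λ ()))
  classify q (nX r)   | false with r ≟ q
  ... | yes refl = inj₂ (inj₁ refl)
  ... | no ne    = inj₂ (inj₂ (refl , λ { refl → ne refl }))

  Stage : ℕ → ℕ → Bool → State → Set
  Stage n w b z = (∀ x → cells z x ≡ pat n w x) × (∀ v → lower z v ≡ b)

  enter : ∀ q z → Stage (idx q) (toℕ (seg q)) (ps (seg q)) z → Trap q z
  enter q z (h , low) = record
    { fixed  = λ x _ → h x
    ; rising = λ x e t → true≢false t (trans (h x) (trans (pat-own q x (rises⇒inUnit q x e)) (<?-off (ℕ.≤-refl {idx q}))))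
    ; wait   = low }

  lt-suc : ∀ {q} r → r ≢ q → does (idx r ℕ.<? suc (idx q)) ≡ does (idx r ℕ.<? idx q)
  lt-suc {q} r ne with ℕ.<-cmp (idx r) (idx q)
  ... | tri< r<q _ _ = trans (<?-on (ℕ.m≤n⇒m≤1+n r<q)) (sym (<?-on r<q))
  ... | tri≈ _ e _   = ⊥-elim (ne (idx-injective e))
  ... | tri> _ _ q<r = trans (<?-off q<r) (sym (<?-off (ℕ.<⇒≤ q<r)))

  pat-suc : ∀ q w x → rises q x ≡ false → x ≢ nX q → pat (suc (idx q)) w x ≡ pat (idx q) w x
  pat-suc q w x e ne = by x e ne
    where
    by : ∀ x → rises q x ≡ false → x ≢ nX q → pat (suc (idx q)) w x ≡ pat (idx q) w x
    by (nA r _) e ne = lt-suc {q} r λ { refl → true≢false (==-on refl) e }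
    by (nS r _) e ne = lt-suc {q} r λ { refl → true≢false (==-on refl) e }
    by (nZ r _) e ne = lt-suc {q} r λ { refl → true≢false (==-on refl) e }
    by (nE r)   e ne = lt-suc {q} r λ { refl → true≢false (==-on refl) e }
    by (nX r)   e ne = lt-suc {q} r λ { refl → ne refl }
    by (nG t _) e ne = lt-suc {q} (last t) λ { refl → true≢false (==-on refl) e }
    by (nW t)   e ne = refl

  module _ {q z z′} (trap : Trap q z) (st : Step ext z z′) where
    open Trap trap

    private
      keep : ∀ x → rises q x ≡ false → x ≢ nX q → z′ (inj₁ x) ≡ z (inj₁ x)
      keep x e ne = kept st (inj₁ x) (quiet trap x e ne)

      keep-lower : ∀ v → z′ (inj₂ v) ≡ z (inj₂ v)
      keep-lower v = kept st (inj₂ v) (quiet-lower trap v)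

      keep-true : ∀ x → rises q x ≡ true → z (inj₁ x) ≡ true → z′ (inj₁ x) ≡ true
      keep-true x e t = trans (kept st (inj₁ x) (good⁺ t (ℤ.<⇒≤ (rising x e t)))) t

      was-positive : ∀ x → rises q x ≡ true → z′ (inj₁ x) ≡ true → 0ℤ < total z (inj₁ x)
      was-positive x e t′ = by _ refl
        where
        by : ∀ b → z (inj₁ x) ≡ b → 0ℤ < total z (inj₁ x)
        by true  t = rising x e t
        by false f = subst (λ b → Bad b (total z (inj₁ x))) f (st (inj₁ x) λ same → true≢false t′ (trans same f))

      -- While X of q stays unflipped, the only changes are cells of `rises q` going from -1 to +1,
      -- and these attract each other, so `field-mono` applies.
      total-mono : z′ (inj₁ (nX q)) ≡ false → ∀ x → rises q x ≡ true → total z (inj₁ x) ≤ total z′ (inj₁ x)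
      total-mono off x e = ℤ.+-monoˡ-≤ (ext (inj₁ x)) (field-mono {z} {z′} (inj₁ x) compare)
        where
        risen : ∀ y → rises q y ≡ true → ∀ b → z (inj₁ y) ≡ b → z (inj₁ y) ≡ z′ (inj₁ y) ⊎ (Attracts (inj₁ x) (inj₁ y) × z (inj₁ y) ≡ false)
        risen y f true  t = inj₁ (trans t (sym (keep-true y f t)))
        risen y f false t = inj₂ (attracts q x y e f , t)
        compare : ∀ j → z j ≡ z′ j ⊎ (Attracts (inj₁ x) j × z j ≡ false)
        compare (inj₂ v) = inj₁ (sym (keep-lower v))
        compare (inj₁ y) with classify q y
        ... | inj₁ f               = risen y f _ refl
        ... | inj₂ (inj₁ refl)     = inj₁ (trans (X-off trap) (sym off))
        ... | inj₂ (inj₂ (f , ne)) = inj₁ (sym (keep y f ne))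

    -- If X of q flips, its field was positive, so by `complete` all other cells of the unit had
    -- flipped before this step and the outcome is determined. Otherwise the positive fields persist
    -- by `total-mono`.
    trap-step : Trap q z′ ⊎ Stage (suc (idx q)) (toℕ (seg q)) (ps (seg q)) z′
    trap-step = by _ refl
      where
      by : ∀ b → z′ (inj₁ (nX q)) ≡ b → Trap q z′ ⊎ Stage (suc (idx q)) (toℕ (seg q)) (ps (seg q)) z′
      by false off = inj₁ record
        { fixed  = λ x e → same x e
        ; rising = λ x e t → ℤ.<-≤-trans (was-positive x e t) (total-mono off x e)
        ; wait   = λ v → trans (keep-lower v) (wait v) }
        where
        same : ∀ x → rises q x ≡ false → z′ (inj₁ x) ≡ pat (idx q) (toℕ (seg q)) x
        same x e with classify q x
        ... | inj₁ t               = true≢false t e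
        ... | inj₂ (inj₁ refl)     = trans off (sym (<?-off (ℕ.≤-refl {idx q})))
        ... | inj₂ (inj₂ (_ , ne)) = trans (keep x e ne) (fixed x e)
      by true on = inj₂ (flipped , λ v → trans (keep-lower v) (wait v))
        where
        all : ∀ x → rises q x ≡ true → z (inj₁ x) ≡ true
        all = complete trap (subst (λ b → Bad b (total z (inj₁ (nX q)))) (X-off trap)
          (st (inj₁ (nX q)) λ same → true≢false on (trans same (X-off trap))))
        flipped : ∀ x → z′ (inj₁ x) ≡ pat (suc (idx q)) (toℕ (seg q)) x
        flipped x with classify q x
        ... | inj₁ e               = trans (keep-true x e (all x e)) (sym (trans (pat-own q x (rises⇒inUnit q x e)) (<?-on (ℕ.n<1+n (idx q)))))
        ... | inj₂ (inj₁ refl)     = trans on (sym (<?-on (ℕ.n<1+n (idx q))))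
        ... | inj₂ (inj₂ (e , ne)) = trans (keep x e ne) (trans (fixed x e) (sym (pat-suc q (toℕ (seg q)) x e ne)))

  -- The stage in which all units of the segment s have flipped and W s waits for the lower machine
  low : Seg → Sys.State chain
  low s = pat (suc (idx (last s))) (toℕ s)

  module _ {s z} (h : ∀ x → cells z x ≡ low s x) where

    private
      p = cells z

      own-low : ∀ {b} r → does (idx r ℕ.<? suc (idx (last s))) ≡ b → Own b r p
      own-low r e x i = trans (h x) (trans (pat-own r x i) e)

    low-W : p (nW s) ≡ false
    low-W = trans (h (nW s)) (<?-off (ℕ.≤-refl {toℕ s}))

    low-done : Own true (last s) p
    low-done = own-low (last s) (<?-on (ℕ.n<1+n (idx (last s))))

    low-behind : isTop s ≡ false → Behind p (last s)
    low-behind t = (λ k → value (nA r k) (==-on refl)) , (λ c → value (nS r c) (==-on refl))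
      where
      r = next (last s)
      value : ∀ x → inUnit r x ≡ true → p x ≡ isFirst r
      value x e = trans (own-low r (<?-off (ℕ.≤-reflexive (sym (proj₂ (next-last s t))))) x e) (sym (proj₁ (next-last s t)))

    low-graded : Graded p s
    low-graded = graded p s (suc (idx (last s))) (λ t γ ne → own-low (t , γ) refl) (λ t ne → h (nW t))
      (ℕ.m≤n⇒m≤1+n (ℕ.+-monoʳ-≤ (toℕ s * suc N′) z≤n)) ℕ.≤-refl

    low-driven : ∀ r → driven p s r ≡ runExt M.u r
    low-driven plain       = refl
    low-driven end         = cong sp low-W
    low-driven (dem γ j b) = cong₂ _+_
      (spins-all (fin M.u) true λ k → own-low (s , γ) (<?-on (s≤s (idx-last s γ))) (nS (s , γ) (j , k)) (==-on refl))
      (cong (λ x → if b then x else 0ℤ) (cong sp (low-done (nX (last s)) (==-on refl))))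

    quiet-low : ∀ x → x ≢ nW s → Stable z (inj₁ x)
    quiet-low (nS r c) ne = robust z _ r (own-low r refl) (nS r c) (==-on refl) refl
    quiet-low (nZ r k) ne = robust z _ r (own-low r refl) (nZ r k) (==-on refl) refl
    quiet-low (nE r)   ne = robust z _ r (own-low r refl) (nE r) (==-on refl) refl
    quiet-low (nX r)   ne = robust z _ r (own-low r refl) (nX r) (==-on refl) refl
    quiet-low (nG t k) ne = robust z _ (last t) (own-low (last t) refl) (nG t k) (==-on refl) refl
    quiet-low (nW t)   ne = quiet-W z s t t≢s (own-low (last t) (lt-suc {last s} (last t) λ e → t≢s (cong proj₁ e))) (h (nW t))
      where
      t≢s : t ≢ s
      t≢s refl = ne refl
    quiet-low (nA r k) ne with idx r ℕ.<? suc (idx (last s))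
    ... | yes r<n = stable-A-done z r k (own-low r (<?-on r<n))
    ... | no  r≮n = stable-A-todo z r k (own-low r (<?-off (ℕ.≮⇒≥ r≮n))) notFirst sum≤0
      where
      n≤r : idx (last s) ℕ.< idx r
      n≤r = ℕ.≮⇒≥ r≮n
      notFirst : isFirst r ≡ false
      notFirst with isFirst r in e
      ... | false = refl
      ... | true  = ⊥-elim (ℕ.n≮0 (subst (idx (last s) ℕ.<_) (isFirst-idx r e) n≤r))
      pW≤1 : pW p r ≤ 1ℤ
      pW≤1 = act≤1 (not (isTop (seg (prev r))) ∧ (last (seg (prev r)) == prev r)) (par r xor par (last (seg (prev r)))) (p (nW (seg (prev r))))
      sum≤0 : pX p r + pW p r ≤ 0ℤ
      sum≤0 with prev r ≟ last s
      ... | no ne′ = ℤ.+-mono-≤ {pX p r} { -1ℤ } {pW p r} {1ℤ} (ℤ.≤-reflexive (cong₂ (λ f b → act true (not f) b) notFirst prev-off)) pW≤1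
        where
        prev-off : p (nX (prev r)) ≡ false
        prev-off = own-low (prev r) (<?-off (ℕ.≤∧≢⇒< (ℕ.s≤s⁻¹ (subst (idx (last s) ℕ.<_) (idx-prev r notFirst) n≤r)) λ e → ne′ (idx-injective (sym e))))
                     (nX (prev r)) (==-on refl)
      -- X of the finished segment already releases the next unit; the pull -1 of the unflipped W
      -- alone holds it back.
      ... | yes e = ℤ.+-mono-≤ {pX p r} {1ℤ} {pW p r} { -1ℤ } (act≤1 true (not (isFirst r)) (p (nX (prev r)))) (ℤ.≤-reflexive pW≡-1)
        where
        notTop : isTop s ≡ false
        notTop = isTop-off λ e → ℕ.<⇒≱ n≤r (subst (λ s → idx r ℕ.≤ idx (last s)) (sym e) (idx-top r))
        pW≡-1 : pW p r ≡ -1ℤ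
        pW≡-1 = trans
          (cong₂ (λ a d → act a d (p (nW (seg (prev r)))))
            (cong₂ (λ a b → not a ∧ b) (trans (cong (isTop ∘ proj₁) e) notTop) (==-on (trans (cong (last ∘ proj₁) e) (sym e))))
            (trans (cong (λ t → par r xor par t) (trans (cong (last ∘ proj₁) e) (sym e))) (trans (par-prev r) (cong not notFirst))))
          (cong sp (trans (cong (p ∘ λ t → nW (proj₁ t)) e) low-W))

  -- Concatenating the stages

  top : Seg
  top = fromℕ g′

  Waiting : State → Set
  Waiting z = z (inj₁ (nW top)) ≡ false

  ≤-top : ∀ (s : Seg) → toℕ s ℕ.≤ toℕ top
  ≤-top s = ℕ.≤-trans (Fin.toℕ≤pred[n] s) (ℕ.≤-reflexive (sym (Fin.toℕ-fromℕ g′)))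

  top-waits : ∀ {n} (s : Seg) → pat n (toℕ s) (nW top) ≡ false
  top-waits s = <?-off (≤-top s)

  cast : ∀ {Φ Ω : State → Set} {k l} → k ≡ l → Run ext Waiting Φ Ω k → Run ext Waiting Φ Ω l
  cast refl r = r

  run-unit : ∀ q → Run ext Waiting (Stage (idx q) (toℕ (seg q)) (ps (seg q))) (Stage (suc (idx q)) (toℕ (seg q)) (ps (seg q))) 1
  run-unit q = trap (Trap q) (enter q) (λ z t → trans (Trap.fixed t (nW top) refl) (top-waits {idx q} (seg q)))
                    (λ z → progress) (λ z z′ → trap-step) (stop λ _ h → h)

  -- The invariant of `running`, an ending not yet flipped, is what keeps W stable. Hence the cells
  -- act as a constant external field during the whole wave below.
  run-lower : ∀ s → Run ext Waiting (low s ×ₛ λ y → ∀ v → y v ≡ ps s) (low s ×ₛ λ y → ∀ v → y v ≡ not (ps s)) M.T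
  run-lower s = Run-map (λ _ h → h) (λ z (h , _) → trans (h (nW top)) (top-waits {suc (idx (last s))} s)) (λ _ h → h)
    (lift (low s) pushed still (M.running (ps s)))
    where
    frozen : State
    frozen (inj₁ x) = low s x
    -- A filler value: the facts taken from `frozen` concern its cells only.
    frozen (inj₂ v) = false
    pushed : ∀ v → down (low s) v + 0ℤ ≡ sg (ps s) (runExt M.u (M.role v))
    pushed v = trans (ℤ.+-identityʳ _) (trans (down-graded (low s) s (low-graded {s} {frozen} λ _ → refl) v)
      (cong (sg (ps s)) (low-driven {s} {frozen} (λ _ → refl) (M.role v))))
    still : ∀ z → (low s ×ₛ λ y → y M.ending ≡ ps s) z → ∀ x → Stable z (inj₁ x)
    still z (h , e) x with x ≟W s
      where
      _≟W_ : ∀ x s → x ≡ nW s ⊎ x ≢ nW s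
      nA _ _ ≟W s = inj₂ λ ()
      nS _ _ ≟W s = inj₂ λ ()
      nZ _ _ ≟W s = inj₂ λ ()
      nE _   ≟W s = inj₂ λ ()
      nX _   ≟W s = inj₂ λ ()
      nG _ _ ≟W s = inj₂ λ ()
      nW t   ≟W s with t Fin.≟ s
      ... | yes refl = inj₁ refl
      ... | no ne    = inj₂ λ { refl → ne refl }
    ... | inj₁ refl = stable-W-waiting z s (low-behind {s} {z} h) e (low-W {s} {z} h)
    ... | inj₂ ne   = quiet-low {s} {z} h x ne

  -- Everything except W is stable, so nothing else moves. The machine below is left in
  -- `not (ps s)`, the rest state from which the next segment starts.
  run-W : ∀ s → Run ext Waiting (low s ×ₛ λ y → ∀ v → y v ≡ not (ps s)) (Stage (suc (idx (last s))) (suc (toℕ s)) (not (ps s))) 1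
  run-W s = trap (low s ×ₛ λ y → ∀ v → y v ≡ not (ps s)) (λ _ h → h)
    (λ z (h , _) → trans (h (nW top)) (top-waits {suc (idx (last s))} s))
    (λ z (h , l) → inj₁ (nW s) , unstable-W z s (low-done {s} {z} h) (low-behind {s} {z} h) (l M.ending) (low-W {s} {z} h))
    step (stop λ _ h → h)
    where
    step : ∀ z z′ → (low s ×ₛ λ y → ∀ v → y v ≡ not (ps s)) z → Step ext z z′ →
           (low s ×ₛ λ y → ∀ v → y v ≡ not (ps s)) z′ ⊎ Stage (suc (idx (last s))) (suc (toℕ s)) (not (ps s)) z′
    step z z′ (h , l) st = result (z′ (inj₁ (nW s))) refl
      where
      keep : ∀ x → x ≢ nW s → z′ (inj₁ x) ≡ low s x
      keep x ne = trans (kept st (inj₁ x) (quiet-low {s} {z} h x ne)) (h x)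
      keep-lower : ∀ v → z′ (inj₂ v) ≡ not (ps s)
      keep-lower v = trans (kept st (inj₂ v) (stable-after z s (low-graded {s} {z} h) (low-driven {s} {z} h) l v)) (l v)
      next-w : ∀ t → t ≢ s → does (toℕ t ℕ.<? suc (toℕ s)) ≡ does (toℕ t ℕ.<? toℕ s)
      next-w t ne with ℕ.<-cmp (toℕ t) (toℕ s)
      ... | tri< t<s _ _ = trans (<?-on (ℕ.m≤n⇒m≤1+n t<s)) (sym (<?-on t<s))
      ... | tri≈ _ e _   = ⊥-elim (ne (Fin.toℕ-injective e))
      ... | tri> _ _ s<t = trans (<?-off s<t) (sym (<?-off (ℕ.<⇒≤ s<t)))
      same : z′ (inj₁ (nW s)) ≡ false → ∀ x → z′ (inj₁ x) ≡ low s x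
      same f (nA r k) = keep (nA r k) λ ()
      same f (nS r c) = keep (nS r c) λ ()
      same f (nZ r k) = keep (nZ r k) λ ()
      same f (nE r)   = keep (nE r) λ ()
      same f (nX r)   = keep (nX r) λ ()
      same f (nG t k) = keep (nG t k) λ ()
      same f (nW t) with t Fin.≟ s
      ... | yes refl = trans f ((sym (<?-off (ℕ.≤-refl {toℕ s}))))
      ... | no ne    = keep (nW t) λ { refl → ne refl }
      flipped : z′ (inj₁ (nW s)) ≡ true → ∀ x → z′ (inj₁ x) ≡ pat (suc (idx (last s))) (suc (toℕ s)) x
      flipped f (nA r k) = keep (nA r k) λ ()
      flipped f (nS r c) = keep (nS r c) λ ()
      flipped f (nZ r k) = keep (nZ r k) λ ()
      flipped f (nE r)   = keep (nE r) λ ()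
      flipped f (nX r)   = keep (nX r) λ ()
      flipped f (nG t k) = keep (nG t k) λ ()
      flipped f (nW t) with t Fin.≟ s
      ... | yes refl = trans f ((sym (<?-on (ℕ.n<1+n (toℕ s)))))
      ... | no ne    = trans (keep (nW t) λ { refl → ne refl }) (sym (next-w t ne))
      result : ∀ b → z′ (inj₁ (nW s)) ≡ b → (low s ×ₛ λ y → ∀ v → y v ≡ not (ps s)) z′ ⊎ Stage (suc (idx (last s))) (suc (toℕ s)) (not (ps s)) z′
      result false f = inj₁ (same f , keep-lower)
      result true  f = inj₂ (flipped f , keep-lower)

  -- The first N′ units, the last unit, the wave below and the flip of W.
  stagesPerSegment : ℕ
  stagesPerSegment = N′ ℕ.+ (1 ℕ.+ (M.T ℕ.+ 1))

  run-units : ∀ s γ → Run ext Waiting (Stage (idx (s , zero)) (toℕ s) (ps s)) (Stage (idx (s , γ)) (toℕ s) (ps s)) (toℕ γ)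
  run-units s = Fin.<-weakInduction (λ γ → Run ext Waiting (Stage (idx (s , zero)) (toℕ s) (ps s)) (Stage (idx (s , γ)) (toℕ s) (ps s)) (toℕ γ))
    (stop λ _ h → h)
    λ γ r → cast (trans (cong (ℕ._+ 1) (Fin.toℕ-inject₁ γ)) (ℕ.+-comm _ 1))
      (r ++ Run-map (λ _ h → h) (λ _ h → h)
        (λ z → subst (λ n → Stage n (toℕ s) (ps s) z) (trans (cong (λ m → suc (toℕ s * suc N′ ℕ.+ m)) (Fin.toℕ-inject₁ γ)) (sym (ℕ.+-suc _ _))))
        (run-unit (s , inject₁ γ)))

  run-segment : ∀ s → Run ext Waiting (Stage (idx (s , zero)) (toℕ s) (ps s)) (Stage (suc (idx (last s))) (suc (toℕ s)) (not (ps s))) stagesPerSegment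
  run-segment s = cast (cong (ℕ._+ (1 ℕ.+ (M.T ℕ.+ 1))) (Fin.toℕ-fromℕ N′))
    (run-units s (fromℕ N′) ++ run-unit (last s) ++ run-lower s ++ run-W s)

  run-segments : ∀ s → Run ext Waiting (Stage 0 0 false) (Stage (idx (s , zero)) (toℕ s) (ps s)) (toℕ s * stagesPerSegment)
  run-segments = Fin.<-weakInduction (λ s → Run ext Waiting (Stage 0 0 false) (Stage (idx (s , zero)) (toℕ s) (ps s)) (toℕ s * stagesPerSegment))
    (stop λ _ h → h)
    λ s r → cast (trans (ℕ.+-comm _ stagesPerSegment) (cong (λ n → stagesPerSegment ℕ.+ n * stagesPerSegment) (Fin.toℕ-inject₁ s)))
      (r ++ Run-map (λ _ h → h) (λ _ h → h)
        (λ z → subst (λ (n , w , b) → Stage n w b z) (cong₂ _,_ (sym (idx-prev (suc s , zero) refl))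
           (cong₂ _,_ (cong suc (Fin.toℕ-inject₁ s)) (cong (not ∘ parity) (Fin.toℕ-inject₁ s)))))
        (run-segment (inject₁ s)))

  -- Since the number of segments is odd, the machine below is reversed an odd number of times and
  -- ends at `true` together with the cells.
  run′ : Run ext Waiting (λ z → ∀ v → z v ≡ false) (λ z → ∀ v → z v ≡ true) (suc g′ * stagesPerSegment)
  run′ = subst (Run ext Waiting _ _)
    (trans (ℕ.+-comm _ stagesPerSegment) (cong (λ n → stagesPerSegment ℕ.+ n * stagesPerSegment) (Fin.toℕ-fromℕ g′)))
    (Run-map (λ z h → (λ x → trans (h (inj₁ x)) (sym (start x))) , λ v → h (inj₂ v)) (λ _ h → h) (λ _ h → h) (run-segments top)
      ++ Run-map (λ _ h → h) (λ _ h → h) finish (run-segment top))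
    where
    start : ∀ x → pat 0 0 x ≡ false
    start (nA q _) = <?-off {idx q} z≤n
    start (nS q _) = <?-off {idx q} z≤n
    start (nZ q _) = <?-off {idx q} z≤n
    start (nE q)   = <?-off {idx q} z≤n
    start (nX q)   = <?-off {idx q} z≤n
    start (nG s _) = <?-off {idx (last s)} z≤n
    start (nW s)   = <?-off {toℕ s} z≤n
    end-all : ∀ x → pat (suc (idx (last top))) (suc (toℕ top)) x ≡ true
    end-all (nA q _) = <?-on (s≤s (idx-top q))
    end-all (nS q _) = <?-on (s≤s (idx-top q))
    end-all (nZ q _) = <?-on (s≤s (idx-top q))
    end-all (nE q)   = <?-on (s≤s (idx-top q))
    end-all (nX q)   = <?-on (s≤s (idx-top q))
    end-all (nG s _) = <?-on (s≤s (idx-top (last s)))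
    end-all (nW s)   = <?-on (s≤s (≤-top s))
    finish : ∀ z → Stage (suc (idx (last top))) (suc (toℕ top)) (not (ps top)) z → ∀ v → z v ≡ true
    finish z (h , l) (inj₁ x) = trans (h x) (end-all x)
    finish z (h , l) (inj₂ v) = trans (l v) (cong not (trans (cong parity (Fin.toℕ-fromℕ g′)) even-g′))

-- A level as a machine for the next level

module NextMachine (g′ N′ : ℕ) (o : Bool) (even-g′ : parity g′ ≡ false) (even-N′ : parity N′ ≡ false) (N′≢0 : N′ ≢ 0)
                   (ρ : ℕ) (M : Machine (suc N′) ρ o) (light : Machine.D M ℕ.+ 5 ℕ.≤ ρ * Machine.u M)
                   {N₂ ρ₂ : ℕ} (slot : Fin (suc g′) × Fin (suc N′) → Fin N₂ × Fin ρ₂)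
                   (slot-colour : ∀ q → Units.par g′ N′ o even-g′ even-N′ N′≢0 q ≡ not o xor parity (toℕ (proj₁ (slot q))))
                   (slot-injective : ∀ s γ δ → slot (s , γ) ≡ slot (s , δ) → γ ≡ δ) where

  private module M = Machine M

  open Dynamics g′ N′ o even-g′ even-N′ N′≢0 ρ M light slot public

  private
    on : State
    on _ = true

    ps-top : ps top ≡ false
    ps-top = trans (cong parity (Fin.toℕ-fromℕ g′)) even-g′

    adj-sym : ∀ i j → joinAdj i j ≡ joinAdj j i
    adj-sym (inj₁ x) (inj₁ y) = ∨-comm (arrow x y) (arrow y x)
    adj-sym (inj₁ x) (inj₂ v) = refl
    adj-sym (inj₂ v) (inj₁ x) = refl
    adj-sym (inj₂ v) (inj₂ w) = M.adj-sym v w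

    adj-irr : ∀ i → joinAdj i i ≡ false
    adj-irr (inj₁ x) = chain-irr x
    adj-irr (inj₂ v) = M.adj-irr v

    roleW≢dem : ∀ {b γ j h} {A : Set} → roleW b ≡ dem γ j h → A
    roleW≢dem {true}  ()
    roleW≢dem {false} ()

    roleW-end : ∀ {b} → roleW b ≡ end → b ≡ true
    roleW-end {true} e = refl

    colour-dem : ∀ {v γ j h} → role′ v ≡ dem γ j h → joinColour v ≡ not o xor parity (toℕ γ)
    colour-dem {inj₁ (nA q k)} refl = slot-colour q
    colour-dem {inj₁ (nW s)}   e    = roleW≢dem e

    o≡ : o xor false ≡ not (not o)
    o≡ = lemma o
      where lemma : ∀ b → b xor false ≡ not (not b)
            lemma true  = refl
            lemma false = refl

    colour-head : ∀ {v γ j} → role′ v ≡ dem γ j true → joinColour v ≡ not (not o)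
    colour-head {inj₁ (nA (zero , zero) k)} e = o≡
    colour-head {inj₁ (nA (zero , suc _) k)} ()
    colour-head {inj₁ (nA (suc _ , _) k)} ()
    colour-head {inj₁ (nW s)}     e = roleW≢dem e

    colour-end : ∀ {v} → role′ v ≡ end → joinColour v ≡ not (not o)
    colour-end {inj₁ (nW s)} e = trans
      (cong₂ (λ a b → o xor (a xor b)) (trans (cong ps (isTop-true (roleW-end e))) ps-top) (trans (cong parity (Fin.toℕ-fromℕ N′)) even-N′)) o≡

    ending-unique : ∀ {v} → role′ v ≡ end → v ≡ inj₁ (nW top)
    ending-unique {inj₁ (nW s)} e = cong (λ s → inj₁ (nW s)) (isTop-true (roleW-end e))

    count : (f : Role N₂ ρ₂ → ℤ) → f plain ≡ 0ℤ → f end ≡ 0ℤ →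
            sum (Sys.finite join) (f ∘ role′) ≡ ∑ (λ s → ∑ λ γ → ∑ {σ} λ k → f (roleₓ (nA (s , γ) k)))
    count f p e = trans
      (cong₂ _+_ (cong (λ t → here + t) (cong₂ _+_ (sum-zero (units ⊠ slots) λ _ → p) (cong₂ _+_ (sum-zero (units ⊠ fin 3) λ _ → p)
        (cong₂ _+_ (sum-zero units λ _ → p) (cong₂ _+_ (sum-zero units λ _ → p) (cong₂ _+_ (sum-zero (segs ⊠ fin M.η) λ _ → p)
          (sum-zero segs λ s → at-W (isTop s))))))))
        (sum-zero M.finite λ _ → p))
      (lemma here)
      where
      here : ℤ
      here = ∑ (λ s → ∑ λ γ → ∑ {σ} λ k → f (roleₓ (nA (s , γ) k)))
      at-W : ∀ b → f (roleW b) ≡ 0ℤ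
      at-W true  = e
      at-W false = p
      lemma : ∀ a → (a + (0ℤ + (0ℤ + (0ℤ + (0ℤ + (0ℤ + 0ℤ)))))) + 0ℤ ≡ a
      lemma = solve-∀

    ∑-bounded : ∀ n (f : Fin n → ℤ) {c} → (∀ i → f i ≤ + c) → ∑ f ≤ + (n * c)
    ∑-bounded zero    f h = ℤ.≤-refl
    ∑-bounded (suc n) f h = ℤ.+-mono-≤ (h zero) (∑-bounded n (f ∘ suc) (h ∘ suc))

    -- In each of the g segments `slot-injective` leaves at most one unit for the slot, and a unit
    -- has σ nodes A.
    load : ∀ γ j → sum (Sys.finite join) (λ v → ind (inSlot γ j (role′ v))) ≤ + (suc g′ * σ)
    load γ j = ℤ.≤-trans (ℤ.≤-reflexive (count (ind ∘ inSlot γ j) refl refl))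
      (∑-bounded (suc g′) (λ s → ∑ λ δ → ∑ {σ} λ k → g s δ) λ s →
        ∑-at-most-one (λ δ → ∑ {σ} λ k → g s δ) (unique s) (λ δ → bound (test s δ)) (nonneg σ))
      where
      test : Seg → Fin (suc N′) → Bool
      test s δ = does (γ Fin.≟ proj₁ (slot (s , δ))) ∧ does (j Fin.≟ proj₂ (slot (s , δ)))
      g : Seg → Fin (suc N′) → ℤ
      g s δ = ind (test s δ)
      bound : ∀ b → ∑ {σ} (λ _ → ind b) ≤ + σ
      bound true  = ℤ.≤-reflexive (∑-const σ)
      bound false = ℤ.≤-trans (ℤ.≤-reflexive (∑-zero {σ} λ _ → refl)) (nonneg σ)
      found : ∀ s δ → ∑ {σ} (λ _ → g s δ) ≢ 0ℤ → slot (s , δ) ≡ (γ , j)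
      found s δ ne with γ Fin.≟ proj₁ (slot (s , δ)) | j Fin.≟ proj₂ (slot (s , δ))
      ... | yes p | yes q = sym (cong₂ _,_ p q)
      ... | yes _ | no _  = ⊥-elim (ne (∑-zero {σ} λ _ → refl))
      ... | no _  | _     = ⊥-elim (ne (∑-zero {σ} λ _ → refl))
      unique : ∀ s δ ε → ∑ {σ} (λ _ → g s δ) ≢ 0ℤ → ∑ {σ} (λ _ → g s ε) ≢ 0ℤ → δ ≡ ε
      unique s δ ε p q = slot-injective s δ ε (trans (found s δ p) (sym (found s ε q)))

    heads : sum (Sys.finite join) (λ v → ind (isHead (role′ v))) ≡ + σ
    heads = trans (count (ind ∘ isHead) refl refl) (trans
      (∑-pick zero (λ s → ∑ λ γ → ∑ {σ} λ k → ind (isFirst (s , γ))) λ { zero ne → ⊥-elim (ne refl) ; (suc s) ne → ∑-zero {suc N′} λ γ → ∑-zero {σ} λ _ → refl })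
      (trans (∑-pick zero (λ γ → ∑ {σ} λ k → ind (isFirst (zero , γ))) λ { zero ne → ⊥-elim (ne refl) ; (suc γ) ne → ∑-zero {σ} λ _ → refl })
        (∑-const σ)))

    own-on : ∀ q → Own true q (cells on)
    own-on q x e = refl

    field-A≡ : ∀ q k → field′ on (inj₁ (nA q k)) ≡ σS (cells on) q + 1ℤ + pX (cells on) q + pW (cells on) q
    field-A≡ q k = cancel {field′ on (inj₁ (nA q k))} (+ suc σ + ind (isFirst q)) (total-A on q k)
      where
      undo : ∀ a c → a ≡ (a + c) - c
      undo = solve-∀
      cancel : ∀ {a b} c → a + c ≡ b + c → a ≡ b
      cancel {a} {b} c e = trans (undo a c) (trans (cong (_- c) e) (sym (undo b c)))

    inner : ∀ q x → inUnit q x ≡ true → isA x ≡ false → 0ℤ ≤ field′ on (inj₁ x)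
    inner q x e f = subst (0ℤ ≤_) (trans (cong (λ t → field′ on (inj₁ x) + t) (ext-inner q x e f)) (ℤ.+-identityʳ _)) (robust⁺ on q (own-on q) x e f)

    -- The critical nodes are the heads. In the final state the repulsive link contributes -1 and no
    -- W is coupled to them, so their field is exactly σ, the demand σ + 1 less the trigger.
    hold : ∀ v → cap (suc σ) (role′ v) ≤ field′ on v
    hold (inj₁ (nS q c)) = inner q (nS q c) (==-on refl) refl
    hold (inj₁ (nZ q k)) = inner q (nZ q k) (==-on refl) refl
    hold (inj₁ (nE q))   = inner q (nE q) (==-on refl) refl
    hold (inj₁ (nX q))   = inner q (nX q) (==-on refl) refl
    hold (inj₁ (nG s k)) = inner (last s) (nG s k) (==-on refl) refl
    hold (inj₁ (nA q k)) = subst (+ suc σ - ind (isFirst q) ≤_) (sym (field-A≡ q k)) (by _ refl)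
      where
      p = cells on
      lemma₁ : ∀ a x w s → (a + 1ℤ + x + w) - ((1ℤ + s) - 1ℤ) ≡ (a - s) + ((x - -1ℤ) + (w - 0ℤ))
      lemma₁ = solve-∀
      lemma₂ : ∀ a x w s → (a + 1ℤ + x + w) - ((1ℤ + s) - 0ℤ) ≡ (a - s) + ((x - 1ℤ) + (w - -1ℤ))
      lemma₂ = solve-∀
      by : ∀ b → isFirst q ≡ b → + suc σ - ind (isFirst q) ≤ σS p q + 1ℤ + pX p q + pW p q
      by true e = ≤-by (≥-of (own-S p (own-on q)) ⊕ ≥-of (cong (λ f → act true (not f) true) e) ⊕ ≥-of noW)
        (trans (cong (λ f → (σS p q + 1ℤ + pX p q + pW p q) - (+ suc σ - ind f)) e) (lemma₁ (σS p q) (pX p q) (pW p q) (+ σ)))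
        where
        noW : pW p q ≡ 0ℤ
        noW = cong (λ a → act (not a ∧ (last (seg (prev q)) == prev q)) (par q xor par (last (seg (prev q)))) true)
                   (isTop-on (cong proj₁ (prev-first q e)))
      by false e = ≤-by (≥-of (own-S p (own-on q)) ⊕ ≥-of (cong (λ f → act true (not f) true) e)
          ⊕ gap (-1≤act (not (isTop (seg (prev q))) ∧ (last (seg (prev q)) == prev q)) (par q xor par (last (seg (prev q)))) true))
        (trans (cong (λ f → (σS p q + 1ℤ + pX p q + pW p q) - (+ suc σ - ind f)) e) (lemma₂ (σS p q) (pX p q) (pW p q) (+ σ)))
    hold (inj₁ (nW s)) = by _ refl
      where
      p = cells on
      lemma : ∀ a b l → (a + b + 1ℤ) + l - 1ℤ ≡ (a - 0ℤ) + ((b - 0ℤ) + (l - 0ℤ))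
      lemma = solve-∀
      by : ∀ b → isTop s ≡ b → cap (suc σ) (roleW (isTop s)) ≤ field′ on (inj₁ (nW s))
      by false e = subst (λ b → cap (suc σ) (roleW b) ≤ field′ on (inj₁ (nW s))) (sym e)
        (subst (0ℤ ≤_) (trans (cong (λ b → field′ on (inj₁ (nW s)) + runExt (suc σ) (roleW b)) e) (ℤ.+-identityʳ _)) (0≤total-W on s e (own-on (last s))))
      by true e = subst (λ b → cap (suc σ) (roleW b) ≤ field′ on (inj₁ (nW s))) (sym e)
        (≤-by (≥-of (wA-on {p} e) ⊕ ≥-of (wS-on {p} e) ⊕ ≥-of′ up≥0)
          (trans (cong (λ t → t + up (nW s) (lower on) - 1ℤ) (field-W p s)) (lemma (wA p s) (wS′ p s) (up (nW s) (lower on)))))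
        where
        ≥-of′ : ∀ {a} → 0ℤ ≤ a → 0ℤ ≤ a - 0ℤ
        ≥-of′ {a} h = subst (0ℤ ≤_) (sym (ℤ.+-identityʳ a)) h
        up≥0 : 0ℤ ≤ up (nW s) (lower on)
        up≥0 = subst (0ℤ ≤_) (sym (trans (upW s (lower on)) (cong (λ b → sg b 1ℤ) (trans (cong ps (isTop-true e)) ps-top)))) (nonneg 1)
    hold (inj₂ v) = subst (λ t → 0ℤ ≤ t + M.field′ (λ _ → true) v)
      (sym (trans (down-graded (cells on) top all-on v) (cong (λ b → sg b (driven (cells on) top (M.role v))) ps-top)))
      (ℤ.≤-trans (positive (M.role v)) (ℤ.+-monoʳ-≤ (driven (cells on) top (M.role v)) (M.hold v)))
      where
      all-on : Graded (cells on) top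
      all-on = (λ t _ → (λ _ _ → refl) , refl , refl) , λ t top<t → ⊥-elim (ℕ.<⇒≱ top<t (≤-top t))
      positive : ∀ r → 0ℤ ≤ driven (cells on) top r + cap M.u r
      positive plain       = ℤ.≤-refl
      positive end         = nonneg 2
      positive (dem γ j h) = subst (0ℤ ≤_)
        (trans (lemma (+ M.u) (ind h)) (cong (λ t → (t + ind h) + (+ M.u - ind h)) (sym (∑-const M.u)))) (nonneg M.u ⊕ nonneg M.u)
        where lemma : ∀ u h → u + u ≡ (u + h) + (u - h)
              lemma = solve-∀

  -- The demand σ + 1 is the weight with which S and E of the own unit oppose a node A; the heads
  -- are the σ nodes A of the first unit of the ring.
  machine : Machine N₂ ρ₂ (not o)
  machine = record
    { sys = join ; u = suc σ ; D = suc g′ * σ ; η = σ ; T = suc g′ * stagesPerSegment ; role = role′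
    ; adj-sym = adj-sym ; adj-irr = adj-irr
    ; colour-dem = λ {v} → colour-dem {v} ; colour-head = λ {v} → colour-head {v} ; colour-end = λ {v} → colour-end {v}
    ; ending = inj₁ (nW top) ; role-ending = cong roleW (isTop-on refl) ; ending-unique = λ {v} → ending-unique {v}
    ; load = load ; heads = heads ; η≤D = ℕ.m≤m+n σ (g′ * σ) ; 1≤u = s≤s z≤n ; hold = hold ; run = run′ }

-- From spin systems to graphs and colourings

module Realise (S : Sys) (adj-sym : ∀ i j → Sys.adj S i j ≡ Sys.adj S j i) (adj-irr : ∀ i → Sys.adj S i i ≡ false) where

  open Sys S

  private
    F = finite
    n = size finite

  graph : SimpleGraph n
  graph = record { Adj = λ i j → adj (to F i) (to F j) ; sym = λ i j → adj-sym _ _ ; irrefl = λ i → adj-irr _ }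

  state : Coloring n → State
  state y v = y (from F v) xor colour v

  colouring : State → Coloring n
  colouring z i = z (to F i) xor colour (to F i)

  state-colouring : ∀ z v → state (colouring z) v ≡ z v
  state-colouring z v rewrite to-from F v = lemma (z v) (colour v)
    where
    lemma : ∀ a b → (a xor b) xor b ≡ a
    lemma true  true  = refl
    lemma true  false = refl
    lemma false true  = refl
    lemma false false = refl

  private
    none : Ext
    none _ = 0ℤ

    length-filter : ∀ {A : Set} {n} (t : A → Bool) (f : Fin n → A) → + length (filterᵇ t (tabulate f)) ≡ ∑ (ind ∘ t ∘ f)
    length-filter {n = zero}  t f = refl
    length-filter {n = suc n} t f with t (f zero)
    ... | true  = cong (λ s → 1ℤ + s) (length-filter t (f ∘ suc))
    ... | false = trans (length-filter t (f ∘ suc)) (sym (ℤ.+-identityˡ _))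

    difference : ∀ a c d b → act a (c xor d) (b xor d) ≡ ind (a ∧ not (b xor c)) + - ind (a ∧ not (b xor not c))
    difference false c     d     b     = refl
    difference true  true  true  true  = refl
    difference true  true  true  false = refl
    difference true  true  false true  = refl
    difference true  true  false false = refl
    difference true  false true  true  = refl
    difference true  false true  false = refl
    difference true  false false true  = refl
    difference true  false false false = refl

    -- A neighbour pulls by +1 if its actual colour is the frame colour c of the node and by -1
    -- otherwise, so the field compares the two colour counts.
    field-count : ∀ y i → let c = colour (to F i) in
                  field′ (state y) (to F i) ≡ + Defs.nbrCount graph y i c + - + Defs.nbrCount graph y i (not c)
    field-count y i = trans (sum-∑ F _) (trans
      (∑-cong λ u → trans (cong (λ k → act (adj v (to F u)) (c xor colour (to F u)) (y k xor colour (to F u))) (from-to F u))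
                          (difference (adj v (to F u)) c (colour (to F u)) (y u)))
      (trans (∑-+ (λ u → ind (near c u)) (λ u → - ind (near (not c) u))) (cong₂ _+_ (sym (length-filter (near c) id))
        (trans (∑-neg (ind ∘ near (not c))) (cong -_ (sym (length-filter (near (not c)) id)))))))
      where
      v = to F i
      c = colour v
      near : Bool → Fin n → Bool
      near c u = adj v (to F u) ∧ not (y u xor c)

    pos : ∀ {k l} → k ℕ.< l → 0ℤ < (+ l + - + k) + 0ℤ
    pos {k} {l} p = <-by (gap< (+<+ p)) (lemma (+ k) (+ l))
      where lemma : ∀ k l → ((l + - k) + 0ℤ) - (1ℤ + 0ℤ) ≡ l - (1ℤ + k)
            lemma = solve-∀

    minus : ∀ {k l} → k ℕ.< l → (+ k + - + l) + 0ℤ < 0ℤ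
    minus {k} {l} p = <-by (gap< (+<+ p)) (lemma (+ k) (+ l))
      where lemma : ∀ k l → 0ℤ - (1ℤ + ((k + - l) + 0ℤ)) ≡ l - (1ℤ + k)
            lemma = solve-∀

    pos⁻ : ∀ {k l} → 0ℤ < (+ l + - + k) + 0ℤ → k ℕ.< l
    pos⁻ {k} {l} p = ℤ.drop‿+<+ (<-by (gap< p) (lemma (+ k) (+ l)))
      where lemma : ∀ k l → l - (1ℤ + k) ≡ ((l + - k) + 0ℤ) - (1ℤ + 0ℤ)
            lemma = solve-∀

    minus⁻ : ∀ {k l} → (+ k + - + l) + 0ℤ < 0ℤ → k ℕ.< l
    minus⁻ {k} {l} p = ℤ.drop‿+<+ (<-by (gap< p) (lemma (+ k) (+ l)))
      where lemma : ∀ k l → l - (1ℤ + k) ≡ 0ℤ - (1ℤ + ((k + - l) + 0ℤ))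
            lemma = solve-∀

    bad : ∀ b c (N : Bool → ℕ) → N (not b) ℕ.< N b → Bad (b xor c) ((+ N c + - + N (not c)) + 0ℤ)
    bad true  true  N = pos
    bad true  false N = minus
    bad false true  N = minus
    bad false false N = pos

    bad⁻ : ∀ b c (N : Bool → ℕ) → Bad (b xor c) ((+ N c + - + N (not c)) + 0ℤ) → N (not b) ℕ.< N b
    bad⁻ true  true  N = pos⁻
    bad⁻ true  false N = minus⁻
    bad⁻ false true  N = minus⁻
    bad⁻ false false N = pos⁻

    state-to : ∀ y i → state y (to F i) ≡ y i xor colour (to F i)
    state-to y i = cong (λ k → y k xor colour (to F i)) (from-to F i)

    unstable : ∀ y i → Defs.Switchable graph y i → Unstable none (state y) (to F i)
    unstable y i h = subst₂ (λ b f → Bad b (f + 0ℤ)) (sym (state-to y i)) (sym (field-count y i))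
      (bad (y i) (colour (to F i)) (Defs.nbrCount graph y i) h)

    switchable : ∀ y i → Unstable none (state y) (to F i) → Defs.Switchable graph y i
    switchable y i h = bad⁻ (y i) (colour (to F i)) (Defs.nbrCount graph y i)
      (subst₂ (λ b f → Bad b (f + 0ℤ)) (state-to y i) (field-count y i) h)

    valid-step : ∀ y S → Defs.ValidStep graph y S → Step none (state y) (state (Defs.switch graph S y))
    valid-step y S valid v ne = by _ refl
      where
      by : ∀ b → S (from F v) ≡ b → Unstable none (state y) v
      by true  e = subst (Unstable none (state y)) (to-from F v) (unstable y (from F v) (valid (from F v) e))
      by false e = ⊥-elim (ne (cong (λ b → (if b then not (y (from F v)) else y (from F v)) xor colour v) e))

  module _ (M : Defs.Model graph) (valid : ∀ y S → M y S → Defs.ValidStep graph y S) where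

    -- A step leaves at most one trap, and no stable colouring lies in a trap. Steps inside a trap,
    -- such as empty ones, only increase k.
    run-bound : ∀ {Θ Φ Ω T} → Run none Θ Φ Ω T → ∀ y k → Φ (state y) → Defs.ReachesStable graph M y k → T ℕ.≤ k
    run-bound (stop _) y k φ r = z≤n
    run-bound {Φ = Φ} {T = suc T} (trap {Φ′ = Φ′} Ψ enter _ progress step rest) y k φ r = stay y k (enter _ φ) r
      where
      stay : ∀ y k → Ψ (state y) → Defs.ReachesStable graph M y k → suc T ℕ.≤ k
      stay y .0 ψ (Defs.done stable) = let v , u = progress (state y) ψ in
        ⊥-elim (stable (from F v) (switchable y (from F v) (subst (Unstable none (state y)) (sym (to-from F v)) u)))
      stay y (suc k) ψ (Defs.step S m r) = by (step _ _ ψ (valid-step y S (valid y S m)))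
        where
        by : Ψ (state (Defs.switch graph S y)) ⊎ Φ′ (state (Defs.switch graph S y)) → suc T ℕ.≤ suc k
        by (inj₁ ψ′) = ℕ.m≤n⇒m≤1+n (stay _ k ψ′ r)
        by (inj₂ φ′) = s≤s (run-bound rest _ k φ′ r)

  lower-bound : ∀ {Θ Φ Ω T} → Run none Θ Φ Ω T → ∀ y → Φ (state y) → ∀ {B : ℕ → Set} → (∀ k → T ℕ.≤ k → B k) → LowerBoundAllModels graph y B
  lower-bound run y φ {B} b = at sequential , at (λ _ _ → proj₁) , at (λ _ _ → proj₁) , at (λ _ _ m i → proj₁ (m i)) , at sequential , at (λ _ _ m → m)
    where
    at : ∀ {M : Defs.Model graph} → (∀ y S → M y S → Defs.ValidStep graph y S) → Defs.StabTimeAtLeast graph M y B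
    at valid k r = b k (run-bound _ valid run y k φ r)
    sequential : ∀ y S → Defs.SingleSwitch graph y S → Defs.ValidStep graph y S
    sequential y S (v , sw , only , _) u e = subst (Defs.Switchable graph y) (sym (only u e)) sw

-- The bottom machine: a row of five nodes

module Base {N ρ : ℕ} (o : Bool) (γ₁ : Fin N) (odd-γ₁ : parity (toℕ γ₁) ≡ true) (j₁ : Fin ρ) where

  Row : Set
  Row = Fin 2 ⊎ Fin 2 ⊎ ⊤

  pattern h₀ = inj₁ zero
  pattern h₁ = inj₁ (suc zero)
  pattern m₀ = inj₂ (inj₁ zero)
  pattern m₁ = inj₂ (inj₁ (suc zero))
  pattern e₀ = inj₂ (inj₂ tt)

  rowAdj : Row → Row → Bool
  rowAdj (inj₁ _)        (inj₂ (inj₁ _)) = true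
  rowAdj (inj₂ (inj₁ _)) (inj₁ _)        = true
  rowAdj (inj₂ (inj₁ _)) (inj₂ (inj₂ _)) = true
  rowAdj (inj₂ (inj₂ _)) (inj₂ (inj₁ _)) = true
  rowAdj _               _               = false

  rowColour : Row → Bool
  rowColour (inj₂ (inj₁ _)) = o
  rowColour _               = not o

  row : Sys
  row = record { Node = Row ; finite = fin 2 ⊞ fin 2 ⊞ unit ; adj = rowAdj ; colour = rowColour }

  open Sys row

  -- Both h are heads, so the colour prescribed for demanding nodes must agree with that of heads;
  -- this asks for an odd γ₁.
  rowRole : Row → Role N ρ
  rowRole (inj₁ _)        = dem γ₁ j₁ true
  rowRole (inj₂ (inj₁ _)) = plain
  rowRole (inj₂ (inj₂ _)) = end

  private
    ext : Ext
    ext = runExt 2 ∘ rowRole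

    total : State → Node → ℤ
    total z i = field′ z i + ext i

    pull≡ : ∀ b → act true (not o xor o) b ≡ sp b
    pull≡ b = cong (λ d → act true d b) (trans (xor-sym (not o) o) (xor-not o))

    pull≡′ : ∀ b → act true (o xor not o) b ≡ sp b
    pull≡′ b = cong (λ d → act true d b) (xor-not o)

    field-h : ∀ z k → field′ z (inj₁ k) ≡ sp (z m₀) + sp (z m₁)
    field-h z k rewrite pull≡ (z m₀) | pull≡ (z m₁) = lemma (sp (z m₀)) (sp (z m₁))
      where lemma : ∀ a b → (0ℤ + (0ℤ + 0ℤ)) + ((a + (b + 0ℤ)) + 0ℤ) ≡ a + b
            lemma = solve-∀

    field-m : ∀ z k → field′ z (inj₂ (inj₁ k)) ≡ sp (z h₀) + sp (z h₁) + sp (z e₀)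
    field-m z k rewrite pull≡′ (z h₀) | pull≡′ (z h₁) | pull≡′ (z e₀) = lemma (sp (z h₀)) (sp (z h₁)) (sp (z e₀))
      where lemma : ∀ a b c → (a + (b + 0ℤ)) + ((0ℤ + (0ℤ + 0ℤ)) + c) ≡ a + b + c
            lemma = solve-∀

    field-e : ∀ z → field′ z e₀ ≡ sp (z m₀) + sp (z m₁)
    field-e z rewrite pull≡ (z m₀) | pull≡ (z m₁) = lemma (sp (z m₀)) (sp (z m₁))
      where lemma : ∀ a b → (0ℤ + (0ℤ + 0ℤ)) + ((a + (b + 0ℤ)) + 0ℤ) ≡ a + b
            lemma = solve-∀

    at-h : ∀ {z a b} k → z m₀ ≡ a → z m₁ ≡ b → total z (inj₁ k) ≡ sp a + sp b + + 3
    at-h {z} k refl refl = cong (λ t → t + + 3) (field-h z k)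

    at-m : ∀ {z a b c} k → z h₀ ≡ a → z h₁ ≡ b → z e₀ ≡ c → total z (inj₂ (inj₁ k)) ≡ sp a + sp b + sp c + 0ℤ
    at-m {z} k refl refl refl = cong (λ t → t + 0ℤ) (field-m z k)

    at-e : ∀ {z a b} → z m₀ ≡ a → z m₁ ≡ b → total z e₀ ≡ sp a + sp b + -1ℤ
    at-e {z} refl refl = cong (λ t → t + -1ℤ) (field-e z)

    stay⁻ : ∀ {z z′ i t} → Step ext z z′ → z i ≡ false → total z i ≡ t → t ≤ 0ℤ → z′ i ≡ false
    stay⁻ {z} {z′} {i} s e refl p = trans (kept s i (good⁻ e p)) e

    stay⁺ : ∀ {z z′ i t} → Step ext z z′ → z i ≡ true → total z i ≡ t → 0ℤ ≤ t → z′ i ≡ true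
    stay⁺ {z} {z′} {i} s e refl p = trans (kept s i (good⁺ e p)) e

    up! : ∀ {z i t} → z i ≡ false → total z i ≡ t → 0ℤ < t → ∃ (Unstable ext z)
    up! {z} {i} e refl p = i , subst (λ b → Bad b (total z i)) (sym e) p

    -- The pair h is free in `Ψ₁`, the pair m in `Ψ₂`. The first stage ends after both h have
    -- flipped, the second when the ending flips.
    Ψ₁ Ψ₂ : State → Set
    Ψ₁ z = z m₀ ≡ false × z m₁ ≡ false × z e₀ ≡ false
    Ψ₂ z = z h₀ ≡ true × z h₁ ≡ true × z e₀ ≡ false

    progress₁ : ∀ z → Ψ₁ z → ∀ a b → z h₀ ≡ a → z h₁ ≡ b → ∃ (Unstable ext z)
    progress₁ z (m , m′ , e) false b     p q = up! p (at-h {z} zero m m′) (+<+ (s≤s z≤n))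
    progress₁ z (m , m′ , e) true  false p q = up! q (at-h {z} (suc zero) m m′) (+<+ (s≤s z≤n))
    progress₁ z (m , m′ , e) true  true  p q = up! m (at-m {z} zero p q e) (+<+ (s≤s z≤n))

    step₁ : ∀ z z′ → Ψ₁ z → Step ext z z′ → ∀ a b → z h₀ ≡ a → z h₁ ≡ b → Ψ₁ z′ ⊎ Ψ₂ z′
    step₁ z z′ (m , m′ , e) s false false p q = inj₁ (stay⁻ s m (at-m {z} zero p q e) -≤+ , stay⁻ s m′ (at-m {z} (suc zero) p q e) -≤+ , stay⁻ s e (at-e {z} m m′) -≤+)
    step₁ z z′ (m , m′ , e) s false true  p q = inj₁ (stay⁻ s m (at-m {z} zero p q e) -≤+ , stay⁻ s m′ (at-m {z} (suc zero) p q e) -≤+ , stay⁻ s e (at-e {z} m m′) -≤+)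
    step₁ z z′ (m , m′ , e) s true  false p q = inj₁ (stay⁻ s m (at-m {z} zero p q e) -≤+ , stay⁻ s m′ (at-m {z} (suc zero) p q e) -≤+ , stay⁻ s e (at-e {z} m m′) -≤+)
    step₁ z z′ (m , m′ , e) s true  true  p q = inj₂ (stay⁺ s p (at-h {z} zero m m′) (nonneg 1) , stay⁺ s q (at-h {z} (suc zero) m m′) (nonneg 1) , stay⁻ s e (at-e {z} m m′) -≤+)

    progress₂ : ∀ z → Ψ₂ z → ∀ a b → z m₀ ≡ a → z m₁ ≡ b → ∃ (Unstable ext z)
    progress₂ z (h , h′ , e) false b     p q = up! p (at-m {z} zero h h′ e) (+<+ (s≤s z≤n))
    progress₂ z (h , h′ , e) true  false p q = up! q (at-m {z} (suc zero) h h′ e) (+<+ (s≤s z≤n))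
    progress₂ z (h , h′ , e) true  true  p q = up! e (at-e {z} p q) (+<+ (s≤s z≤n))

    All : State → Set
    All z = ∀ v → z v ≡ true

    step₂ : ∀ z z′ → Ψ₂ z → Step ext z z′ → ∀ a b → z m₀ ≡ a → z m₁ ≡ b → Ψ₂ z′ ⊎ All z′
    step₂ z z′ (h , h′ , e) s false false p q = inj₁ (stay⁺ s h (at-h {z} zero p q) (nonneg 1) , stay⁺ s h′ (at-h {z} (suc zero) p q) (nonneg 1) , stay⁻ s e (at-e {z} p q) -≤+)
    step₂ z z′ (h , h′ , e) s false true  p q = inj₁ (stay⁺ s h (at-h {z} zero p q) (nonneg 3) , stay⁺ s h′ (at-h {z} (suc zero) p q) (nonneg 3) , stay⁻ s e (at-e {z} p q) -≤+)
    step₂ z z′ (h , h′ , e) s true  false p q = inj₁ (stay⁺ s h (at-h {z} zero p q) (nonneg 3) , stay⁺ s h′ (at-h {z} (suc zero) p q) (nonneg 3) , stay⁻ s e (at-e {z} p q) -≤+)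
    step₂ z z′ (h , h′ , e) s true  true  p q = by _ refl
      where
      by : ∀ c → z′ e₀ ≡ c → Ψ₂ z′ ⊎ All z′
      by false f = inj₁ (stay⁺ s h (at-h {z} zero p q) (nonneg 5) , stay⁺ s h′ (at-h {z} (suc zero) p q) (nonneg 5) , f)
      by true  t = inj₂ λ { h₀ → stay⁺ s h (at-h {z} zero p q) (nonneg 5) ; h₁ → stay⁺ s h′ (at-h {z} (suc zero) p q) (nonneg 5)
                          ; m₀ → stay⁺ s p (at-m {z} zero h h′ e) (nonneg 1) ; m₁ → stay⁺ s q (at-m {z} (suc zero) h h′ e) (nonneg 1)
                          ; e₀ → t }

    row-run : Run ext (λ z → z e₀ ≡ false) (λ z → ∀ v → z v ≡ false) All 2
    row-run = trap Ψ₁ (λ z h → h m₀ , h m₁ , h e₀) (λ z (_ , _ , e) → e)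
        (λ z h → progress₁ z h _ _ refl refl) (λ z z′ h s → step₁ z z′ h s _ _ refl refl)
      (trap Ψ₂ (λ z h → h) (λ z (_ , _ , e) → e) (λ z h → progress₂ z h _ _ refl refl) (λ z z′ h s → step₂ z z′ h s _ _ refl refl)
        (stop λ z h → h))

    hold : ∀ v → cap 2 (rowRole v) ≤ field′ (λ _ → true) v
    hold (inj₁ k)        = subst (1ℤ ≤_) (sym (field-h (λ _ → true) k)) (+≤+ (s≤s z≤n))
    hold (inj₂ (inj₁ k)) = subst (0ℤ ≤_) (sym (field-m (λ _ → true) k)) (+≤+ z≤n)
    hold e₀              = subst (1ℤ ≤_) (sym (field-e (λ _ → true))) (+≤+ (s≤s z≤n))

    row-sym : ∀ i j → rowAdj i j ≡ rowAdj j i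
    row-sym (inj₁ _)        (inj₁ _)        = refl
    row-sym (inj₁ _)        (inj₂ (inj₁ _)) = refl
    row-sym (inj₁ _)        (inj₂ (inj₂ _)) = refl
    row-sym (inj₂ (inj₁ _)) (inj₁ _)        = refl
    row-sym (inj₂ (inj₁ _)) (inj₂ (inj₁ _)) = refl
    row-sym (inj₂ (inj₁ _)) (inj₂ (inj₂ _)) = refl
    row-sym (inj₂ (inj₂ _)) (inj₁ _)        = refl
    row-sym (inj₂ (inj₂ _)) (inj₂ (inj₁ _)) = refl
    row-sym (inj₂ (inj₂ _)) (inj₂ (inj₂ _)) = refl

    row-irr : ∀ i → rowAdj i i ≡ false
    row-irr (inj₁ _)        = refl
    row-irr (inj₂ (inj₁ _)) = refl
    row-irr (inj₂ (inj₂ _)) = refl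

    colour-dem : ∀ {v γ j h} → rowRole v ≡ dem γ j h → rowColour v ≡ o xor parity (toℕ γ)
    colour-dem {inj₂ (inj₁ _)} ()
    colour-dem {inj₂ (inj₂ _)} ()
    colour-dem {inj₁ _} refl = trans (lemma o) (cong (o xor_) (sym odd-γ₁))
      where lemma : ∀ o → not o ≡ o xor true
            lemma true  = refl
            lemma false = refl

    colour-head : ∀ {v γ j} → rowRole v ≡ dem γ j true → rowColour v ≡ not o
    colour-head {inj₁ _} e = refl
    colour-head {inj₂ (inj₁ _)} ()
    colour-head {inj₂ (inj₂ _)} ()

    colour-end : ∀ {v} → rowRole v ≡ end → rowColour v ≡ not o
    colour-end {e₀} e = refl

    ending-unique : ∀ {v} → rowRole v ≡ end → v ≡ e₀
    ending-unique {e₀} e = refl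

    load : ∀ γ j → sum finite (λ v → ind (inSlot γ j (rowRole v))) ≤ + 2
    load γ j with does (γ Fin.≟ γ₁) ∧ does (j Fin.≟ j₁)
    ... | true  = ℤ.≤-refl
    ... | false = +≤+ z≤n

  machine : Machine N ρ o
  machine = record
    { sys = row ; u = 2 ; D = 2 ; η = 2 ; T = 2 ; role = rowRole ; adj-sym = row-sym ; adj-irr = row-irr
    ; colour-dem = λ {v} → colour-dem {v} ; colour-head = λ {v} → colour-head {v} ; colour-end = λ {v} → colour-end {v}
    ; ending = e₀ ; role-ending = refl ; ending-unique = λ {v} → ending-unique {v}
    ; load = load ; heads = refl ; η≤D = ℕ.≤-refl ; 1≤u = s≤s z≤n ; hold = hold ; run = row-run }

-- The external field of the outermost machine comes from a large complete bipartite graph,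
-- none of whose nodes ever becomes switchable.
module Powered {N ρ : ℕ} {o : Bool} (M : Machine N ρ o) where

  private module M = Machine M

  -- The opposite side pulls with weight m, the nodes of the machine together with at most their
  -- number. The surplus u + 1 is also the largest number of links that a node of the machine asks
  -- for on one side.
  m : ℕ
  m = size M.finite ℕ.+ (M.u ℕ.+ 1)

  private
    side : Fin m ⊎ Fin m → Bool
    side (inj₁ _) = false
    side (inj₂ _) = true

    frozen : Sys
    frozen = record { Node = Fin m ⊎ Fin m ; finite = fin m ⊞ fin m ; adj = λ i j → side i xor side j ; colour = side }

    quota : Role N ρ → ℕ
    quota plain       = 0
    quota (dem _ _ h) = M.u ℕ.+ (if h then 1 else 0)
    quota end         = 1

    -- A demanding node is joined to the side that attracts it, the ending to the side that repels
    -- it, since its external field is -1.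
    serves : Fin m → Bool → Role N ρ → Bool
    serves k d r = does (toℕ k ℕ.<? quota r) ∧ (if isEnd r then not d else d)

    link : Fin m ⊎ Fin m → M.Node → Bool
    link (inj₁ k) v = serves k (false xor M.colour v) (M.role v)
    link (inj₂ k) v = serves k (true xor M.colour v) (M.role v)

    open Join frozen M.sys link
    open Sys join

    on : Sys.State frozen
    on _ = true

    none : Ext
    none _ = 0ℤ

    quota≤m : ∀ r → quota r ℕ.≤ m
    quota≤m plain           = z≤n
    quota≤m (dem _ _ true)  = ℕ.m≤n+m (M.u ℕ.+ 1) (size M.finite)
    quota≤m (dem _ _ false) = ℕ.≤-trans (ℕ.+-monoʳ-≤ M.u z≤n) (ℕ.m≤n+m (M.u ℕ.+ 1) (size M.finite))
    quota≤m end             = ℕ.≤-trans (ℕ.m≤n+m 1 M.u) (ℕ.m≤n+m (M.u ℕ.+ 1) (size M.finite))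

    ∑-below : ∀ m q → q ℕ.≤ m → ∑ {m} (λ k → ind (does (toℕ k ℕ.<? q))) ≡ + q
    ∑-below m       zero    z≤n     = ∑-zero {m} λ _ → refl
    ∑-below (suc m) (suc q) (s≤s p) = cong (λ t → 1ℤ + t) (∑-below m q p)

    powered : ∀ v → down on v + 0ℤ ≡ runExt M.u (M.role v)
    powered v = trans (ℤ.+-identityʳ _) (by (M.role v) (M.colour v))
      where
      at : Bool → Bool → Role N ρ → ℤ
      at c b r = ∑ {m} λ k → act (serves k (c xor b) r) (b xor c) true
      away : ∀ c b r → (if isEnd r then not (c xor b) else (c xor b)) ≡ false → at c b r ≡ 0ℤ
      away c b r e = ∑-zero {m} λ k → cong (λ t → act t (b xor c) true)
        (trans (cong (does (toℕ k ℕ.<? quota r) ∧_) e) (∧-zeroʳ _))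
      near : ∀ c b r {d} → (if isEnd r then not (c xor b) else (c xor b)) ≡ true → b xor c ≡ d →
             at c b r ≡ (if d then + quota r else - + quota r)
      near c b r {d} e refl = trans
        (∑-cong {m} λ k → trans (cong (λ t → act t d true) (trans (cong (does (toℕ k ℕ.<? quota r) ∧_) e) (∧-identityʳ _)))
                              (value (does (toℕ k ℕ.<? quota r)) d))
        (total d)
        where
        value : ∀ a d → act a d true ≡ (if d then ind a else - ind a)
        value true  true  = refl
        value true  false = refl
        value false true  = refl
        value false false = refl
        total : ∀ d → ∑ {m} (λ k → if d then ind (does (toℕ k ℕ.<? quota r)) else - ind (does (toℕ k ℕ.<? quota r))) ≡ (if d then + quota r else - + quota r)
        total true  = ∑-below m (quota r) (quota≤m r)
        total false = trans (∑-neg {m} (λ k → ind (does (toℕ k ℕ.<? quota r)))) (cong -_ (∑-below m (quota r) (quota≤m r)))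
      dem-quota : ∀ h → + (M.u ℕ.+ (if h then 1 else 0)) ≡ + M.u + ind h
      dem-quota true  = refl
      dem-quota false = refl
      by : ∀ r b → at false b r + at true b r ≡ runExt M.u r
      by plain b = cong₂ _+_ (∑-zero {m} λ _ → refl) (∑-zero {m} λ _ → refl)
      by r@(dem _ _ h) true  = trans (cong₂ _+_ (near false true r refl refl) (away true true r refl)) (trans (ℤ.+-identityʳ _) (dem-quota h))
      by r@(dem _ _ h) false = trans (cong₂ _+_ (away false false r refl) (near true false r refl refl)) (trans (ℤ.+-identityˡ _) (dem-quota h))
      by end true  = cong₂ _+_ (away false true end refl) (near true true end refl refl)
      by end false = cong₂ _+_ (near false false end refl refl) (away true false end refl)

    solid : ∀ z → (on ×ₛ λ y → y M.ending ≡ false) z → ∀ x → ¬ Unstable none z (inj₁ x)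
    solid z (h , _) x = good⁺ (h x) (subst (0ℤ ≤_) (sym (ℤ.+-identityʳ _))
      (ℤ.≤-trans (nonneg (M.u ℕ.+ 1)) (subst (_≤ Sys.field′ frozen (z ∘ inj₁) x + up x (z ∘ inj₂)) (lemma (+ size M.finite) (+ (M.u ℕ.+ 1)))
        (ℤ.+-mono-≤ (ℤ.≤-reflexive (sym (field-x x))) (-≤sum M.finite λ v → -1≤act (link x v) _ (z (inj₂ v)))))))
      where
      lemma : ∀ a b → (a + b) + - a ≡ b
      lemma = solve-∀
      field-x : ∀ x → Sys.field′ frozen (z ∘ inj₁) x ≡ + m
      field-x (inj₁ k) = trans (cong₂ _+_ (∑-zero {m} λ _ → refl) (trans (∑-cong {m} λ j → cong sp (h (inj₂ j))) (∑-const m))) (ℤ.+-identityˡ _)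
      field-x (inj₂ k) = trans (cong₂ _+_ (trans (∑-cong {m} λ j → cong sp (h (inj₁ j))) (∑-const m)) (∑-zero {m} λ _ → refl)) (ℤ.+-identityʳ _)

    closed-run : Run none (on ×ₛ λ y → y M.ending ≡ false) (on ×ₛ λ y → ∀ v → y v ≡ false) (on ×ₛ λ y → ∀ v → y v ≡ true) M.T
    closed-run = lift on powered solid M.run

    xor-comm-link : ∀ i j → joinAdj i j ≡ joinAdj j i
    xor-comm-link (inj₁ x) (inj₁ y) = xor-sym (side x) (side y)
    xor-comm-link (inj₁ x) (inj₂ v) = refl
    xor-comm-link (inj₂ v) (inj₁ x) = refl
    xor-comm-link (inj₂ v) (inj₂ w) = M.adj-sym v w

    irreflexive : ∀ i → joinAdj i i ≡ false
    irreflexive (inj₁ x) = xor-same (side x)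
    irreflexive (inj₂ v) = M.adj-irr v

    initial : State
    initial (inj₁ x) = true
    initial (inj₂ v) = false

  order : ℕ
  order = (m ℕ.+ m) ℕ.+ size M.finite

  slow : ∀ {B : ℕ → Set} → (∀ k → M.T ℕ.≤ k → B k) → Σ (SimpleGraph order) λ G → Σ (Coloring order) λ x → LowerBoundAllModels G x B
  slow b = graph , colouring initial ,
    lower-bound closed-run (colouring initial) ((λ x → state-colouring initial (inj₁ x)) , (λ v → state-colouring initial (inj₂ v))) b
    where open Realise join xor-comm-link irreflexive

-- The assignment of slots

parity-+ : ∀ a b → parity (a ℕ.+ b) ≡ parity a xor parity b
parity-+ zero    b = refl
parity-+ (suc a) b = trans (cong not (parity-+ a b)) (lemma (parity a) (parity b))
  where
  lemma : ∀ a b → not (a xor b) ≡ not a xor b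
  lemma true  b = not-involutive b
  lemma false b = refl

parity-double : ∀ a → parity (a ℕ.+ a) ≡ false
parity-double a = trans (parity-+ a a) (xor-same (parity a))

bit : Bool → ℕ
bit b = if b then 1 else 0

bit≤1 : ∀ b → bit b ℕ.≤ 1
bit≤1 true  = ℕ.≤-refl
bit≤1 false = z≤n

-- The nodes A (s , γ) of one level are driven by slot number γ mod ρ of the unit 2 (γ / ρ) + b
-- of the next level; the bit b gives that unit the frame colour that makes it attractive.
module Slots (g′ N′ M₂ ρ₂ : ℕ) (fits : suc N′ ℕ.≤ M₂ * ρ₂) where

  place : Fin (suc N′) → Fin M₂ × Fin ρ₂
  place γ = Fin.remQuot {M₂} ρ₂ (Fin.inject≤ γ fits)

  position : Fin M₂ → Bool → ℕ
  position m b = (toℕ m ℕ.+ toℕ m) ℕ.+ bit b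

  position< : ∀ m b → position m b ℕ.< suc (M₂ ℕ.+ M₂)
  position< m b = s≤s (ℕ.≤-trans (ℕ.+-monoʳ-≤ (toℕ m ℕ.+ toℕ m) (bit≤1 b)) (ℕ.≤-trans
    (ℕ.≤-reflexive (trans (ℕ.+-assoc (toℕ m) (toℕ m) 1) (cong (toℕ m ℕ.+_) (ℕ.+-comm (toℕ m) 1))))
    (ℕ.+-mono-≤ (ℕ.<⇒≤ (Fin.toℕ<n m)) (Fin.toℕ<n m))))

  -- The base colour of the next level is `not o`, so the bit must be the negation of the parity
  -- that enters `par`.
  flag : Fin (suc g′) × Fin (suc N′) → Bool
  flag (s , γ) = not (parity (toℕ s) xor parity (toℕ γ))

  -- The M₂ pairs of units leave one further unit, which keeps their number odd.
  slot : Fin (suc g′) × Fin (suc N′) → Fin (suc (M₂ ℕ.+ M₂)) × Fin ρ₂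
  slot q@(s , γ) = Fin.fromℕ< (position< (proj₁ (place γ)) (flag q)) , proj₂ (place γ)

  parity-position : ∀ m b → parity (position m b) ≡ b
  parity-position m b = trans (parity-+ (toℕ m ℕ.+ toℕ m) (bit b)) (trans (cong (_xor parity (bit b)) (parity-double (toℕ m))) (lemma b))
    where lemma : ∀ b → parity (bit b) ≡ b
          lemma true  = refl
          lemma false = refl

  slot-colour : ∀ o q → o xor (parity (toℕ (proj₁ q)) xor parity (toℕ (proj₂ q))) ≡ not o xor parity (toℕ (proj₁ (slot q)))
  slot-colour o q@(s , γ) = trans (sym (not-xor-not o (parity (toℕ s) xor parity (toℕ γ))))
    (cong (not o xor_) (sym (trans (cong parity (Fin.toℕ-fromℕ< (position< (proj₁ (place γ)) (flag q)))) (parity-position (proj₁ (place γ)) (flag q)))))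

  slot-injective : ∀ s γ δ → slot (s , γ) ≡ slot (s , δ) → γ ≡ δ
  slot-injective s γ δ e = Fin.inject≤-injective fits fits γ δ (trans (sym (Fin.combine-remQuot {M₂} ρ₂ _))
    (trans (cong₂ Fin.combine (Fin.toℕ-injective halves) (cong proj₂ e)) (Fin.combine-remQuot {M₂} ρ₂ _)))
    where
    a = toℕ (proj₁ (place γ))
    b = toℕ (proj₁ (place δ))
    positions : position (proj₁ (place γ)) (flag (s , γ)) ≡ position (proj₁ (place δ)) (flag (s , δ))
    positions = trans (sym (Fin.toℕ-fromℕ< (position< (proj₁ (place γ)) (flag (s , γ)))))
      (trans (cong (toℕ ∘ proj₁) e) (Fin.toℕ-fromℕ< (position< (proj₁ (place δ)) (flag (s , δ)))))
    flags : flag (s , γ) ≡ flag (s , δ)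
    flags = trans (sym (parity-position (proj₁ (place γ)) (flag (s , γ)))) (trans (cong parity positions) (parity-position (proj₁ (place δ)) (flag (s , δ))))
    doubles : a ℕ.+ a ≡ b ℕ.+ b
    doubles = ℕ.+-cancelʳ-≡ (bit (flag (s , δ))) _ _ (trans (cong (λ f → (a ℕ.+ a) ℕ.+ bit f) (sym flags)) positions)
    halves : a ≡ b
    halves = trans (ℕ.n≡⌊n+n/2⌋ a) (trans (cong ℕ.⌊_/2⌋ doubles) (sym (ℕ.n≡⌊n+n/2⌋ b)))

-- 5 is the size of the bottom row. A level adds at most 9 times the number of its nodes A. In the
-- bound for that number, 18 is the product of 3 from `2 * half + 1 ≤ 3 * half`, 3 from `ρ = 3 * g`
-- and the initial strength 2.
nodeBound : ℕ → ℕ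
nodeBound zero    = 5
nodeBound (suc i) = 9 * (18 * 4 ^ i) ℕ.+ nodeBound i

-- The factor 4 comes from 1 + 3 g u ≤ 4 g u.
strengthBound : ℕ → ℕ
strengthBound i = 2 * 4 ^ i

orderBound : ℕ → ℕ
orderBound i = (half ℕ.+ half) ℕ.+ nodeBound i
  where half = nodeBound i ℕ.+ (strengthBound i ℕ.+ 1)

-- Each level multiplies the number of waves by g, and all levels have O(g ^ (K + 2)) nodes.
module Tower (h K : ℕ) where

  g′ g ρ : ℕ
  g′ = suc h ℕ.+ suc h
  g  = suc g′
  ρ  = 3 * g

  -- Level i has `2 * half i + 1` units per segment, an odd number. At `suc K`, above the last
  -- level, truncated subtraction gives the value 1.
  half : ℕ → ℕ
  half i = g ^ (K ∸ i)

  1≤half : ∀ i → 1 ℕ.≤ half i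
  1≤half i = ℕ.m^n>0 g (K ∸ i)

  3≤g : 3 ℕ.≤ g
  3≤g = s≤s (s≤s (subst (1 ℕ.≤_) (sym (ℕ.+-suc h h)) (s≤s z≤n)))

  half≤ : ∀ i → half i ℕ.≤ g * half (suc i)
  half≤ i = ℕ.^-monoʳ-≤ g (subst (K ∸ i ℕ.≤_) (cong suc (ℕ.pred[m∸n]≡m∸[1+n] K i)) (lemma (K ∸ i)))
    where
    lemma : ∀ n → n ℕ.≤ suc (ℕ.pred n)
    lemma zero    = z≤n
    lemma (suc n) = ℕ.≤-refl

  fits : ∀ i → suc (half i ℕ.+ half i) ℕ.≤ half (suc i) * ρ
  fits i = begin
    suc (half i ℕ.+ half i)        ≤⟨ ℕ.+-monoˡ-≤ (half i ℕ.+ half i) (1≤half i) ⟩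
    half i ℕ.+ (half i ℕ.+ half i) ≡⟨ cong (λ t → half i ℕ.+ (half i ℕ.+ t)) (sym (ℕ.+-identityʳ (half i))) ⟩
    3 * half i                   ≤⟨ ℕ.*-monoʳ-≤ 3 (half≤ i) ⟩
    3 * (g * half (suc i))     ≡⟨ sym (ℕ.*-assoc 3 g (half (suc i))) ⟩
    ρ * half (suc i)             ≡⟨ ℕ.*-comm ρ (half (suc i)) ⟩
    half (suc i) * ρ             ∎
    where open ℕ.≤-Reasoning

  Level : ℕ → Set₁
  Level i = Σ[ M ∈ Machine (suc (half i ℕ.+ half i)) ρ (parity i) ] Machine.D M ℕ.≤ g * Machine.u M

  -- `ρ = 3 * g` provides three shares `g * u`: one covers D, the other two are at least 6 together
  -- and cover the 5.
  light : ∀ i ((M , _) : Level i) → Machine.D M ℕ.+ 5 ℕ.≤ ρ * Machine.u M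
  light i (M , D≤) = begin
    D ℕ.+ 5                              ≤⟨ ℕ.+-mono-≤ D≤ five ⟩
    g * u ℕ.+ (g * u ℕ.+ g * u)    ≡⟨ cong (λ t → g * u ℕ.+ (g * u ℕ.+ t)) (sym (ℕ.+-identityʳ (g * u))) ⟩
    3 * (g * u)                      ≡⟨ sym (ℕ.*-assoc 3 g u) ⟩
    ρ * u                              ∎
    where
    open ℕ.≤-Reasoning
    open Machine M using (D; u; 1≤u)
    3≤gu : 3 ℕ.≤ g * u
    3≤gu = ℕ.*-mono-≤ 3≤g 1≤u
    five : 5 ℕ.≤ g * u ℕ.+ g * u
    five = ℕ.≤-trans (ℕ.n≤1+n 5) (ℕ.+-mono-≤ 3≤gu 3≤gu)

  base : Level 0
  base = Base.machine false (Fin.fromℕ< one<) (cong parity (Fin.toℕ-fromℕ< one<)) zero , ℕ.m≤n*m 2 g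
    where
    one< : 1 ℕ.< suc (half 0 ℕ.+ half 0)
    one< = s≤s (ℕ.≤-trans (1≤half 0) (ℕ.m≤m+n (half 0) (half 0)))

  double≢0 : ∀ i → half i ℕ.+ half i ≢ 0
  double≢0 i e = ℕ.<⇒≢ (ℕ.≤-trans (1≤half i) (ℕ.m≤m+n (half i) (half i))) (sym e)

  raise : ∀ i → Level i → Level (suc i)
  raise i L@(M , _) = Next.machine , ℕ.*-monoʳ-≤ g (ℕ.n≤1+n _)
    where
    module S = Slots g′ (half i ℕ.+ half i) (half (suc i)) ρ (fits i)
    module Next = NextMachine g′ (half i ℕ.+ half i) (parity i) (parity-double (suc h)) (parity-double (half i)) (double≢0 i)
                              ρ M (light i L) S.slot (S.slot-colour (parity i)) S.slot-injective

  tower : ∀ i → Level i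
  tower zero    = base
  tower (suc i) = raise i (tower i)

  strength stages nodes : ℕ → ℕ
  strength i = Machine.u (proj₁ (tower i))
  stages i   = Machine.T (proj₁ (tower i))
  nodes i    = size (Machine.finite (proj₁ (tower i)))

  heads≤ : ∀ i → Machine.η (proj₁ (tower i)) ℕ.≤ strength i
  heads≤ zero    = ℕ.≤-refl
  heads≤ (suc i) = ℕ.n≤1+n _

  units : ℕ → ℕ
  units i = g * suc (half i ℕ.+ half i)

  private instance
    g-NonZero : ℕ.NonZero g
    g-NonZero = _

  open ℕ.≤-Reasoning

  1≤strength : ∀ i → 1 ℕ.≤ strength i
  1≤strength i = Machine.1≤u (proj₁ (tower i))

  strength≥ : ∀ i → g ^ i ℕ.≤ strength i
  strength≥ zero    = s≤s z≤n
  strength≥ (suc i) = begin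
    g * g ^ i            ≤⟨ ℕ.*-mono-≤ (ℕ.m≤n*m g 3) (strength≥ i) ⟩
    ρ * strength i         ≤⟨ ℕ.n≤1+n _ ⟩
    suc (ρ * strength i)   ∎

  strength≤ : ∀ i → strength i ℕ.≤ strengthBound i * g ^ i
  strength≤ zero    = ℕ.≤-refl
  strength≤ (suc i) = begin
    1 ℕ.+ ρ * strength i                    ≤⟨ ℕ.+-monoˡ-≤ (ρ * strength i) (ℕ.*-mono-≤ {1} {g} (s≤s z≤n) (1≤strength i)) ⟩
    g * strength i ℕ.+ ρ * strength i     ≡⟨ lemma₁ g (strength i) ⟩
    4 * g * strength i                    ≤⟨ ℕ.*-monoʳ-≤ (4 * g) (strength≤ i) ⟩
    4 * g * (2 * 4 ^ i * g ^ i)   ≡⟨ lemma₂ g (4 ^ i) (g ^ i) ⟩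
    2 * (4 * 4 ^ i) * (g * g ^ i) ∎
    where
    lemma₁ : ∀ g s → g * s ℕ.+ 3 * g * s ≡ 4 * g * s
    lemma₁ = ℕSolver.solve-∀
    lemma₂ : ∀ g x y → 4 * g * (2 * x * y) ≡ 2 * (4 * x) * (g * y)
    lemma₂ = ℕSolver.solve-∀

  -- The units of the first level alone give g ^ (K + 1) stages, and each further level repeats the
  -- wave below once per segment.
  stages≥ : ∀ i → g ^ (i ℕ.+ suc K) ℕ.≤ stages (suc i)
  stages≥ zero = ℕ.*-monoʳ-≤ g (ℕ.≤-trans (ℕ.m≤m+n (half 0) (half 0)) (ℕ.m≤m+n _ _))
  stages≥ (suc i) = ℕ.*-monoʳ-≤ g (begin
    g ^ (i ℕ.+ suc K)                                                       ≤⟨ stages≥ i ⟩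
    stages (suc i)                                                            ≤⟨ ℕ.m≤m+n _ 1 ⟩
    stages (suc i) ℕ.+ 1                                                      ≤⟨ ℕ.n≤1+n _ ⟩
    1 ℕ.+ (stages (suc i) ℕ.+ 1)                                              ≤⟨ ℕ.m≤n+m _ (half (suc i) ℕ.+ half (suc i)) ⟩
    (half (suc i) ℕ.+ half (suc i)) ℕ.+ (1 ℕ.+ (stages (suc i) ℕ.+ 1))        ∎)

  weight : ℕ → ℕ
  weight i = units i * (ρ * strength i)

  -- The product `half i * g ^ i` is g ^ K for every i ≤ K; the two remaining factors g come from
  -- the segments and from ρ.
  weight≤ : ∀ {i} → i ℕ.≤ K → weight i ℕ.≤ (18 * 4 ^ i) * g ^ suc (suc K)
  weight≤ {i} i≤K = begin
    g * suc (half i ℕ.+ half i) * (ρ * strength i)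
      ≤⟨ ℕ.*-mono-≤ (ℕ.*-monoʳ-≤ g (ℕ.+-monoˡ-≤ (half i ℕ.+ half i) (1≤half i))) (ℕ.*-monoʳ-≤ ρ (strength≤ i)) ⟩
    g * (half i ℕ.+ (half i ℕ.+ half i)) * (ρ * (2 * 4 ^ i * g ^ i))
      ≡⟨ lemma g (half i) (4 ^ i) (g ^ i) ⟩
    (18 * 4 ^ i) * (g * (g * (half i * g ^ i)))
      ≡⟨ cong (λ t → (18 * 4 ^ i) * (g * (g * t))) (trans (sym (ℕ.^-distribˡ-+-* g (K ∸ i) i)) (cong (g ^_) (ℕ.m∸n+n≡m i≤K))) ⟩
    (18 * 4 ^ i) * g ^ suc (suc K) ∎
    where
    lemma : ∀ g H x y → g * (H ℕ.+ (H ℕ.+ H)) * (3 * g * (2 * x * y)) ≡ (18 * x) * (g * (g * (H * y)))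
    lemma = ℕSolver.solve-∀

  -- 9 = 1 + 1 + 3 + 1 + 1 + 1 + 1, for the groups A, S, Z, E, X, G and W measured in multiples of
  -- `weight i`.
  nodes-step : ∀ i → nodes (suc i) ℕ.≤ 9 * weight i ℕ.+ nodes i
  nodes-step i = ℕ.+-monoˡ-≤ (nodes i) (begin
    w ℕ.+ (w ℕ.+ (Q * 3 ℕ.+ (Q ℕ.+ (Q ℕ.+ (g * η ℕ.+ g)))))
      ≤⟨ ℕ.+-monoʳ-≤ w (ℕ.+-monoʳ-≤ w (ℕ.+-mono-≤ (ℕ.*-monoˡ-≤ 3 Q≤w) (ℕ.+-mono-≤ Q≤w (ℕ.+-mono-≤ Q≤w (ℕ.+-mono-≤ gη≤w (ℕ.≤-trans g≤Q Q≤w)))))) ⟩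
    w ℕ.+ (w ℕ.+ (w * 3 ℕ.+ (w ℕ.+ (w ℕ.+ (w ℕ.+ w)))))
      ≡⟨ lemma w ⟩
    9 * w ∎)
    where
    w = weight i
    Q = units i
    η = Machine.η (proj₁ (tower i))
    strength≤σ : strength i ℕ.≤ ρ * strength i
    strength≤σ = ℕ.m≤n*m (strength i) ρ
    Q≤w : Q ℕ.≤ w
    Q≤w = ℕ.≤-trans (ℕ.≤-reflexive (sym (ℕ.*-identityʳ Q))) (ℕ.*-monoʳ-≤ Q (ℕ.≤-trans (1≤strength i) strength≤σ))
    g≤Q : g ℕ.≤ Q
    g≤Q = ℕ.m≤m*n g (suc (half i ℕ.+ half i))
    gη≤w : g * η ℕ.≤ w
    gη≤w = ℕ.*-mono-≤ g≤Q (ℕ.≤-trans (heads≤ i) strength≤σ)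
    lemma : ∀ w → w ℕ.+ (w ℕ.+ (w * 3 ℕ.+ (w ℕ.+ (w ℕ.+ (w ℕ.+ w))))) ≡ 9 * w
    lemma = ℕSolver.solve-∀

  1≤G : 1 ℕ.≤ g ^ suc (suc K)
  1≤G = ℕ.m^n>0 g (suc (suc K))

  nodes≤ : ∀ {i} → i ℕ.≤ suc K → nodes i ℕ.≤ nodeBound i * g ^ suc (suc K)
  nodes≤ {zero}  _       = ℕ.*-monoʳ-≤ 5 1≤G
  nodes≤ {suc i} (s≤s h) = begin
    nodes (suc i)                                                ≤⟨ nodes-step i ⟩
    9 * weight i ℕ.+ nodes i                                   ≤⟨ ℕ.+-mono-≤ (ℕ.*-monoʳ-≤ 9 (weight≤ h)) (nodes≤ (ℕ.m≤n⇒m≤1+n h)) ⟩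
    9 * (18 * 4 ^ i * G) ℕ.+ nodeBound i * G           ≡⟨ lemma (18 * 4 ^ i) (nodeBound i) G ⟩
    nodeBound (suc i) * G                                      ∎
    where
    G = g ^ suc (suc K)
    lemma : ∀ a b G → 9 * (a * G) ℕ.+ b * G ≡ (9 * a ℕ.+ b) * G
    lemma = ℕSolver.solve-∀

  open Powered (proj₁ (tower (suc K))) public using (order; slow; m)

  order≤ : order ℕ.≤ orderBound (suc K) * g ^ suc (suc K)
  order≤ = begin
    (m ℕ.+ m) ℕ.+ nodes (suc K)                          ≤⟨ ℕ.+-mono-≤ (ℕ.+-mono-≤ m≤ m≤) (nodes≤ ℕ.≤-refl) ⟩
    (a * G ℕ.+ a * G) ℕ.+ nodeBound (suc K) * G    ≡⟨ lemma a (nodeBound (suc K)) G ⟩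
    ((a ℕ.+ a) ℕ.+ nodeBound (suc K)) * G              ∎
    where
    G = g ^ suc (suc K)
    a = nodeBound (suc K) ℕ.+ (strengthBound (suc K) ℕ.+ 1)
    lemma : ∀ a b G → (a * G ℕ.+ a * G) ℕ.+ b * G ≡ ((a ℕ.+ a) ℕ.+ b) * G
    lemma = ℕSolver.solve-∀
    lemma′ : ∀ b c G → b * G ℕ.+ (c * G ℕ.+ 1 * G) ≡ (b ℕ.+ (c ℕ.+ 1)) * G
    lemma′ = ℕSolver.solve-∀
    m≤ : m ℕ.≤ a * G
    m≤ = begin
      nodes (suc K) ℕ.+ (strength (suc K) ℕ.+ 1)
        ≤⟨ ℕ.+-mono-≤ (nodes≤ ℕ.≤-refl) (ℕ.+-mono-≤
             (ℕ.≤-trans (strength≤ (suc K)) (ℕ.*-monoʳ-≤ (strengthBound (suc K)) (ℕ.^-monoʳ-≤ g (ℕ.n≤1+n (suc K)))))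
             (ℕ.≤-trans 1≤G (ℕ.≤-reflexive (sym (ℕ.*-identityˡ G))))) ⟩
      nodeBound (suc K) * G ℕ.+ (strengthBound (suc K) * G ℕ.+ 1 * G)
        ≡⟨ lemma′ (nodeBound (suc K)) (strengthBound (suc K)) G ⟩
      a * G ∎

  order≥ : g ^ suc K ℕ.≤ order
  order≥ = begin
    g ^ suc K            ≤⟨ strength≥ (suc K) ⟩
    strength (suc K)       ≤⟨ ℕ.m≤m+n _ 1 ⟩
    strength (suc K) ℕ.+ 1 ≤⟨ ℕ.m≤n+m _ (nodes (suc K)) ⟩
    m                      ≤⟨ ℕ.m≤m+n m m ⟩
    m ℕ.+ m                ≤⟨ ℕ.m≤m+n (m ℕ.+ m) _ ⟩
    order                  ∎

-- The exponent 2 - ε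

^-distribʳ-* : ∀ m n k → (m * n) ^ k ≡ m ^ k * n ^ k
^-distribʳ-* m n zero    = refl
^-distribʳ-* m n (suc k) = trans (cong (m * n *_) (^-distribʳ-* m n k)) (lemma m n (m ^ k) (n ^ k))
  where lemma : ∀ a b c d → a * b * (c * d) ≡ a * c * (b * d)
        lemma = ℕSolver.solve-∀

-- With n ≤ E g^(3q+1) and k ≥ g^(6q-1) one has n² ≤ E² g³ k, and n ≥ g^(3q) absorbs the factor g³.
bound-holds : ∀ {g n k E} p q K → suc K ≡ 3 * q → 1 ℕ.≤ p → 1 ℕ.≤ n → n ℕ.≤ E * g ^ suc (suc K) → g ^ suc K ℕ.≤ n →
              g ^ (K ℕ.+ suc K) ℕ.≤ k → AtLeastCN2minusEps p q 1 (E * E) n k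
bound-holds {g} {n} {k} {E} (suc p) q K 1+K≡3q _ 1≤n n≤ ≤n ≤k = begin
  1 ^ q * n ^ (2 * q)                              ≡⟨ trans (cong (ℕ._* n ^ (2 * q)) (ℕ.^-zeroˡ q)) (ℕ.*-identityˡ _) ⟩
  n ^ (2 * q)                                          ≡⟨ sym (ℕ.^-*-assoc n 2 q) ⟩
  (n ^ 2) ^ q                                          ≤⟨ ℕ.^-monoˡ-≤ q square ⟩
  (E * E * (k * g ^ 3)) ^ q                      ≡⟨ trans (^-distribʳ-* (E * E) _ q) (cong ((E * E) ^ q *_) (^-distribʳ-* k (g ^ 3) q)) ⟩
  (E * E) ^ q * (k ^ q * (g ^ 3) ^ q)        ≡⟨ sym (ℕ.*-assoc ((E * E) ^ q) _ _) ⟩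
  (E * E) ^ q * k ^ q * (g ^ 3) ^ q          ≤⟨ ℕ.*-monoʳ-≤ ((E * E) ^ q * k ^ q) slack ⟩
  (E * E) ^ q * k ^ q * n ^ suc p              ∎
  where
  open ℕ.≤-Reasoning
  instance
    n-NonZero : ℕ.NonZero n
    n-NonZero = ℕ.>-nonZero 1≤n
  slack : (g ^ 3) ^ q ℕ.≤ n ^ suc p
  slack = begin
    (g ^ 3) ^ q ≡⟨ trans (ℕ.^-*-assoc g 3 q) (cong (g ^_) (sym 1+K≡3q)) ⟩
    g ^ suc K     ≤⟨ ≤n ⟩
    n               ≤⟨ ℕ.m≤m*n n (n ^ p) {{ℕ.m^n≢0 n p}} ⟩
    n ^ suc p     ∎
  G = g ^ K
  square : n ^ 2 ℕ.≤ E * E * (k * g ^ 3)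
  square = begin
    n ^ 2                                                          ≤⟨ ℕ.^-monoˡ-≤ 2 n≤ ⟩
    (E * g ^ suc (suc K)) ^ 2                                  ≡⟨ lemma E g G ⟩
    E * E * (G * (g * G) * g ^ 3)                        ≡⟨ cong (λ t → E * E * (t * g ^ 3)) (sym (ℕ.^-distribˡ-+-* g K (suc K))) ⟩
    E * E * (g ^ (K ℕ.+ suc K) * g ^ 3)                    ≤⟨ ℕ.*-monoʳ-≤ (E * E) (ℕ.*-monoˡ-≤ (g ^ 3) ≤k) ⟩
    E * E * (k * g ^ 3)                                      ∎
    where
    lemma : ∀ E g G → E * (g * (g * G)) * (E * (g * (g * G)) * 1) ≡ E * E * (G * (g * G) * (g * (g * (g * 1))))
    lemma = ℕSolver.solve-∀

-- The parameter h only makes the graph large, through g = 2 h + 3; the constant depends on K alone.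
slow-graph : ∀ h K p q → suc K ≡ 3 * q → 1 ℕ.≤ p →
             ∃ λ n → h ℕ.≤ n × Σ (SimpleGraph n) λ G → Σ (Coloring n) λ x →
               LowerBoundAllModels G x (AtLeastCN2minusEps p q 1 (orderBound (suc K) * orderBound (suc K)) n)
slow-graph h K p q e 1≤p = order , ℕ.≤-trans h≤g (ℕ.≤-trans g≤g^ order≥) ,
  slow λ k T≤k → bound-holds {g} {order} {k} {orderBound (suc K)} p q K e 1≤p 1≤order order≤ order≥ (ℕ.≤-trans (stages≥ K) T≤k)
  where
  open Tower h K
  1≤order : 1 ℕ.≤ order
  1≤order = ℕ.≤-trans (ℕ.m^n>0 g (suc K)) order≥
  h≤g : h ℕ.≤ g
  h≤g = ℕ.≤-trans (ℕ.n≤1+n h) (ℕ.≤-trans (ℕ.m≤m+n (suc h) (suc h)) (ℕ.n≤1+n g′))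
  g≤g^ : g ℕ.≤ g ^ suc K
  g≤g^ = ℕ.m≤m*n g (g ^ K) {{ℕ.m^n≢0 g K}}

1≤orderBound : ∀ i → 1 ℕ.≤ orderBound i
1≤orderBound i = ℕ.≤-trans (ℕ.≤-trans (ℕ.m≤n+m 1 (strengthBound i)) (ℕ.m≤n+m (strengthBound i ℕ.+ 1) (nodeBound i)))
  (ℕ.≤-trans (ℕ.m≤m+n half half) (ℕ.m≤m+n (half ℕ.+ half) (nodeBound i)))
  where half = nodeBound i ℕ.+ (strengthBound i ℕ.+ 1)

theorem4 : (p q : ℕ) → 1 ℕ.≤ p → 1 ℕ.≤ q →
    ∃ λ a → ∃ λ b → 1 ℕ.≤ a × 1 ℕ.≤ b ×
      ((N : ℕ) → ∃ λ n → N ℕ.≤ n × Σ (SimpleGraph n) λ G → Σ (Coloring n) λ x →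
        LowerBoundAllModels G x (AtLeastCN2minusEps p q a b n))
theorem4 p (suc q) 1≤p _ = 1 , E * E , ℕ.≤-refl , ℕ.*-mono-≤ (1≤orderBound (suc K)) (1≤orderBound (suc K)) ,
  λ N → slow-graph N K p (suc q) refl 1≤p
  where
  -- K is written so that `suc K ≡ 3 * suc q` holds by `refl`. E is independent of N, so one
  -- constant serves graphs of all sizes.
  K E : ℕ
  K = q ℕ.+ (suc q ℕ.+ (suc q ℕ.+ 0))
  E = orderBound (suc K)
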